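{- If $\mathcal{P}$ is an order-hereditary property of $k$-colourings of (the edges of) the sequence of hypercube graphs $\mathbf{Q}=(Q_n)_{n\in\mathbb{N}}$, with $\mathcal{P}_n\ne\emptyset$ for every $n$, then $$|\mathcal{P}_n|=k^{\left(\pi^{\mathbf{Q}}(\mathcal{P})+o(1)\right)2^{n-1}n}\qquad(n\to\infty).$$
   Context: $k\ge2$ is a fixed integer, $[k]=\{1,\dots,k\}$. $Q_n$ is the $n$-dimensional hypercube graph on vertex set $\{0,1\}^n$, with two vertices adjacent iff they differ in exactly one coordinate; $e(Q_n)=n2^{n-1}$. For $m\le n$, an order-preserving embedding of $Q_m$ into $Q_n$ is a map $\phi:\{0,1\}^m\to\{0,1\}^n$ for which there is an $m$-set $B=\{b_1<\dots<b_m\}\subseteq[n]$ such that $\phi(\mathbf{x})_{b_j}=\mathbf{x}_j$ for all $j$, and $\phi(\mathbf{x})_i=\phi(\mathbf{0})_i$ for $i\notin B$. An order-hereditary property of $k$-colourings of $\mathbf{Q}$ is a sequence $\mathcal{P}=(\mathcal{P}_n)_n$, where $\mathcal{P}_n$ is a set of maps $c:E(Q_n)\to[k]$, such that for every $c\in\mathcal{P}_n$ and every order-preserving embedding $\phi:Q_m\to Q_n$, the colouring $\mathbf{x}\mathbf{y}\mapsto c(\phi(\mathbf{x})\phi(\mathbf{y}))$ of $E(Q_m)$ lies in $\mathcal{P}_m$. A template for $Q_n$ is a function $t$ assigning to each edge $e$ of $Q_n$ a nonempty set $t(e)\subseteq[k]$; $\langle t\rangle$ is the set of $c:E(Q_n)\to[k]$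 with $c(e)\in t(e)$ for all $e$; $\mathrm{Ent}(t)=\sum_{e\in E(Q_n)}\log_k|t(e)|$. $\mathrm{ex}(Q_n,\mathcal{P})=\max\{\mathrm{Ent}(t):\langle t\rangle\subseteq\mathcal{P}_n\}$, and $\pi^{\mathbf{Q}}(\mathcal{P})=\lim_{n\to\infty}\mathrm{ex}(Q_n,\mathcal{P})/(n2^{n-1})$ (the limit exists). -}

module Defs where

open import Data.Bool.Base using (Bool; true; false)
import Data.Bool.Properties as Bool
open import Data.Empty using (⊥; ⊥-elim)
open import Data.Fin.Base as Fin using (Fin; zero; suc)
import Data.Fin.Properties as Fin
open import Data.Fin.Subset using (Subset; Nonempty; _∈_; ∣_∣; ⁅_⁆)
open import Data.Fin.Subset.Properties using (x∈⁅y⁆⇒x≡y; p⊆q⇒∣p∣≤∣q∣; ∣⁅x⁆∣≡1)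
open import Data.Integer.Base as ℤ using (+_; -[1+_])
import Data.Integer.Properties as ℤ
open import Data.List.Base as List using (List; []; _∷_; foldr; map; length; allFin; cartesianProductWith)
open import Data.List.Membership.Propositional using () renaming (_∈_ to _∈ₗ_)
open import Data.List.Membership.Propositional.Properties using (∈-cartesianProductWith⁺; ∈-allFin)
open import Data.List.Properties using (length-++; length-map; length-tabulate)
open import Data.List.Relation.Unary.All as All using ([]; _∷_)
open import Data.List.Relation.Unary.AllPairs using ([]; _∷_)
open import Data.List.Relation.Unary.Any using (here; there)
open import Data.List.Relation.Unary.Unique.Propositional using (Unique)
import Data.List.Relation.Unary.Unique.Propositional.Properties as Unique
open import Data.Nat.Base as ℕ using (ℕ; zero; suc; NonZero; NonTrivial; z≤n; s≤s)
import Data.Nat.Properties as ℕ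
open import Data.Product.Base using (Σ; ∃; ∃-syntax; _×_; _,_; proj₁; proj₂)
open import Data.Rational.Unnormalised.Base as ℚ using (ℚᵘ; mkℚᵘ; 0ℚᵘ; 1ℚᵘ; *≤*; *<*; *≡*)
import Data.Rational.Unnormalised.Properties as ℚ
open import Data.Rational.Unnormalised.Solver using (module +-*-Solver)
open import Data.Sum.Base using (_⊎_; inj₁; inj₂)
open import Data.Vec.Base using (Vec; []; _∷_; lookup; replicate; _[_]≔_; insertAt; removeAt)
open import Data.Vec.Properties
  using (lookup∘update; lookup∘update′; insertAt-lookup; insertAt-removeAt; removeAt-insertAt; ∷-injective)
open import Data.Vec.Relation.Binary.Pointwise.Extensional using (ext; Pointwise-≡⇒≡)
open import Function.Base using (_∘_; case_of_)
open import Function.Bundles using (Inverse)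
open import Level using (0ℓ)
open import Relation.Binary.Bundles using (Setoid)
import Relation.Binary.Construct.On as On
open import Relation.Binary.Definitions using (tri<; tri≈; tri>)
open import Relation.Binary.PropositionalEquality
  using (_≡_; _≢_; _≗_; refl; sym; trans; cong; cong₂; subst; subst₂; setoid; _→-setoid_)
open import Relation.Nullary using (yes; no; recompute)

∣-∣≤ : ∀ p q ε → p ℚ.≤ q ℚ.+ ε → q ℚ.≤ p ℚ.+ ε → ℚ.∣ p ℚ.- q ∣ ℚ.≤ ε
∣-∣≤ p q ε p≤ q≤ with ℚ.∣p∣≡p∨∣p∣≡-p (p ℚ.- q)
... | inj₁ eq rewrite eq = begin
  p ℚ.- q            ≤⟨ ℚ.+-monoˡ-≤ (ℚ.- q) p≤ ⟩
  q ℚ.+ ε ℚ.- q      ≃⟨ solve 2 (λ q e → q :+ e :- q := e) ℚ.≃-refl q ε ⟩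
  ε                  ∎
  where open ℚ.≤-Reasoning ; open +-*-Solver
... | inj₂ eq rewrite eq = begin
  ℚ.- (p ℚ.- q)      ≃⟨ solve 2 (λ p q → :- (p :- q) := q :- p) ℚ.≃-refl p q ⟩
  q ℚ.- p            ≤⟨ ℚ.+-monoˡ-≤ (ℚ.- p) q≤ ⟩
  p ℚ.+ ε ℚ.- p      ≃⟨ solve 2 (λ q e → q :+ e :- q := e) ℚ.≃-refl p ε ⟩
  ε                  ∎
  where open ℚ.≤-Reasoning ; open +-*-Solver

archimedean : ∀ ε → 0ℚᵘ ℚ.< ε → ∃[ N ] ∀ n → N ℕ.≤ n → mkℚᵘ (+ 1) n ℚ.≤ ε
archimedean (mkℚᵘ (+ zero)  d) (*<* (ℤ.+<+ ()))
archimedean (mkℚᵘ -[1+ p ]  d) (*<* ())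
archimedean (mkℚᵘ (+ suc p) d) _ = d , λ n d≤n → *≤* (ℤ.+≤+ (begin
  suc d ℕ.+ 0               ≡⟨ ℕ.+-identityʳ (suc d) ⟩
  suc d                     ≤⟨ s≤s d≤n ⟩
  suc n                     ≤⟨ ℕ.m≤m+n (suc n) (p ℕ.* suc n) ⟩
  suc p ℕ.* suc n           ∎))
  where open ℕ.≤-Reasoning

half>0 : ∀ {ε} → 0ℚᵘ ℚ.< ε → 0ℚᵘ ℚ.< ℚ.½ ℚ.* ε
half>0 {ε} 0<ε = ℚ.positive⁻¹ _ {{ℚ.pos*pos⇒pos ℚ.½ ε {{ℚ.positive 0<ε}}}}

half+half : ∀ ε → ℚ.½ ℚ.* ε ℚ.+ ℚ.½ ℚ.* ε ℚ.≃ ε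
half+half ε = ℚ.≃-trans (ℚ.≃-sym (ℚ.*-distribʳ-+ ε ℚ.½ ℚ.½))
                (ℚ.≃-trans (ℚ.*-congʳ {ε} (*≡* {ℚ.½ ℚ.+ ℚ.½} {1ℚᵘ} refl)) (ℚ.*-identityˡ ε))

-- Cauchy sequences of rationals, up to _≃ᵣ_; r • x is multiplication by a rational.
record ℝ : Set where
  field
    seq    : ℕ → ℚᵘ
    cauchy : ∀ ε → 0ℚᵘ ℚ.< ε →
             ∃[ N ] ∀ m n → N ℕ.≤ m → N ℕ.≤ n → ℚ.∣ seq m ℚ.- seq n ∣ ℚ.≤ ε

open ℝ public

infix  4 _≤ᵣ_ _<ᵣ_ _≃ᵣ_
infixl 6 _+ᵣ_ _-ᵣ_
infixr 7 _•_
infix  8 -ᵣ_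

_≤ᵣ_ : ℝ → ℝ → Set
x ≤ᵣ y = ∀ ε → 0ℚᵘ ℚ.< ε → ∃[ N ] ∀ n → N ℕ.≤ n → seq x n ℚ.≤ seq y n ℚ.+ ε

_<ᵣ_ : ℝ → ℝ → Set
x <ᵣ y = ∃[ ε ] 0ℚᵘ ℚ.< ε × ∃[ N ] ∀ n → N ℕ.≤ n → seq x n ℚ.+ ε ℚ.≤ seq y n

_≃ᵣ_ : ℝ → ℝ → Set
x ≃ᵣ y = x ≤ᵣ y × y ≤ᵣ x

fromℚ : ℚᵘ → ℝ
fromℚ q = record
  { seq    = λ _ → q
  ; cauchy = λ ε 0<ε → 0 , λ _ _ _ _ →
      ℚ.≤-trans (ℚ.≤-reflexive (ℚ.∣-∣-cong (ℚ.+-inverseʳ q))) (ℚ.<⇒≤ 0<ε)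
  }

0ᵣ : ℝ
0ᵣ = fromℚ 0ℚᵘ

_+ᵣ_ : ℝ → ℝ → ℝ
x +ᵣ y = record
  { seq    = λ n → seq x n ℚ.+ seq y n
  ; cauchy = λ ε 0<ε →
      let (M , hM) = cauchy x _ (half>0 0<ε) ; (N , hN) = cauchy y _ (half>0 0<ε) in
      M ℕ.⊔ N , λ m n m≥ n≥ →
        let a = seq x m ; b = seq y m ; c = seq x n ; d = seq y n in begin
        ℚ.∣ (a ℚ.+ b) ℚ.- (c ℚ.+ d) ∣
          ≃⟨ ℚ.∣-∣-cong (solve 4 (λ a b c d → (a :+ b) :- (c :+ d) := (a :- c) :+ (b :- d))
                           ℚ.≃-refl a b c d) ⟩
        ℚ.∣ (a ℚ.- c) ℚ.+ (b ℚ.- d) ∣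
          ≤⟨ ℚ.∣p+q∣≤∣p∣+∣q∣ (a ℚ.- c) (b ℚ.- d) ⟩
        ℚ.∣ a ℚ.- c ∣ ℚ.+ ℚ.∣ b ℚ.- d ∣
          ≤⟨ ℚ.+-mono-≤ (hM m n (ℕ.m⊔n≤o⇒m≤o M N m≥) (ℕ.m⊔n≤o⇒m≤o M N n≥))
                        (hN m n (ℕ.m⊔n≤o⇒n≤o M N m≥) (ℕ.m⊔n≤o⇒n≤o M N n≥)) ⟩
        ℚ.½ ℚ.* ε ℚ.+ ℚ.½ ℚ.* ε
          ≃⟨ half+half ε ⟩
        ε ∎
  }
  where open ℚ.≤-Reasoning ; open +-*-Solver

-ᵣ_ : ℝ → ℝ
-ᵣ x = record
  { seq    = λ n → ℚ.- seq x n
  ; cauchy = λ ε 0<ε → let (N , h) = cauchy x ε 0<ε in N , λ m n m≥ n≥ →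
      ℚ.≤-trans (ℚ.≤-reflexive (ℚ.∣-∣-cong
        (solve 2 (λ a b → :- a :- :- b := b :- a) ℚ.≃-refl (seq x m) (seq x n))))
        (h n m n≥ m≥)
  }
  where open +-*-Solver

_-ᵣ_ : ℝ → ℝ → ℝ
x -ᵣ y = x +ᵣ -ᵣ y

_•_ : ℚᵘ → ℝ → ℝ
r • x = record
  { seq    = λ n → r ℚ.* seq x n
  ; cauchy = λ ε 0<ε →
      let instance _ = ℚ.positive 0<ε
          instance _ = ℚ.1/pos⇒pos s
          (N , h) = cauchy x (ε ℚ.* ℚ.1/ s) (ℚ.positive⁻¹ _ {{ℚ.pos*pos⇒pos ε (ℚ.1/ s)}})
      in N , λ m n m≥ n≥ → let a = seq x m ; b = seq x n in begin
        ℚ.∣ r ℚ.* a ℚ.- r ℚ.* b ∣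
          ≃⟨ ℚ.∣-∣-cong (solve 3 (λ r a b → r :* a :- r :* b := r :* (a :- b)) ℚ.≃-refl r a b) ⟩
        ℚ.∣ r ℚ.* (a ℚ.- b) ∣
          ≃⟨ ℚ.∣p*q∣≃∣p∣*∣q∣ r (a ℚ.- b) ⟩
        ℚ.∣ r ∣ ℚ.* ℚ.∣ a ℚ.- b ∣
          ≤⟨ ℚ.*-monoˡ-≤-nonNeg ℚ.∣ a ℚ.- b ∣ {{ℚ.∣-∣-nonNeg (a ℚ.- b)}} (ℚ.p≤q+p ℚ.∣ r ∣ 1ℚᵘ) ⟩
        s ℚ.* ℚ.∣ a ℚ.- b ∣
          ≤⟨ ℚ.*-monoʳ-≤-nonNeg s {{ℚ.pos⇒nonNeg s}} (h m n m≥ n≥) ⟩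
        s ℚ.* (ε ℚ.* ℚ.1/ s)
          ≃⟨ solve 3 (λ s e t → s :* (e :* t) := e :* (s :* t)) ℚ.≃-refl s ε (ℚ.1/ s) ⟩
        ε ℚ.* (s ℚ.* ℚ.1/ s)
          ≃⟨ ℚ.*-congˡ {ε} (ℚ.*-inverseʳ s) ⟩
        ε ℚ.* 1ℚᵘ
          ≃⟨ ℚ.*-identityʳ ε ⟩
        ε ∎
  }
  where
  open ℚ.≤-Reasoning
  open +-*-Solver
  s : ℚᵘ
  s = 1ℚᵘ ℚ.+ ℚ.∣ r ∣
  instance
    s>0 : ℚ.Positive s
    s>0 = ℚ.positive (ℚ.+-mono-<-≤ {0ℚᵘ} {1ℚᵘ} {0ℚᵘ} (*<* (ℤ.+<+ (s≤s z≤n))) (ℚ.0≤∣p∣ r))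
    s≢0 : ℚ.NonZero s
    s≢0 = ℚ.pos⇒nonZero s

infix 4 _⟶_

_⟶_ : (ℕ → ℝ) → ℝ → Set
a ⟶ x = ∀ ε → 0ℚᵘ ℚ.< ε → ∃[ N ] ∀ n → N ℕ.≤ n →
        a n -ᵣ x ≤ᵣ fromℚ ε × x -ᵣ a n ≤ᵣ fromℚ ε

record IsMaximum (S : ℝ → Set) (x : ℝ) : Set where
  field
    attained : S x
    bound    : ∀ y → S y → y ≤ᵣ x

-- The largest i ≤ j with k ^ i ≤ m (for m ≥ 1).
⌊log⌋-upTo : ℕ → ℕ → ℕ → ℕ
⌊log⌋-upTo k m zero    = zero
⌊log⌋-upTo k m (suc j) with k ℕ.^ suc j ℕ.≤? m
... | yes _ = suc j
... | no  _ = ⌊log⌋-upTo k m j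

-- For k ≥ 2 every i with k ^ i ≤ m satisfies i ≤ m.
⌊log⌋ : ℕ → ℕ → ℕ
⌊log⌋ k m = ⌊log⌋-upTo k m m

module _ (k : ℕ) .{{k≥2 : NonTrivial k}} where

  private
    1<k : 1 ℕ.< k
    1<k = recompute (1 ℕ.<? k) (ℕ.nonTrivial⇒n>1 k)

    instance
      k≢0 : NonZero k
      k≢0 = ℕ.>-nonZero (ℕ.<-trans (s≤s z≤n) 1<k)

  k^⌊log⌋≤ : ∀ m .{{_ : NonZero m}} → k ℕ.^ ⌊log⌋ k m ℕ.≤ m
  k^⌊log⌋≤ m = go m
    where
    go : ∀ j → k ℕ.^ ⌊log⌋-upTo k m j ℕ.≤ m
    go zero    = recompute (1 ℕ.≤? m) (ℕ.>-nonZero⁻¹ m)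
    go (suc j) with k ℕ.^ suc j ℕ.≤? m
    ... | yes p = p
    ... | no  _ = go j

  n<k^n : ∀ n → n ℕ.< k ℕ.^ n
  n<k^n zero    = s≤s z≤n
  n<k^n (suc n) = ℕ.≤-<-trans (n<k^n n) (ℕ.^-monoʳ-< k 1<k (ℕ.n<1+n n))

  <k^1+⌊log⌋ : ∀ m → m ℕ.< k ℕ.^ suc (⌊log⌋ k m)
  <k^1+⌊log⌋ m = go m (ℕ.<-trans (n<k^n m) (ℕ.^-monoʳ-< k 1<k (ℕ.n<1+n m)))
    where
    go : ∀ j → m ℕ.< k ℕ.^ suc j → m ℕ.< k ℕ.^ suc (⌊log⌋-upTo k m j)
    go zero    h = h
    go (suc j) h with k ℕ.^ suc j ℕ.≤? m
    ... | yes _ = h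
    ... | no ¬p = go j (ℕ.≰⇒> ¬p)

  ^-cancelʳ-< : ∀ {i j} → k ℕ.^ i ℕ.< k ℕ.^ j → i ℕ.< j
  ^-cancelʳ-< {i} {j} h with i ℕ.<? j
  ... | yes p = p
  ... | no ¬p = ⊥-elim (ℕ.<⇒≱ h (ℕ.^-monoʳ-≤ k (ℕ.≮⇒≥ ¬p)))

  ^-cancelˡ-≤ : ∀ {a b} n .{{_ : NonZero n}} → a ℕ.^ n ℕ.≤ b ℕ.^ n → a ℕ.≤ b
  ^-cancelˡ-≤ {a} {b} n h with a ℕ.≤? b
  ... | yes p = p
  ... | no ¬p = ⊥-elim (ℕ.<⇒≱ (ℕ.^-monoˡ-< n (ℕ.≰⇒> ¬p)) h)

  -- The terms ⌊log_k(m^(n+1))⌋ / (n+1) are within 1/(n+1) of log_k m.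
  logSeq : ℕ → ℕ → ℚᵘ
  logSeq m n = mkℚᵘ (+ ⌊log⌋ k (m ℕ.^ suc n)) n

  logSeq-≤ : ∀ m .{{_ : NonZero m}} p q → logSeq m p ℚ.≤ logSeq m q ℚ.+ mkℚᵘ (+ 1) q
  logSeq-≤ m p q = ℚ.≤-trans
    (*≤* (subst₂ ℤ._≤_ (ℤ.pos-* a (suc q)) (ℤ.pos-* (suc b) (suc p))
                 (ℤ.+≤+ (ℕ.<⇒≤ (^-cancelʳ-< lt)))))
    (ℚ.≤-reflexive eq)
    where
    a b : ℕ
    a = ⌊log⌋ k (m ℕ.^ suc p)
    b = ⌊log⌋ k (m ℕ.^ suc q)
    lt : k ℕ.^ (a ℕ.* suc q) ℕ.< k ℕ.^ (suc b ℕ.* suc p)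
    lt = begin-strict
      k ℕ.^ (a ℕ.* suc q)               ≡⟨ ℕ.^-*-assoc k a (suc q) ⟨
      (k ℕ.^ a) ℕ.^ suc q               ≤⟨ ℕ.^-monoˡ-≤ (suc q) (k^⌊log⌋≤ (m ℕ.^ suc p) {{ℕ.m^n≢0 m (suc p)}}) ⟩
      (m ℕ.^ suc p) ℕ.^ suc q           ≡⟨ ℕ.^-*-assoc m (suc p) (suc q) ⟩
      m ℕ.^ (suc p ℕ.* suc q)           ≡⟨ cong (m ℕ.^_) (ℕ.*-comm (suc p) (suc q)) ⟩
      m ℕ.^ (suc q ℕ.* suc p)           ≡⟨ ℕ.^-*-assoc m (suc q) (suc p) ⟨
      (m ℕ.^ suc q) ℕ.^ suc p           <⟨ ℕ.^-monoˡ-< (suc p) (<k^1+⌊log⌋ (m ℕ.^ suc q)) ⟩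
      (k ℕ.^ suc b) ℕ.^ suc p           ≡⟨ ℕ.^-*-assoc k (suc b) (suc p) ⟩
      k ℕ.^ (suc b ℕ.* suc p)           ∎
      where open ℕ.≤-Reasoning
    eq : mkℚᵘ (+ suc b) q ℚ.≃ mkℚᵘ (+ b) q ℚ.+ mkℚᵘ (+ 1) q
    eq = *≡* (trans
      (cong (ℤ._* (+ suc q ℤ.* + suc q)) (cong +_ (ℕ.+-comm 1 b)))
      (trans (sym (ℤ.*-assoc (+ (b ℕ.+ 1)) (+ suc q) (+ suc q)))
             (cong (ℤ._* (+ suc q)) (ℤ.*-distribʳ-+ (+ suc q) (+ b) (+ 1)))))

  log : (m : ℕ) .{{_ : NonZero m}} → ℝ
  log m = record
    { seq    = logSeq m
    ; cauchy = λ ε 0<ε → let (N , h) = archimedean ε 0<ε in N , λ p q p≥ q≥ →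
        ∣-∣≤ (logSeq m p) (logSeq m q) ε
          (ℚ.≤-trans (logSeq-≤ m p q) (ℚ.+-monoʳ-≤ (logSeq m q) (h q q≥)))
          (ℚ.≤-trans (logSeq-≤ m q p) (ℚ.+-monoʳ-≤ (logSeq m p) (h p p≥)))
    }

-- k^(p/q) ≤ m, as k^p ≤ m^q, with negative powers of k moved across.
RatPow≤ : ℕ → ℚᵘ → ℕ → Set
RatPow≤ k (mkℚᵘ (+ p)    q-1) m = k ℕ.^ p ℕ.≤ m ℕ.^ suc q-1
RatPow≤ k (mkℚᵘ -[1+ p ] q-1) m = 1 ℕ.≤ m ℕ.^ suc q-1 ℕ.* k ℕ.^ suc p

RatPow≥ : ℕ → ℚᵘ → ℕ → Set
RatPow≥ k (mkℚᵘ (+ p)    q-1) m = m ℕ.^ suc q-1 ℕ.≤ k ℕ.^ p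
RatPow≥ k (mkℚᵘ -[1+ p ] q-1) m = m ℕ.^ suc q-1 ℕ.* k ℕ.^ suc p ℕ.≤ 1

-- The equation m = k ^ x with a real exponent x: for k ≥ 2, k ^ x is the only
-- real number lying above k ^ r for all rational r < x and below k ^ r for all
-- rational r > x.
record _≡_^ᵣ_ (m k : ℕ) (x : ℝ) : Set where
  field
    below : ∀ r → fromℚ r <ᵣ x → RatPow≤ k r m
    above : ∀ r → x <ᵣ fromℚ r → RatPow≥ k r m

infix 4 _≡_^ᵣ_

module _ (k : ℕ) .{{k≥2 : NonTrivial k}} (m : ℕ) .{{_ : NonZero m}} where

  private
    1<k : 1 ℕ.< k
    1<k = recompute (1 ℕ.<? k) (ℕ.nonTrivial⇒n>1 k)

    instance
      k≢0 : NonZero k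
      k≢0 = ℕ.>-nonZero (ℕ.<-trans (s≤s z≤n) 1<k)

  ^ᵣ-log : m ≡ k ^ᵣ log k m
  ^ᵣ-log = record { below = below′ ; above = above′ }
    where
    open ℕ.≤-Reasoning
    below′ : ∀ r → fromℚ r <ᵣ log k m → RatPow≤ k r m
    below′ (mkℚᵘ -[1+ p ] q) _ =
      ℕ.>-nonZero⁻¹ _ {{ℕ.m*n≢0 (m ℕ.^ suc q) (k ℕ.^ suc p)
                         {{ℕ.m^n≢0 m (suc q)}} {{ℕ.m^n≢0 k (suc p)}}}}
    below′ r@(mkℚᵘ (+ p) q) (ε , 0<ε , N , h) = ^-cancelˡ-≤ k (suc N) (begin
      (k ℕ.^ p) ℕ.^ suc N            ≡⟨ ℕ.^-*-assoc k p (suc N) ⟩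
      k ℕ.^ (p ℕ.* suc N)            ≤⟨ ℕ.^-monoʳ-≤ k pN≤aq ⟩
      k ℕ.^ (a ℕ.* suc q)            ≡⟨ ℕ.^-*-assoc k a (suc q) ⟨
      (k ℕ.^ a) ℕ.^ suc q            ≤⟨ ℕ.^-monoˡ-≤ (suc q) (k^⌊log⌋≤ k (m ℕ.^ suc N) {{ℕ.m^n≢0 m (suc N)}}) ⟩
      (m ℕ.^ suc N) ℕ.^ suc q        ≡⟨ ℕ.^-*-assoc m (suc N) (suc q) ⟩
      m ℕ.^ (suc N ℕ.* suc q)        ≡⟨ cong (m ℕ.^_) (ℕ.*-comm (suc N) (suc q)) ⟩
      m ℕ.^ (suc q ℕ.* suc N)        ≡⟨ ℕ.^-*-assoc m (suc q) (suc N) ⟨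
      (m ℕ.^ suc q) ℕ.^ suc N        ∎)
      where
      a : ℕ
      a = ⌊log⌋ k (m ℕ.^ suc N)
      r≤ : r ℚ.≤ logSeq k m N
      r≤ = ℚ.≤-trans (ℚ.≤-trans (ℚ.≤-reflexive (ℚ.≃-sym (ℚ.+-identityʳ r)))
                                (ℚ.+-monoʳ-≤ r (ℚ.<⇒≤ 0<ε)))
                     (h N ℕ.≤-refl)
      pN≤aq : p ℕ.* suc N ℕ.≤ a ℕ.* suc q
      pN≤aq = ℤ.drop‿+≤+ (subst₂ ℤ._≤_ (sym (ℤ.pos-* p (suc N))) (sym (ℤ.pos-* a (suc q)))
                             (ℚ.drop-*≤* r≤))

    above′ : ∀ r → log k m <ᵣ fromℚ r → RatPow≥ k r m
    above′ r@(mkℚᵘ s q) (ε , 0<ε , N , h) = go s refl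
      where
      M n a : ℕ
      M = proj₁ (archimedean ε 0<ε)
      n = M ℕ.⊔ N
      a = ⌊log⌋ k (m ℕ.^ suc n)
      1+a≤r : mkℚᵘ (+ suc a) n ℚ.≤ r
      1+a≤r = ℚ.≤-trans (ℚ.≤-reflexive eq)
               (ℚ.≤-trans (ℚ.+-monoʳ-≤ (logSeq k m n) (proj₂ (archimedean ε 0<ε) n (ℕ.m≤m⊔n M N)))
                          (h n (ℕ.m≤n⊔m M N)))
        where
        eq : mkℚᵘ (+ suc a) n ℚ.≃ mkℚᵘ (+ a) n ℚ.+ mkℚᵘ (+ 1) n
        eq = *≡* (trans
          (cong (ℤ._* (+ suc n ℤ.* + suc n)) (cong +_ (ℕ.+-comm 1 a)))
          (trans (sym (ℤ.*-assoc (+ (a ℕ.+ 1)) (+ suc n) (+ suc n)))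
                 (cong (ℤ._* (+ suc n)) (ℤ.*-distribʳ-+ (+ suc n) (+ a) (+ 1)))))
      go : ∀ s′ → s′ ≡ s → RatPow≥ k (mkℚᵘ s′ q) m
      go -[1+ p ] refl = case ℚ.drop-*≤* 1+a≤r of λ ()
      go (+ p) refl = ^-cancelˡ-≤ k (suc n) (begin
        (m ℕ.^ suc q) ℕ.^ suc n        ≡⟨ ℕ.^-*-assoc m (suc q) (suc n) ⟩
        m ℕ.^ (suc q ℕ.* suc n)        ≡⟨ cong (m ℕ.^_) (ℕ.*-comm (suc q) (suc n)) ⟩
        m ℕ.^ (suc n ℕ.* suc q)        ≡⟨ ℕ.^-*-assoc m (suc n) (suc q) ⟨
        (m ℕ.^ suc n) ℕ.^ suc q        ≤⟨ ℕ.^-monoˡ-≤ (suc q) (ℕ.<⇒≤ (<k^1+⌊log⌋ k (m ℕ.^ suc n))) ⟩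
        (k ℕ.^ suc a) ℕ.^ suc q        ≡⟨ ℕ.^-*-assoc k (suc a) (suc q) ⟩
        k ℕ.^ (suc a ℕ.* suc q)        ≤⟨ ℕ.^-monoʳ-≤ k aq≤pn ⟩
        k ℕ.^ (p ℕ.* suc n)            ≡⟨ ℕ.^-*-assoc k p (suc n) ⟨
        (k ℕ.^ p) ℕ.^ suc n            ∎)
        where
        aq≤pn : suc a ℕ.* suc q ℕ.≤ p ℕ.* suc n
        aq≤pn = ℤ.drop‿+≤+ (subst₂ ℤ._≤_ (sym (ℤ.pos-* (suc a) (suc q))) (sym (ℤ.pos-* p (suc n)))
                               (ℚ.drop-*≤* 1+a≤r))

Vertex : ℕ → Set
Vertex n = Vec Bool n

Adjacent : ∀ {n} → Vertex n → Vertex n → Set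
Adjacent x y = ∃[ i ] lookup x i ≢ lookup y i × (∀ j → lookup x j ≢ lookup y j → j ≡ i)

-- The unordered pair of adjacent vertices {lower , upper} differing in coordinate
-- dir, stored through its endpoint with a 0 there (see edge-adjacent, adjacent-edge).
record Edge (n : ℕ) : Set where
  constructor mkEdge
  field
    lower : Vertex n
    dir   : Fin n
    .zero-at-dir : lookup lower dir ≡ false

  upper : Vertex n
  upper = lower [ dir ]≔ true

open Edge public using (lower; dir; upper)

edge-zero : ∀ {n} (e : Edge n) → lookup (lower e) (dir e) ≡ false
edge-zero (mkEdge x i p) = recompute (lookup x i Bool.≟ false) p

lookup-injective : ∀ {n} {x y : Vertex n} → (∀ i → lookup x i ≡ lookup y i) → x ≡ y
lookup-injective h = Pointwise-≡⇒≡ (ext h)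

edge-ext : ∀ {n} {e f : Edge n} → lower e ≡ lower f → dir e ≡ dir f → e ≡ f
edge-ext refl refl = refl

edge-adjacent : ∀ {n} (e : Edge n) → Adjacent (lower e) (upper e)
edge-adjacent e = dir e , ≢-dir , λ j h → unique j h
  where
  ≢-dir : lookup (lower e) (dir e) ≢ lookup (upper e) (dir e)
  ≢-dir rewrite lookup∘update (dir e) (lower e) true | edge-zero e = λ ()
  unique : ∀ j → lookup (lower e) j ≢ lookup (upper e) j → j ≡ dir e
  unique j h with j Fin.≟ dir e
  ... | yes p = p
  ... | no ¬p = ⊥-elim (h (sym (lookup∘update′ ¬p (lower e) true)))

_joins_,_ : ∀ {n} → Edge n → Vertex n → Vertex n → Set
e joins x , y = (lower e ≡ x × upper e ≡ y) ⊎ (lower e ≡ y × upper e ≡ x)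

private
  oriented : ∀ {n} {x y : Vertex n} i → lookup x i ≡ false → lookup y i ≡ true →
             (∀ j → lookup x j ≢ lookup y j → j ≡ i) → x [ i ]≔ true ≡ y
  oriented {x = x} {y} i x0 y1 u = lookup-injective λ j → case j Fin.≟ i of λ where
    (yes refl) → trans (lookup∘update i x true) (sym y1)
    (no j≢i)   → trans (lookup∘update′ j≢i x true)
                   (case lookup x j Bool.≟ lookup y j of λ where
                      (yes p) → p
                      (no ¬p) → ⊥-elim (j≢i (u j ¬p)))

adjacent-edge : ∀ {n} (x y : Vertex n) → Adjacent x y → ∃[ e ] e joins x , y
adjacent-edge x y (i , x≢y , u) with lookup x i in xi | lookup y i in yi
... | false | false = ⊥-elim (x≢y refl)
... | true  | true  = ⊥-elim (x≢y refl)
... | false | true  = mkEdge x i xi , inj₁ (refl , oriented i xi yi u)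
... | true  | false = mkEdge y i yi , inj₂ (refl , oriented i yi xi (λ j h → u j (h ∘ sym)))

private
  not-flipped : ∀ {n} (e f : Edge n) → lower f ≡ upper e → upper f ≢ lower e
  not-flipped e f p q with trans (sym (edge-zero e))
    (trans (cong (λ v → lookup v (dir e)) (sym q))
      (case dir e Fin.≟ dir f of λ where
         (yes eq) → trans (cong (lookup (upper f)) eq) (lookup∘update (dir f) (lower f) true)
         (no  ne) → trans (lookup∘update′ ne (lower f) true)
                      (trans (cong (λ v → lookup v (dir e)) p)
                             (lookup∘update (dir e) (lower e) true))))
  ... | ()

  same-endpoints : ∀ {n} (e f : Edge n) → lower f ≡ lower e → upper f ≡ upper e → e ≡ f
  same-endpoints e f p q = edge-ext (sym p)
    (proj₂ (proj₂ (edge-adjacent f)) (dir e)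
      (subst₂ (λ a b → lookup a (dir e) ≢ lookup b (dir e)) (sym p) (sym q)
        (proj₁ (proj₂ (edge-adjacent e)))))

joins-unique : ∀ {n} {x y : Vertex n} (e f : Edge n) → e joins x , y → f joins x , y → e ≡ f
joins-unique e f (inj₁ (refl , refl)) (inj₁ (p , q)) = same-endpoints e f p q
joins-unique e f (inj₂ (refl , refl)) (inj₂ (p , q)) = same-endpoints e f p q
joins-unique e f (inj₁ (refl , refl)) (inj₂ (p , q)) = ⊥-elim (not-flipped e f p q)
joins-unique e f (inj₂ (refl , refl)) (inj₁ (p , q)) = ⊥-elim (not-flipped e f p q)

vertices : ∀ n → List (Vertex n)
vertices zero    = [] ∷ []
vertices (suc n) = cartesianProductWith _∷_ (false ∷ true ∷ []) (vertices n)

insertEdge : ∀ {n} → Fin (suc n) → Vertex n → Edge (suc n)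
insertEdge i x = mkEdge (insertAt x i false) i (insertAt-lookup x i false)

edges : ∀ n → List (Edge n)
edges zero    = []
edges (suc n) = cartesianProductWith insertEdge (allFin (suc n)) (vertices n)

e⟨Q_⟩ : ℕ → ℕ
e⟨Q n ⟩ = n ℕ.* 2 ℕ.^ (n ℕ.∸ 1)

∈-vertices : ∀ {n} (x : Vertex n) → x ∈ₗ vertices n
∈-vertices []          = here refl
∈-vertices (false ∷ x) = ∈-cartesianProductWith⁺ _∷_ {xs = false ∷ true ∷ []} (here refl) (∈-vertices x)
∈-vertices (true  ∷ x) = ∈-cartesianProductWith⁺ _∷_ {xs = false ∷ true ∷ []} (there (here refl)) (∈-vertices x)

∈-edges : ∀ {n} (e : Edge n) → e ∈ₗ edges n
∈-edges {zero}  (mkEdge _ () _)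
∈-edges {suc n} e@(mkEdge x i _) =
  subst (_∈ₗ edges (suc n)) (edge-ext eq refl)
    (∈-cartesianProductWith⁺ insertEdge (∈-allFin i) (∈-vertices (removeAt x i)))
  where
  eq : insertAt (removeAt x i) i false ≡ x
  eq = trans (cong (insertAt (removeAt x i) i) (sym (edge-zero e))) (insertAt-removeAt x i)

vertices-unique : ∀ n → Unique (vertices n)
vertices-unique zero    = [] ∷ []
vertices-unique (suc n) =
  Unique.cartesianProductWith⁺ _∷_ ∷-injective (((λ ()) ∷ []) ∷ [] ∷ []) (vertices-unique n)

edges-unique : ∀ n → Unique (edges n)
edges-unique zero    = []
edges-unique (suc n) =
  Unique.cartesianProductWith⁺ insertEdge inj (Unique.allFin⁺ (suc n)) (vertices-unique n)
  where
  inj : ∀ {i j x y} → insertEdge i x ≡ insertEdge j y → i ≡ j × x ≡ y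
  inj {i} {j} {x} {y} eq with cong dir eq
  ... | refl = refl , trans (sym (removeAt-insertAt x i false))
                        (trans (cong (λ v → removeAt v i) (cong lower eq)) (removeAt-insertAt y i false))

private
  length-product : ∀ {A B C : Set} (f : A → B → C) xs ys →
                   length (cartesianProductWith f xs ys) ≡ length xs ℕ.* length ys
  length-product f []       ys = refl
  length-product f (x ∷ xs) ys =
    trans (length-++ (map (f x) ys)) (cong₂ ℕ._+_ (length-map (f x) ys) (length-product f xs ys))

length-vertices : ∀ n → length (vertices n) ≡ 2 ℕ.^ n
length-vertices zero    = refl
length-vertices (suc n) = trans (length-product _∷_ (false ∷ true ∷ []) (vertices n))
                                (cong (2 ℕ.*_) (length-vertices n))

length-edges : ∀ n → length (edges n) ≡ e⟨Q n ⟩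
length-edges zero    = refl
length-edges (suc n) = trans (length-product insertEdge (allFin (suc n)) (vertices n))
                             (cong₂ ℕ._*_ (length-tabulate {n = suc n} (λ i → i)) (length-vertices n))

e⟨Q⟩≢0 : ∀ n → NonZero e⟨Q suc n ⟩
e⟨Q⟩≢0 n = ℕ.m*n≢0 (suc n) (2 ℕ.^ n) {{_}} {{ℕ.m^n≢0 2 n}}

-- b lists the set B = {b₁ < … < bₘ} in increasing order.
record OrderEmbedding (m n : ℕ) : Set where
  field
    φ      : Vertex m → Vertex n
    b      : Fin m → Fin n
    b-mono : ∀ {i j} → i Fin.< j → b i Fin.< b j
    φ-on   : ∀ x j → lookup (φ x) (b j) ≡ lookup x j
    φ-off  : ∀ x i → (∀ j → i ≢ b j) → lookup (φ x) i ≡ lookup (φ (replicate m false)) i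

  -- The edge xy goes to the edge φ(x)φ(y): see φᴱ-lower and φᴱ-upper.
  φᴱ : Edge m → Edge n
  φᴱ (mkEdge x i p) = mkEdge (φ x) (b i) (trans (φ-on x i) p)

  φᴱ-lower : ∀ e → lower (φᴱ e) ≡ φ (lower e)
  φᴱ-lower e = refl

  φᴱ-upper : ∀ e → upper (φᴱ e) ≡ φ (upper e)
  φᴱ-upper e@(mkEdge x i p) = lookup-injective at
    where
    b-inj : ∀ {j} → j ≢ i → b j ≢ b i
    b-inj {j} j≢i eq with Fin.<-cmp j i
    ... | tri< j<i _ _ = Fin.<-irrefl eq (b-mono j<i)
    ... | tri≈ _ j≡i _ = j≢i j≡i
    ... | tri> _ _ i<j = Fin.<-irrefl (sym eq) (b-mono i<j)
    on : ∀ j → lookup (φ x [ b i ]≔ true) (b j) ≡ lookup (upper e) j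
    on j with j Fin.≟ i
    ... | yes refl = trans (lookup∘update (b i) (φ x) true) (sym (lookup∘update i x true))
    ... | no j≢i   = trans (lookup∘update′ (b-inj j≢i) (φ x) true)
                       (trans (φ-on x j) (sym (lookup∘update′ j≢i x true)))
    at : ∀ l → lookup (φ x [ b i ]≔ true) l ≡ lookup (φ (upper e)) l
    at l with Fin.any? (λ j → l Fin.≟ b j)
    ... | no ∄j = trans (lookup∘update′ (λ eq → ∄j (i , eq)) (φ x) true)
                    (trans (φ-off x l (λ j eq → ∄j (j , eq)))
                           (sym (φ-off (upper e) l (λ j eq → ∄j (j , eq)))))
    ... | yes (j , refl) = trans (on j) (sym (φ-on (upper e) j))

Colouring : ℕ → ℕ → Set
Colouring k n = Edge n → Fin k

-- Without function extensionality a set of maps is a predicate respecting _≗_.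
record Property (k : ℕ) : Set₁ where
  field
    mem  : ∀ n → Colouring k n → Set
    resp : ∀ n {c c′} → c ≗ c′ → mem n c → mem n c′

open Property public

OrderHereditary : ∀ {k} → Property k → Set
OrderHereditary P = ∀ {m n} (ϕ : OrderEmbedding m n) c →
                    mem P n c → mem P m (c ∘ OrderEmbedding.φᴱ ϕ)

members : ∀ {k} → Property k → ℕ → Setoid 0ℓ 0ℓ
members {k} P n = record
  { Carrier = ∃ (mem P n) ; isEquivalence = On.isEquivalence proj₁ (Setoid.isEquivalence S) }
  where S = Edge n →-setoid Fin k

-- P n has exactly N elements, as a set of maps under pointwise equality.
HasCardinality : ∀ {k} → Property k → ℕ → ℕ → Set
HasCardinality P n N = Inverse (setoid (Fin N)) (members P n)

record Template (k n : ℕ) : Set where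
  field
    palette  : Edge n → Subset k
    nonempty : ∀ e → Nonempty (palette e)

open Template public

∣palette∣≢0 : ∀ {k n} (t : Template k n) e → NonZero ∣ palette t e ∣
∣palette∣≢0 t e with nonempty t e
... | i , i∈ = ℕ.>-nonZero (subst (ℕ._≤ ∣ palette t e ∣) (∣⁅x⁆∣≡1 i) (p⊆q⇒∣p∣≤∣q∣ λ j∈ → subst (_∈ palette t e) (sym (x∈⁅y⁆⇒x≡y i j∈)) i∈))

⟨_⟩ : ∀ {k n} → Template k n → Colouring k n → Set
⟨ t ⟩ c = ∀ e → c e ∈ palette t e

_⊑_ : ∀ {k n} → Template k n → Property k → Set
_⊑_ {n = n} t P = ∀ c → ⟨ t ⟩ c → mem P n c

module _ {k : ℕ} .{{k≥2 : NonTrivial k}} where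

  Ent : ∀ {n} → Template k n → ℝ
  Ent {n} t = foldr _+ᵣ_ 0ᵣ (map (λ e → log k ∣ palette t e ∣ {{∣palette∣≢0 t e}}) (edges n))

  -- x = ex(Qₙ, P), specified rather than computed.
  IsEx : Property k → ℕ → ℝ → Set
  IsEx P n = IsMaximum (λ x → Σ (Template k n) λ t → t ⊑ P × x ≃ᵣ Ent t)

  -- π = lim ex(Qₙ, P) / e(Qₙ), taken from n = 1 on since Q₀ has no edges.
  IsDensity : Property k → ℝ → Set
  IsDensity P π = Σ (ℕ → ℝ) λ ex →
    (∀ n → IsEx P n (ex n)) × (λ n → (+ 1 ℚ./ e⟨Q suc n ⟩) {{e⟨Q⟩≢0 n}} • ex (suc n)) ⟶ π

{-# OPTIONS --safe #-}
-- Lower bound: an extremal template t for Qₙ has |⟨t⟩| = k ^ Ent t, and ⟨t⟩ ⊆ Pₙ.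
--
-- Upper bound: view the directions of Q_{mw} as an m × w matrix. The columns partition the
-- edges of Q_{mw} into copies of Q_m, the rows partition them into g copies of Q_w, and a column
-- copy meets a row copy in at most one edge. Let Y be the set of colourings all of whose row
-- copies lie in P_w; it contains P_{mw}, it is a product over the row copies, and |Y| ≤ |P_w|^g.
-- Reveal a colouring one column copy at a time. The colours which a fixed fraction of the
-- members of Y consistent with the past have at an edge form a palette; a colour outside it
-- shrinks Y by a large factor, so this happens rarely. Either every choice from the palettes on
-- the current column copy occurs in P_{mw}, and then heredity bounds their entropy by
-- ex(Q_m, P); or some choice is missing, and by the product structure a fixed fraction of Y is
-- lost. If the first case prevails, |P_{mw}| is at most k to the power
-- (ex(Q_m, P) / e(Q_m) + ε) e(Q_{mw}). Otherwise log |P_w| / e(Q_w) drops by a fixed amount from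
-- w to mw, which can happen only boundedly often along w, mw, m²w, …
module Submission where

open import Defs
open import Data.Integer.Base using (+_)
open import Data.Nat.Base using (ℕ; NonTrivial)
open import Data.Product.Base using (Σ; ∃; _×_)
open import Data.Rational.Unnormalised.Base using (_/_)

open import Algebra.Properties.CommutativeSemigroup using (interchange)
open import Data.Bool.Base using (Bool; true; false; if_then_else_)
import Data.Bool.Properties as Bool
open import Data.Empty using (⊥-elim)
open import Data.Fin.Base as Fin using (Fin; zero; suc; combine; remQuot; funToFin; finToFun)
import Data.Fin.Properties as Fin
open import Data.Fin.Subset using (Subset; ∣_∣; inside; outside) renaming (_∈_ to _∈ₛ_)
open import Data.Fin.Subset.Properties using (_∈?_; drop-there; nonempty?; Empty-unique; ∣⊥∣≡0)
open import Data.Integer.Base as ℤ using (-[1+_])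
import Data.Integer.Properties as ℤ
open import Data.List.Base as List
  using (List; []; _∷_; _++_; map; filter; foldr; length; allFin; cartesianProduct; cartesianProductWith)
open import Data.List.Membership.Propositional using (_∈_; find; lose)
open import Data.List.Membership.Propositional.Properties
  using (∈-cartesianProductWith⁺; ∈-cartesianProduct⁺; ∈-cartesianProduct⁻; ∈-allFin; ∈-lookup;
         ∈-filter⁺; ∈-filter⁻)
open import Data.List.Properties
  using (length-++; length-map; length-tabulate; length-filter; filter-++; map-tabulate)
open import Data.List.Relation.Unary.All as All using (All; []; _∷_)
open import Data.List.Relation.Unary.AllPairs using ([]; _∷_)
open import Data.List.Relation.Unary.Any as Any using (here; there)
open import Data.List.Relation.Unary.Any.Properties using (lookup-index)
open import Data.List.Relation.Unary.Unique.Propositional using (Unique)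
import Data.List.Relation.Unary.Unique.Propositional.Properties as Unique
open import Data.Nat.Base as ℕ hiding (_/_; _%_)
open import Data.Nat.DivMod using (m≡m%n+[m/n]*n; m%n<n; m/n*n≤m)
open import Data.Nat.ListAction using (sum; product)
open import Data.Nat.Properties as ℕ
import Data.Nat.Solver as ℕ
open import Data.Product.Base using (∃-syntax; _,_; proj₁; proj₂; swap)
open import Data.Product.Properties using (,-injectiveˡ; ,-injectiveʳ)
open import Data.Rational.Unnormalised.Base as ℚ using (ℚᵘ; mkℚᵘ; 0ℚᵘ; 1ℚᵘ; *≤*; *<*; *≡*)
import Data.Rational.Unnormalised.Properties as ℚ
import Data.Rational.Unnormalised.Solver as ℚ
open import Data.Sum.Base using (_⊎_; inj₁; inj₂; [_,_]′)
open import Data.Vec.Base as Vec using (Vec; []; _∷_; lookup; tail; tabulate; replicate)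
open import Data.Vec.Properties
  using (∷-injective; lookup∘tabulate; tabulate∘lookup; tabulate-cong; lookup⇒[]=; []=⇒lookup)
  renaming (≡-dec to ≡-decᵛ)
open import Data.Vec.Relation.Binary.Pointwise.Inductive as Pointwise using (Pointwise; []; _∷_)
open import Function.Base using (_∘_; id)
open import Function.Bundles using (Inverse)
open import Level using (0ℓ)
open import Relation.Binary.PropositionalEquality hiding (resp; J)
open import Relation.Nullary using (yes; no; ¬_; Dec; does; recompute; _×-dec_)
open import Relation.Nullary.Decidable using (dec-true; dec-false; map′)
open import Relation.Unary using (Pred; Decidable)

-- Palettes are taken with respect to `Y` and not to the members of `P` on the large cube, because
-- in an arbitrary set of colourings colours that are frequent one by one need not occur together.
-- In `Y` the edges of a column copy lie in different row copies, so under the uniform distribution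
-- their colours are independent, and conditioning on the columns already revealed keeps the product
-- structure. Hence `M` colours of frequency at least 1/`D₀` give a choice of frequency at least
-- 1/`D`, where `D` = `D₀`^`M`; this is why a missing choice is expensive. Divided by `D`^β `Q`^n,
-- the counting inequality reads
--
-- |F| ≤ (1 - 1/D)^β |Y| + Q^σ (K + Π/Q)^n Π^β.
--
-- The first term is what remains after β missing choices; the second counts the members that are
-- fully revealed before that. `D` depends on k, m and the precision but not on w, so the rate log
-- |P_w| / e(Q_w), which lies between 0 and 1, falls by the same amount at every loss. Rates are
-- compared through integer powers; real logarithms enter only at the end.

module _ where
  private variable
    A B C : Set
    P Q R : Pred A 0ℓ
    m n : ℕ

  -- Finite counting

  lookup-injectiveᵁ : ∀ {xs : List A} → Unique xs → ∀ i j → List.lookup xs i ≡ List.lookup xs j → i ≡ j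
  lookup-injectiveᵁ (x∉ ∷ u) zero    zero    eq = refl
  lookup-injectiveᵁ (x∉ ∷ u) zero    (suc j) eq = ⊥-elim (All.lookup x∉ (∈-lookup j) eq)
  lookup-injectiveᵁ (x∉ ∷ u) (suc i) zero    eq = ⊥-elim (All.lookup x∉ (∈-lookup i) (sym eq))
  lookup-injectiveᵁ (x∉ ∷ u) (suc i) (suc j) eq = cong suc (lookup-injectiveᵁ u i j eq)

  -- `g` receives the membership proof because the maps used later, such as passing to restrictions
  -- in `P`, are defined only on the elements being counted.
  length-injection : {xs : List A} {ys : List B} → Unique xs → (g : ∀ {x} → x ∈ xs → B) →
                     (∀ {x} (x∈ : x ∈ xs) → g x∈ ∈ ys) →
                     (∀ {x x′} (x∈ : x ∈ xs) (x′∈ : x′ ∈ xs) → g x∈ ≡ g x′∈ → x ≡ x′) →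
                     length xs ≤ length ys
  length-injection {xs = xs} {ys} u g g∈ inj = Fin.injective⇒≤ {f = f} λ {i} {j} eq →
    lookup-injectiveᵁ u i j (inj (∈-lookup i) (∈-lookup j)
      (trans (lookup-index (g∈ (∈-lookup i)))
        (trans (cong (List.lookup ys) eq) (sym (lookup-index (g∈ (∈-lookup j)))))))
    where
    f : Fin (length xs) → Fin (length ys)
    f i = Any.index (g∈ (∈-lookup i))

  length-allFin : ∀ n → length (allFin n) ≡ n
  length-allFin n = length-tabulate {n = n} id

  count : Decidable {A = A} P → List A → ℕ
  count P? xs = length (filter P? xs)

  count-injection : (P? : Decidable {A = A} P) (Q? : Decidable {A = B} Q) {xs : List A} {ys : List B} →
                    Unique xs → (∀ y → y ∈ ys) → (g : ∀ {x} → P x → B) →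
                    (∀ {x} (p : P x) → Q (g p)) →
                    (∀ {x x′} (p : P x) (p′ : P x′) → g p ≡ g p′ → x ≡ x′) →
                    count P? xs ≤ count Q? ys
  count-injection P? Q? {xs} u all g gQ inj =
    length-injection (Unique.filter⁺ P? u) (λ x∈ → g (prf x∈))
      (λ x∈ → ∈-filter⁺ Q? (all _) (gQ (prf x∈)))
      (λ x∈ x′∈ → inj (prf x∈) (prf x′∈))
    where
    prf : ∀ {x} → x ∈ filter P? xs → _
    prf x∈ = proj₂ (∈-filter⁻ P? {xs = xs} x∈)

  count-≤Fin : (P? : Decidable {A = A} P) {xs : List A} → Unique xs → (g : ∀ {x} → P x → Fin n) →
               (∀ {x x′} (p : P x) (p′ : P x′) → g p ≡ g p′ → x ≡ x′) → count P? xs ≤ n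
  count-≤Fin {n = n} P? {xs} u g inj = subst (count P? xs ≤_) (length-allFin n)
    (length-injection (Unique.filter⁺ P? u) (λ x∈ → g (prf x∈)) (λ x∈ → ∈-allFin _)
      (λ x∈ x′∈ → inj (prf x∈) (prf x′∈)))
    where
    prf : ∀ {x} → x ∈ filter P? xs → _
    prf x∈ = proj₂ (∈-filter⁻ P? {xs = xs} x∈)

  Fin≤-count : (P? : Decidable {A = A} P) {xs : List A} → (∀ x → x ∈ xs) → (g : Fin n → A) →
               (∀ i → P (g i)) → (∀ i j → g i ≡ g j → i ≡ j) → n ≤ count P? xs
  Fin≤-count {n = n} P? {xs} all g gP inj = subst (_≤ count P? xs) (length-allFin n)
    (length-injection (Unique.allFin⁺ n) (λ {i} _ → g i) (λ {i} _ → ∈-filter⁺ P? (all (g i)) (gP i))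
      (λ {i} {j} _ _ → inj i j))

  -- Recombination changes both members of a pair at once, so two products of counts are compared
  -- through one injection of pairs.
  count-×-injection :
    (P? : Decidable {A = A} P) (Q? : Decidable {A = A} Q)
    (R? : Decidable {A = A} R) {S : Pred A 0ℓ} (S? : Decidable {A = A} S) {xs : List A} →
    Unique xs → (∀ x → x ∈ xs) → (g : A × A → A × A) →
    (∀ {x y} → P x → Q y → R (proj₁ (g (x , y))) × S (proj₂ (g (x , y)))) →
    (∀ {v w} → g v ≡ g w → v ≡ w) →
    count P? xs * count Q? xs ≤ count R? xs * count S? xs
  count-×-injection P? Q? R? S? {xs} u all g gRS inj = subst₂ _≤_
    (length-product (filter P? xs) (filter Q? xs)) (length-product (filter R? xs) (filter S? xs))
    (length-injection (Unique.cartesianProduct⁺ (Unique.filter⁺ P? u) (Unique.filter⁺ Q? u))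
      (λ {v} _ → g v)
      (λ v∈ → let (x∈ , y∈) = ∈-cartesianProduct⁻ (filter P? xs) (filter Q? xs) v∈
                  (r , s) = gRS (proj₂ (∈-filter⁻ P? {xs = xs} x∈)) (proj₂ (∈-filter⁻ Q? {xs = xs} y∈))
              in ∈-cartesianProduct⁺ (∈-filter⁺ R? (all _) r) (∈-filter⁺ S? (all _) s))
      (λ _ _ → inj))
    where
    length-product : (ys zs : List A) → length (cartesianProduct ys zs) ≡ length ys * length zs
    length-product []       zs = refl
    length-product (y ∷ ys) zs = trans (length-++ (map (y ,_) zs))
      (cong₂ _+_ (length-map (y ,_) zs) (length-product ys zs))

  count-mono : (P? : Decidable {A = A} P) (Q? : Decidable {A = A} Q) → (∀ {x} → P x → Q x) →
               ∀ xs → count P? xs ≤ count Q? xs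
  count-mono P? Q? P⇒Q [] = z≤n
  count-mono P? Q? P⇒Q (x ∷ xs) with P? x | Q? x
  ... | yes p | yes q = s≤s (count-mono P? Q? P⇒Q xs)
  ... | yes p | no ¬q = ⊥-elim (¬q (P⇒Q p))
  ... | no ¬p | yes q = m≤n⇒m≤1+n (count-mono P? Q? P⇒Q xs)
  ... | no ¬p | no ¬q = count-mono P? Q? P⇒Q xs

  ∑ : List A → (A → ℕ) → ℕ
  ∑ xs f = sum (map f xs)

  ∑-mono : (xs : List A) {f g : A → ℕ} → (∀ x → f x ≤ g x) → ∑ xs f ≤ ∑ xs g
  ∑-mono []       f≤g = z≤n
  ∑-mono (x ∷ xs) f≤g = +-mono-≤ (f≤g x) (∑-mono xs f≤g)

  -- A gain at a single summand survives in the total; in `bad-step` it comes from the one pattern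
  -- that is known to be missing.
  ∑-mono-∈ : {xs : List A} {f g : A → ℕ} {d : ℕ} → (∀ x → f x ≤ g x) →
             ∀ {x₀} → x₀ ∈ xs → f x₀ + d ≤ g x₀ → ∑ xs f + d ≤ ∑ xs g
  ∑-mono-∈ {xs = x ∷ xs} {f} {g} {d} f≤g (here refl) h = begin
    f x + ∑ xs f + d    ≡⟨ +-assoc (f x) (∑ xs f) d ⟩
    f x + (∑ xs f + d)  ≡⟨ cong (λ z → f x + z) (+-comm (∑ xs f) d) ⟩
    f x + (d + ∑ xs f)  ≡⟨ +-assoc (f x) d (∑ xs f) ⟨
    f x + d + ∑ xs f    ≤⟨ +-mono-≤ h (∑-mono xs f≤g) ⟩
    g x + ∑ xs g        ∎
    where open ≤-Reasoning
  ∑-mono-∈ {xs = x ∷ xs} {f} {g} {d} f≤g (there x₀∈) h = begin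
    f x + ∑ xs f + d    ≡⟨ +-assoc (f x) (∑ xs f) d ⟩
    f x + (∑ xs f + d)  ≤⟨ +-mono-≤ (f≤g x) (∑-mono-∈ f≤g x₀∈ h) ⟩
    g x + ∑ xs g        ∎
    where open ≤-Reasoning

  ∑-+ : (xs : List A) (f g : A → ℕ) → ∑ xs (λ x → f x + g x) ≡ ∑ xs f + ∑ xs g
  ∑-+ []       f g = refl
  ∑-+ (x ∷ xs) f g = trans (cong (λ z → f x + g x + z) (∑-+ xs f g)) (interchange +-commutativeSemigroup (f x) (g x) _ _)

  ∑-*ˡ : (xs : List A) (c : ℕ) (f : A → ℕ) → ∑ xs (λ x → c * f x) ≡ c * ∑ xs f
  ∑-*ˡ []       c f = sym (*-zeroʳ c)
  ∑-*ˡ (x ∷ xs) c f = trans (cong (λ z → c * f x + z) (∑-*ˡ xs c f)) (sym (*-distribˡ-+ c (f x) _))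

  ∑-const : (xs : List A) (c : ℕ) → ∑ xs (λ _ → c) ≡ length xs * c
  ∑-const []       c = refl
  ∑-const (x ∷ xs) c = cong (λ z → c + z) (∑-const xs c)

  -- Words, patterns and boxes

  words : List A → ∀ n → List (Vec A n)
  words as zero    = [] ∷ []
  words as (suc n) = cartesianProductWith _∷_ as (words as n)

  ∈-words : {as : List A} → (∀ a → a ∈ as) → (v : Vec A n) → v ∈ words as n
  ∈-words all []      = here refl
  ∈-words all (a ∷ v) = ∈-cartesianProductWith⁺ _∷_ (all a) (∈-words all v)

  words-unique : {as : List A} → Unique as → ∀ n → Unique (words as n)
  words-unique u zero    = [] ∷ []
  words-unique u (suc n) = Unique.cartesianProductWith⁺ _∷_ ∷-injective u (words-unique u n)

  length-words : (as : List A) → ∀ n → length (words as n) ≡ length as ^ n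
  length-words as zero    = refl
  length-words as (suc n) = go as
    where
    go : ∀ bs → length (cartesianProductWith _∷_ bs (words as n)) ≡ length bs * length as ^ n
    go []       = refl
    go (b ∷ bs) = trans (length-++ (map (b ∷_) (words as n)))
      (cong₂ _+_ (trans (length-map (b ∷_) (words as n)) (length-words as n)) (go bs))

  count-map : (f : A → B) (P? : Decidable {A = B} P) → ∀ xs → count P? (map f xs) ≡ count (P? ∘ f) xs
  count-map f P? []       = refl
  count-map f P? (x ∷ xs) with P? (f x)
  ... | yes _ = cong suc (count-map f P? xs)
  ... | no  _ = count-map f P? xs

  count-++ : (P? : Decidable {A = A} P) → ∀ xs ys → count P? (xs ++ ys) ≡ count P? xs + count P? ys
  count-++ P? xs ys = trans (cong length (filter-++ P? xs ys)) (length-++ (filter P? xs))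

  count-words-suc : (as : List A) (P? : Decidable {A = Vec A (suc n)} P) →
                    count P? (words as (suc n)) ≡ ∑ as (λ a → count (P? ∘ (a ∷_)) (words as n))
  count-words-suc {n = n} as P? = go as
    where
    ws : List (Vec _ n)
    ws = words as n
    go : ∀ bs → count P? (cartesianProductWith _∷_ bs ws) ≡ ∑ bs (λ a → count (P? ∘ (a ∷_)) ws)
    go []       = refl
    go (b ∷ bs) = trans (count-++ P? (map (b ∷_) ws) _) (cong₂ _+_ (count-map (b ∷_) P? ws) (go bs))

  count-none : (P? : Decidable {A = A} P) → ∀ xs → (∀ x → ¬ P x) → count P? xs ≡ 0
  count-none P? []       ¬P = refl
  count-none P? (x ∷ xs) ¬P with P? x
  ... | yes p = ⊥-elim (¬P x p)
  ... | no  _ = count-none P? xs ¬P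

  count-cong : (P? : Decidable {A = A} P) (Q? : Decidable {A = A} Q) → (∀ {x} → P x → Q x) →
               (∀ {x} → Q x → P x) → ∀ xs → count P? xs ≡ count Q? xs
  count-cong P? Q? f g xs = ≤-antisym (count-mono P? Q? f xs) (count-mono Q? P? g xs)

  Box : ∀ {k} → Vec (Subset k) m → Vec (Fin k) m → Set
  Box T v = Pointwise _∈ₛ_ v T

  box? : ∀ {k} (T : Vec (Subset k) m) → Decidable (Box T)
  box? T v = Pointwise.decidable _∈?_ v T

  patterns : ∀ k m → List (Vec (Fin k) m)
  patterns k = words (allFin k)

  count-subset : ∀ {k} (p : Subset k) → count (_∈? p) (allFin k) ≡ ∣ p ∣
  count-subset-tail : ∀ {k} s (p : Subset k) → count (_∈? (s ∷ p)) (List.tabulate suc) ≡ ∣ p ∣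
  count-subset-tail {k} s p = begin
    count (_∈? (s ∷ p)) (List.tabulate suc)
      ≡⟨ cong (count (_∈? (s ∷ p))) (map-tabulate id suc) ⟨
    count (_∈? (s ∷ p)) (map suc (allFin k))
      ≡⟨ count-map suc (_∈? (s ∷ p)) (allFin k) ⟩
    count (λ i → suc i ∈? (s ∷ p)) (allFin k)
      ≡⟨ count-cong (λ i → suc i ∈? (s ∷ p)) (_∈? p) drop-there Vec.there (allFin k) ⟩
    count (_∈? p) (allFin k)
      ≡⟨ count-subset p ⟩
    ∣ p ∣ ∎
    where open ≡-Reasoning
  count-subset {zero}  []          = refl
  count-subset {suc k} (inside ∷ p) = cong suc (count-subset-tail inside p)
  count-subset {suc k} (outside ∷ p) = count-subset-tail outside p

  boxSize : ∀ {k} → Vec (Subset k) m → ℕ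
  boxSize []      = 1
  boxSize (p ∷ T) = ∣ p ∣ * boxSize T

  ∑-indicator : (P? : Decidable {A = A} P) {f : A → ℕ} (c : ℕ) → (∀ x → P x → f x ≡ c) →
                (∀ x → ¬ P x → f x ≡ 0) → ∀ xs → ∑ xs f ≡ count P? xs * c
  ∑-indicator P? c yes≡ no≡ []       = refl
  ∑-indicator P? c yes≡ no≡ (x ∷ xs) with P? x
  ... | yes p = cong₂ _+_ (yes≡ x p) (∑-indicator P? c yes≡ no≡ xs)
  ... | no ¬p = cong₂ _+_ (no≡ x ¬p) (∑-indicator P? c yes≡ no≡ xs)

  count-box : ∀ {k} (T : Vec (Subset k) m) → count (box? T) (patterns k m) ≡ boxSize T
  count-box []                      = refl
  count-box {suc m} {k} (p ∷ T) = begin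
    count (box? (p ∷ T)) (patterns k (suc m))
      ≡⟨ count-words-suc (allFin k) (box? (p ∷ T)) ⟩
    ∑ (allFin k) (λ a → count (box? (p ∷ T) ∘ (a ∷_)) (patterns k m))
      ≡⟨ ∑-indicator (_∈? p) (boxSize T)
           (λ a a∈ → trans (count-cong (box? (p ∷ T) ∘ (a ∷_)) (box? T) Pointwise.tail (a∈ ∷_) (patterns k m))
                           (count-box T))
           (λ a a∉ → count-none (box? (p ∷ T) ∘ (a ∷_)) (patterns k m) (λ v → a∉ ∘ Pointwise.head))
           (allFin k) ⟩
    count (_∈? p) (allFin k) * boxSize T
      ≡⟨ cong (_* boxSize T) (count-subset p) ⟩
    ∣ p ∣ * boxSize T ∎
    where open ≡-Reasoning

  -- Recombination of colourings

  lookup-extensional : {v w : Vec A n} → (∀ i → lookup v i ≡ lookup w i) → v ≡ w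
  lookup-extensional {v = v} {w} h =
    trans (sym (tabulate∘lookup v)) (trans (tabulate-cong h) (tabulate∘lookup w))

  comprehension : ∀ {k} {P : Pred (Fin k) 0ℓ} → Decidable P → Subset k
  comprehension P? = tabulate (does ∘ P?)

  ∈-comprehension⁺ : ∀ {k} {P : Pred (Fin k) 0ℓ} (P? : Decidable P) {x} → P x → x ∈ₛ comprehension P?
  ∈-comprehension⁺ P? {x} p = lookup⇒[]= x _ (trans (lookup∘tabulate (does ∘ P?) x) (dec-true (P? x) p))

  ∈-comprehension⁻ : ∀ {k} {P : Pred (Fin k) 0ℓ} (P? : Decidable P) {x} → x ∈ₛ comprehension P? → P x
  ∈-comprehension⁻ P? {x} x∈ with P? x in eq
  ... | yes p = p
  ... | no ¬p with trans (sym ([]=⇒lookup x∈)) (trans (lookup∘tabulate (does ∘ P?) x) (cong does eq))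
  ...   | ()

  count≢0⇒∃ : (P? : Decidable {A = A} P) → ∀ xs → count P? xs ≢ 0 → ∃ P
  count≢0⇒∃ P? []       h = ⊥-elim (h refl)
  count≢0⇒∃ P? (x ∷ xs) h with P? x
  ... | yes p = x , p
  ... | no  _ = count≢0⇒∃ P? xs h

  module _ {k M : ℕ} where

    Pattern : Set
    Pattern = Vec (Fin k) M

    Word : ℕ → Set
    Word = Vec Pattern

    entry : Word n → Fin n → Fin M → Fin k
    entry w i p = lookup (lookup w i) p

    ws : ∀ n → List (Word n)
    ws = words (patterns k M)

    ∈-patterns : (a : Pattern) → a ∈ patterns k M
    ∈-patterns = ∈-words ∈-allFin

    ∈-ws : (w : Word n) → w ∈ ws n
    ∈-ws = ∈-words ∈-patterns

    ws-unique : ∀ n → Unique (ws n)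
    ws-unique = words-unique (words-unique (Unique.allFin⁺ k) M)

    -- The words satisfying Y form a product over the blocks of γ.
    Recombining : ∀ {g} → (Fin n → Fin M → Fin g) → Pred (Word n) 0ℓ → Set
    Recombining γ Y = ∀ b {u v w} → Y v → Y w →
      (∀ i p → γ i p ≡ b → entry u i p ≡ entry w i p) →
      (∀ i p → γ i p ≢ b → entry u i p ≡ entry v i p) → Y u

    -- Each choice from `T` may have its own completion `v`. In the application such a `T` gives a
    -- template inside `P` for the column copy `i`, and `K` bounds k^Ent of it.
    BoxesBoundedBy : ℕ → Pred (Word n) 0ℓ → Set
    BoxesBoundedBy K F = ∀ i T → (∀ a → Box T a → ∃ λ v → F v × lookup v i ≡ a) → boxSize T ≤ K

    module _ {g} (γ : Fin n → Fin M → Fin g) where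

      graft : Fin g → Word n → Word n → Word n
      graft b v w = tabulate λ i → tabulate λ p →
        if does (γ i p Fin.≟ b) then entry w i p else entry v i p

      entry-graft : ∀ b v w i p →
        entry (graft b v w) i p ≡ (if does (γ i p Fin.≟ b) then entry w i p else entry v i p)
      entry-graft b v w i p = trans (cong (λ a → lookup a p) (lookup∘tabulate _ i)) (lookup∘tabulate _ p)

      graft-on : ∀ b v w i p → γ i p ≡ b → entry (graft b v w) i p ≡ entry w i p
      graft-on b v w i p eq = trans (entry-graft b v w i p)
        (cong (if_then entry w i p else entry v i p) (dec-true (γ i p Fin.≟ b) eq))

      graft-off : ∀ b v w i p → γ i p ≢ b → entry (graft b v w) i p ≡ entry v i p
      graft-off b v w i p ne = trans (entry-graft b v w i p)
        (cong (if_then entry w i p else entry v i p) (dec-false (γ i p Fin.≟ b) ne))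

      exchange : Fin g → Word n × Word n → Word n × Word n
      exchange b (v , w) = graft b v w , graft b w v

      -- Every entry of `v` and of `w` survives in one of the two grafts: on block `b` in the other
      -- one, off it in its own.
      exchange-injective : ∀ b {x y} → exchange b x ≡ exchange b y → x ≡ y
      exchange-injective b {v , w} {v′ , w′} eq = cong₂ _,_
        (ext² λ i p → proj₁ (entries i p)) (ext² λ i p → proj₂ (entries i p))
        where
        ext² : {x y : Word n} → (∀ i p → entry x i p ≡ entry y i p) → x ≡ y
        ext² h = lookup-extensional λ i → lookup-extensional (h i)
        at₁ : ∀ i p → entry (graft b v w) i p ≡ entry (graft b v′ w′) i p
        at₁ i p = cong (λ x → entry (proj₁ x) i p) eq
        at₂ : ∀ i p → entry (graft b w v) i p ≡ entry (graft b w′ v′) i p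
        at₂ i p = cong (λ x → entry (proj₂ x) i p) eq
        entries : ∀ i p → entry v i p ≡ entry v′ i p × entry w i p ≡ entry w′ i p
        entries i p with γ i p Fin.≟ b
        ... | yes e = trans (sym (graft-on b w v i p e)) (trans (at₂ i p) (graft-on b w′ v′ i p e)) ,
                      trans (sym (graft-on b v w i p e)) (trans (at₁ i p) (graft-on b v′ w′ i p e))
        ... | no ne = trans (sym (graft-off b v w i p ne)) (trans (at₁ i p) (graft-off b v′ w′ i p ne)) ,
                      trans (sym (graft-off b w v i p ne)) (trans (at₂ i p) (graft-off b w′ v′ i p ne))

    module _ {g} {γ : Fin (suc n) → Fin M → Fin g}
             (γ-inj : ∀ {p p′} → γ zero p ≡ γ zero p′ → p ≡ p′)
             {Y : Pred (Word (suc n)) 0ℓ} (Y? : Decidable Y) (rec : Recombining γ Y) (a : Pattern) where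

      Agrees : List (Fin M) → Pred (Word (suc n)) 0ℓ
      Agrees ps v = Y v × All (λ p → entry v zero p ≡ lookup a p) ps

      agrees? : ∀ ps → Decidable (Agrees ps)
      agrees? ps v = Y? v ×-dec All.all? (λ p → entry v zero p Fin.≟ lookup a p) ps

      agreeing : List (Fin M) → ℕ
      agreeing ps = count (agrees? ps) (ws (suc n))

      -- Independence inside `Y`: exchange the block of `p` between a word agreeing at `ps` and a
      -- word agreeing at `p`. By `γ-inj` the positions in `ps` lie in other blocks, so the first
      -- word gains agreement at `p` and loses none.
      agreeing-∷ : ∀ {p ps} → All (p ≢_) ps →
                   agreeing ps * agreeing (p ∷ []) ≤ agreeing (p ∷ ps) * count Y? (ws (suc n))
      agreeing-∷ {p} {ps} p∉ =
        count-×-injection (agrees? ps) (agrees? (p ∷ [])) (agrees? (p ∷ ps)) Y?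
          (ws-unique (suc n)) ∈-ws (exchange γ b)
          (λ { {v} {w} (yv , av) (yw , ap ∷ []) →
               ( rec b yv yw (graft-on γ b v w) (graft-off γ b v w)
               , trans (graft-on γ b v w zero p refl) ap ∷ All.zipWith
                   (λ { {q} (p≢q , aq) → trans (graft-off γ b v w zero q (p≢q ∘ sym ∘ γ-inj)) aq }) (p∉ , av))
               , rec b yw yv (graft-on γ b w v) (graft-off γ b w v) })
          (exchange-injective γ b)
        where
        b : Fin g
        b = γ zero p

      -- By `agreeing-∷` the frequencies multiply. The denominator |Y| is cleared by cancelling it
      -- at the end, hence the separate case of an empty `Y`.
      agreeing-≥ : ∀ D ps → Unique ps →
                   (∀ p → count Y? (ws (suc n)) ≤ D * agreeing (p ∷ [])) →
                   count Y? (ws (suc n)) ≤ D ^ length ps * agreeing ps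
      agreeing-≥ D [] _ h = ≤-trans
        (count-mono Y? (agrees? []) (λ y → y , []) (ws (suc n))) (≤-reflexive (sym (*-identityˡ _)))
      agreeing-≥ D (p ∷ ps) (p∉ ∷ u) h with count Y? (ws (suc n)) in eq
      ... | zero = z≤n
      ... | Y₀@(suc _) = *-cancelʳ-≤ Y₀ (D * D ^ length ps * agreeing (p ∷ ps)) Y₀ (begin
        Y₀ * Y₀                                             ≤⟨ *-mono-≤ ih (h p) ⟩
        (D ^ length ps * agreeing ps) * (D * agreeing (p ∷ []))
          ≡⟨ solve 4 (λ x y d z → (x :* y) :* (d :* z) := d :* x :* (y :* z)) refl
               (D ^ length ps) (agreeing ps) D (agreeing (p ∷ [])) ⟩
        D * D ^ length ps * (agreeing ps * agreeing (p ∷ []))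
          ≤⟨ *-monoʳ-≤ (D * D ^ length ps) (agreeing-∷ p∉) ⟩
        D * D ^ length ps * (agreeing (p ∷ ps) * count Y? (ws (suc n)))
          ≡⟨ cong (λ c → D * D ^ length ps * (agreeing (p ∷ ps) * c)) eq ⟩
        D * D ^ length ps * (agreeing (p ∷ ps) * Y₀)
          ≡⟨ *-assoc (D * D ^ length ps) _ Y₀ ⟨
        D * D ^ length ps * agreeing (p ∷ ps) * Y₀ ∎)
        where
        open ≤-Reasoning
        open ℕ.+-*-Solver
        ih : Y₀ ≤ D ^ length ps * agreeing ps
        ih = subst (_≤ D ^ length ps * agreeing ps) eq
               (agreeing-≥ D ps u (λ q → subst (_≤ D * agreeing (q ∷ [])) (sym eq) (h q)))

      agreeing-all : agreeing (allFin M) ≤ count (Y? ∘ (a ∷_)) (ws n)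
      agreeing-all = count-injection (agrees? (allFin M)) (Y? ∘ (a ∷_)) (ws-unique (suc n)) ∈-ws
        (λ {v} _ → tail v)
        (λ { {v ∷ vs} (y , av) → subst (λ x → Y (x ∷ vs)) (head≡ v av) y })
        (λ { {v ∷ vs} {w ∷ .vs} (_ , av) (_ , aw) refl → cong (_∷ vs) (trans (head≡ v av) (sym (head≡ w aw))) })
        where
        head≡ : ∀ v → All (λ p → lookup v p ≡ lookup a p) (allFin M) → v ≡ a
        head≡ v av = lookup-extensional λ p → All.lookup av (∈-allFin p)

      agreeing-single : ∀ p → count (Y? ∘ (a ∷_)) (ws n) ≤ agreeing (p ∷ [])
      agreeing-single p = count-injection (Y? ∘ (a ∷_)) (agrees? (p ∷ [])) (ws-unique n) ∈-ws
        (λ {v} _ → a ∷ v) (λ y → y , refl ∷ []) (λ { _ _ refl → refl })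

  -- The counting inequality

  pointwise-lookup : ∀ {k} (v : Vec (Fin k) m) (T : Vec (Subset k) m) → (∀ i → lookup v i ∈ₛ lookup T i) → Box T v
  pointwise-lookup []      []      h = []
  pointwise-lookup (x ∷ v) (p ∷ T) h = h zero ∷ pointwise-lookup v T (h ∘ suc)

  -- A colour is rare if fewer than 1/`D₀` of the words in `Y` have it. A pattern outside the
  -- palettes uses up one factor of the reserve `Q`^σ, so the patterns of one column weigh at most
  -- `K` + `Π`/`Q` = `X`/`Q` together. `D` is the price of `M` frequent colours at once.
  module _ {k M : ℕ} .{{_ : NonZero k}} (K Q D₀ d : ℕ) .{{_ : NonZero K}} .{{_ : NonZero Q}} .{{_ : NonZero D₀}}
           (D≡ : suc d ≡ D₀ ^ M) where

    private
      Π = k ^ M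
      X = Q * K + Π
      D = suc d

      instance
        Π≢0 : NonZero Π
        Π≢0 = m^n≢0 k M

      #_ : ∀ {n} {P : Pred (Word {k} {M} n) 0ℓ} → Decidable P → ℕ
      #_ {n} P? = count P? (ws n)

    -- β counts the missing choices to be waited for before |Y| is small enough, and σ bounds the
    -- number of rare colours, each of which divides |Y| by D₀.
    countBound : ∀ n β σ → {F Y : Pred (Word {k} {M} n) 0ℓ} (F? : Decidable F) (Y? : Decidable Y) →
      (∀ {v} → F v → Y v) →
      ∀ {g} (γ : Fin n → Fin M → Fin g) → (∀ i {p p′} → γ i p ≡ γ i p′ → p ≡ p′) →
      Recombining γ Y → BoxesBoundedBy K F → # Y? ≤ D₀ ^ σ →
      D ^ β * (Q ^ n * # F?) ≤ Q ^ n * (d ^ β * # Y?) + D ^ β * (Q ^ σ * (X ^ n * Π ^ β))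
    -- All β losses have been taken, and what is left of `Y` bounds `F`.
    countBound n zero σ F? Y? F⊆Y γ γ-inj rec box small = begin
      1 * (Q ^ n * # F?)         ≡⟨ *-identityˡ _ ⟩
      Q ^ n * # F?               ≤⟨ *-monoʳ-≤ (Q ^ n) (count-mono F? Y? F⊆Y (ws n)) ⟩
      Q ^ n * # Y?               ≡⟨ cong (Q ^ n *_) (*-identityˡ _) ⟨
      Q ^ n * (1 * # Y?)         ≤⟨ m≤m+n _ _ ⟩
      Q ^ n * (1 * # Y?) + _     ∎
      where open ≤-Reasoning
    -- Everything is revealed: at most one word is left, and the second term is positive.
    countBound zero β@(suc _) σ F? Y? F⊆Y γ γ-inj rec box small = begin
      D ^ β * (1 * # F?)                       ≤⟨ *-monoʳ-≤ (D ^ β) (begin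
        1 * # F?                                 ≡⟨ *-identityˡ _ ⟩
        # F?                                     ≤⟨ #F≤1 ⟩
        1                                        ≤⟨ >-nonZero⁻¹ _ {{m*n≢0 (Q ^ σ) (1 * Π ^ β)
                                                      {{m^n≢0 Q σ}} {{m*n≢0 1 (Π ^ β) {{_}} {{m^n≢0 Π β}}}}}} ⟩
        Q ^ σ * (1 * Π ^ β)                      ∎) ⟩
      D ^ β * (Q ^ σ * (1 * Π ^ β))            ≤⟨ m≤n+m _ _ ⟩
      _ + D ^ β * (Q ^ σ * (1 * Π ^ β))        ∎
      where
      open ≤-Reasoning
      #F≤1 : # F? ≤ 1
      #F≤1 with F? []
      ... | yes _ = ≤-refl
      ... | no  _ = z≤n
    countBound (suc n) β@(suc β′) σ {F} {Y} F? Y? F⊆Y γ γ-inj rec box small =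
      step (Any.any? bad? (patterns k M))
      where
      y f : ℕ
      y = # Y?
      f = # F?
      yₐ fₐ : Pattern → ℕ
      yₐ a = # (Y? ∘ (a ∷_))
      fₐ a = # (F? ∘ (a ∷_))

      marginal? : ∀ p x → Decidable (λ v → Y v × entry v zero p ≡ x)
      marginal? p x v = Y? v ×-dec (entry v zero p Fin.≟ x)

      frequent? : ∀ p → Decidable (λ x → y ≤ D₀ * # (marginal? p x))
      frequent? p x = y ≤? D₀ * # (marginal? p x)

      T : Vec (Subset k) M
      T = tabulate (comprehension ∘ frequent?)

      agreeing-marginal : ∀ a p → agreeing (γ-inj zero) Y? rec a (p ∷ []) ≡ # (marginal? p (lookup a p))
      agreeing-marginal a p = count-cong (agrees? (γ-inj zero) Y? rec a (p ∷ [])) (marginal? p (lookup a p))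
        (λ { (v∈ , e ∷ []) → v∈ , e }) (λ { (v∈ , e) → v∈ , e ∷ [] }) (ws (suc n))

      box-frequent : ∀ a → Box T a → ∀ p → y ≤ D₀ * # (marginal? p (lookup a p))
      box-frequent a a∈ p = ∈-comprehension⁻ (frequent? p)
        (subst (lookup a p ∈ₛ_) (lookup∘tabulate (comprehension ∘ frequent?) p) (Pointwise.lookup a∈ p))

      frequent-box : ∀ a → (∀ p → y ≤ D₀ * # (marginal? p (lookup a p))) → Box T a
      frequent-box a h = pointwise-lookup a T λ p →
        subst (lookup a p ∈ₛ_) (sym (lookup∘tabulate (comprehension ∘ frequent?) p))
          (∈-comprehension⁺ (frequent? p) (h p))

      -- All `M` entries of `a` are frequent, and `agreeing-≥` multiplies their frequencies.
      box-heavy : ∀ a → Box T a → y ≤ D * yₐ a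
      box-heavy a a∈ = begin
        y                                            ≤⟨ agreeing-≥ (γ-inj zero) Y? rec a D₀ (allFin M) (Unique.allFin⁺ M)
                                                          (λ p → subst (λ c → y ≤ D₀ * c) (sym (agreeing-marginal a p)) (box-frequent a a∈ p)) ⟩
        D₀ ^ length (allFin M) * agreeing (γ-inj zero) Y? rec a (allFin M)
                                                     ≤⟨ *-monoʳ-≤ (D₀ ^ length (allFin M)) (agreeing-all (γ-inj zero) Y? rec a) ⟩
        D₀ ^ length (allFin M) * yₐ a                ≡⟨ cong (λ l → D₀ ^ l * yₐ a) (length-allFin M) ⟩
        D₀ ^ M * yₐ a                                ≡⟨ cong (_* yₐ a) D≡ ⟨
        D * yₐ a                                     ∎
        where open ≤-Reasoning

      -- One rare entry suffices, since all words that begin with `a` share it.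
      rare-light : ∀ a → ¬ Box T a → D₀ * yₐ a < y
      rare-light a a∉ with Fin.all? (λ p → frequent? p (lookup a p))
      ... | yes h = ⊥-elim (a∉ (frequent-box a h))
      ... | no ¬h with Fin.¬∀⟶∃¬ M _ (λ p → frequent? p (lookup a p)) ¬h
      ...   | p , ¬fr = begin-strict
        D₀ * yₐ a                                          ≤⟨ *-monoʳ-≤ D₀ (agreeing-single (γ-inj zero) Y? rec a p) ⟩
        D₀ * agreeing (γ-inj zero) Y? rec a (p ∷ [])       ≡⟨ cong (D₀ *_) (agreeing-marginal a p) ⟩
        D₀ * # (marginal? p (lookup a p))                  <⟨ ≰⇒> ¬fr ⟩
        y                                                  ∎
        where open ≤-Reasoning

      Bad : Pattern → Set
      Bad a = Box T a × fₐ a ≡ 0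

      bad? : Decidable Bad
      bad? a = box? T a ×-dec (fₐ a ≟ 0)

      fₐ≤yₐ : ∀ a → fₐ a ≤ yₐ a
      fₐ≤yₐ a = count-mono (F? ∘ (a ∷_)) (Y? ∘ (a ∷_)) F⊆Y (ws n)

      ih : ∀ β σ a → yₐ a ≤ D₀ ^ σ →
           D ^ β * (Q ^ n * fₐ a) ≤ Q ^ n * (d ^ β * yₐ a) + D ^ β * (Q ^ σ * (X ^ n * Π ^ β))
      ih β σ a = countBound n β σ (F? ∘ (a ∷_)) (Y? ∘ (a ∷_)) F⊆Y (γ ∘ suc) (γ-inj ∘ suc)
        (λ b yv yw on off → rec b yv yw
          (λ { zero p _ → refl ; (suc i) p → on i p }) (λ { zero p _ → refl ; (suc i) p → off i p }))
        (λ i T′ h → box (suc i) T′ λ a′ a′∈ → let (v , Fv , e) = h a′ a′∈ in a ∷ v , Fv , e)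

      yₐ≤y : ∀ a → yₐ a ≤ y
      yₐ≤y a = count-injection (Y? ∘ (a ∷_)) Y? (ws-unique n) ∈-ws (λ {v} _ → a ∷ v) id (λ { _ _ refl → refl })

      y≡ : y ≡ ∑ (patterns k M) yₐ
      y≡ = count-words-suc (patterns k M) Y?

      f≡ : f ≡ ∑ (patterns k M) fₐ
      f≡ = count-words-suc (patterns k M) F?

      #patterns : length (patterns k M) ≡ Π
      #patterns = trans (length-words (allFin k) M) (cong (_^ M) (length-allFin k))

      Goal : Set
      Goal = D ^ β * (Q ^ suc n * f) ≤ Q ^ suc n * (d ^ β * y) + D ^ β * (Q ^ σ * (X ^ suc n * Π ^ β))

      -- The fibre over `a*` contains no member of `F` but at least 1/`D` of `Y`. Leaving it out of
      -- the sum replaces `y` by at most (1 - 1/`D`) `y`, which raises the power of `d` from β′ to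
      -- β. The second term is added once for each pattern, which raises the power of `Π`.
      bad-step : ∀ a → Bad a → Goal
      bad-step a* (a*∈ , empty) = begin
        D * D ^ β′ * (Q * Q ^ n * f)
          ≡⟨ solve 5 (λ D Dβ Q Qn f → D :* Dβ :* (Q :* Qn :* f) := Q :* (D :* (Dβ :* (Qn :* f)))) refl D (D ^ β′) Q (Q ^ n) f ⟩
        Q * (D * (D ^ β′ * (Q ^ n * f)))
          ≤⟨ *-monoʳ-≤ Q (+-cancelʳ-≤ (q * y) _ _ summed) ⟩
        Q * (d * (q * y) + D * (Π * c))
          ≡⟨ solve 11 (λ Q d Qn dβ y D Dβ Qσ Xn R Πβ →
                         Q :* (d :* (Qn :* dβ :* y) :+ D :* (R :* (Dβ :* (Qσ :* (Xn :* Πβ)))))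
               := Q :* Qn :* (d :* dβ :* y) :+ D :* Dβ :* (Qσ :* (Q :* Xn :* (R :* Πβ)))) refl
               Q d (Q ^ n) (d ^ β′) y D (D ^ β′) (Q ^ σ) (X ^ n) Π (Π ^ β′) ⟩
        Q * Q ^ n * (d * d ^ β′ * y) + D * D ^ β′ * (Q ^ σ * (Q * X ^ n * (Π * Π ^ β′)))
          -- Since `Q` ≤ `X`, the revealed column can be charged like any other, whatever its
          -- palettes.
          ≤⟨ +-monoʳ-≤ (Q * Q ^ n * (d * d ^ β′ * y)) (*-monoʳ-≤ (D * D ^ β′) (*-monoʳ-≤ (Q ^ σ)
               (*-monoˡ-≤ (Π * Π ^ β′) (*-monoˡ-≤ (X ^ n) (≤-trans (m≤m*n Q K) (m≤m+n (Q * K) Π)))))) ⟩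
        Q * Q ^ n * (d * d ^ β′ * y) + D * D ^ β′ * (Q ^ σ * (X * X ^ n * (Π * Π ^ β′))) ∎
        where
        open ≤-Reasoning
        open ℕ.+-*-Solver
        q c : ℕ
        q = Q ^ n * d ^ β′
        c = D ^ β′ * (Q ^ σ * (X ^ n * Π ^ β′))
        l r : Pattern → ℕ
        l a = D ^ β′ * (Q ^ n * fₐ a)
        r a = q * yₐ a + c
        l≤r : ∀ a → l a ≤ r a
        l≤r a = subst (λ z → l a ≤ z + c) (sym (*-assoc (Q ^ n) (d ^ β′) (yₐ a))) (ih β′ σ a (≤-trans (yₐ≤y a) small))
        l+≤r : l a* + q * yₐ a* ≤ r a*
        l+≤r = begin
          l a* + q * yₐ a*   ≡⟨ cong (λ z → D ^ β′ * (Q ^ n * z) + q * yₐ a*) empty ⟩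
          D ^ β′ * (Q ^ n * 0) + q * yₐ a*  ≡⟨ cong (λ z → D ^ β′ * z + q * yₐ a*) (*-zeroʳ (Q ^ n)) ⟩
          D ^ β′ * 0 + q * yₐ a*  ≡⟨ cong (_+ q * yₐ a*) (*-zeroʳ (D ^ β′)) ⟩
          q * yₐ a*          ≤⟨ m≤m+n _ c ⟩
          r a*               ∎
        Σr : ∑ (patterns k M) r ≡ q * y + Π * c
        Σr = trans (∑-+ (patterns k M) _ _) (cong₂ _+_
          (trans (∑-*ˡ (patterns k M) q yₐ) (cong (q *_) (sym y≡)))
          (trans (∑-const (patterns k M) c) (cong (_* c) #patterns)))
        Σl : ∑ (patterns k M) l ≡ D ^ β′ * (Q ^ n * f)
        Σl = trans (∑-*ˡ (patterns k M) (D ^ β′) _)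
               (cong (D ^ β′ *_) (trans (∑-*ˡ (patterns k M) (Q ^ n) fₐ) (cong (Q ^ n *_) (sym f≡))))
        total : D ^ β′ * (Q ^ n * f) + q * yₐ a* ≤ q * y + Π * c
        total = subst₂ (λ s t → s + q * yₐ a* ≤ t) Σl Σr (∑-mono-∈ l≤r (∈-patterns a*) l+≤r)
        -- The term `q * y` on both sides stands for the subtraction of `y`/`D`: on the left it is
        -- absorbed by `D` times the gain at `a*`.
        summed : D * (D ^ β′ * (Q ^ n * f)) + q * y ≤ d * (q * y) + D * (Π * c) + q * y
        summed = begin
          D * (D ^ β′ * (Q ^ n * f)) + q * y
            ≤⟨ +-monoʳ-≤ _ (*-monoʳ-≤ q (box-heavy a* a*∈)) ⟩
          D * (D ^ β′ * (Q ^ n * f)) + q * (D * yₐ a*)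
            ≡⟨ solve 4 (λ D z q y → D :* z :+ q :* (D :* y) := D :* (z :+ q :* y)) refl D (D ^ β′ * (Q ^ n * f)) q (yₐ a*) ⟩
          D * (D ^ β′ * (Q ^ n * f) + q * yₐ a*)
            ≤⟨ *-monoʳ-≤ D total ⟩
          D * (q * y + Π * c)
            ≡⟨ solve 3 (λ d x z → (con 1 :+ d) :* (x :+ z) := d :* x :+ (con 1 :+ d) :* z :+ x) refl d (q * y) (Π * c) ⟩
          d * (q * y) + D * (Π * c) + q * y ∎

      -- Every choice from `T` is continued by a member of `F`, so `boxSize T` is at most `K`. After
      -- multiplication by `Q`, a pattern in the box keeps σ and weighs `Q`, while one outside
      -- lowers σ and weighs 1; with at most `K` of the former and `Π` patterns in all this adds up
      -- to `X`. The terms with `yₐ` add up to the term with `y`.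
      good-step : (∀ a → ¬ Bad a) → Goal
      good-step good = begin
        D ^ β * (Q ^ suc n * f)
          ≡⟨ Σl ⟨
        ∑ (patterns k M) l
          ≤⟨ ∑-mono (patterns k M) l≤r ⟩
        ∑ (patterns k M) (λ a → q * yₐ a + c * (χ a + 1))
          ≡⟨ Σr ⟩
        q * y + c * (count (box? T) (patterns k M) * Q + Π)
          ≤⟨ +-monoʳ-≤ (q * y) (*-monoʳ-≤ c (+-monoˡ-≤ Π (≤-trans
               (*-monoˡ-≤ Q (≤-trans (≤-reflexive (count-box T)) boxSize≤K)) (≤-reflexive (*-comm K Q))))) ⟩
        q * y + c * X
          ≡⟨ cong₂ _+_ (*-assoc (Q ^ suc n) (d ^ β) y)
               (solve 5 (λ Dβ Qσ Xn Πβ X → Dβ :* (Qσ :* (Xn :* Πβ)) :* X := Dβ :* (Qσ :* (X :* Xn :* Πβ))) refl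
                 (D ^ β) (Q ^ σ) (X ^ n) (Π ^ β) X) ⟩
        Q ^ suc n * (d ^ β * y) + D ^ β * (Q ^ σ * (X ^ suc n * Π ^ β)) ∎
        where
        open ≤-Reasoning
        open ℕ.+-*-Solver
        q c : ℕ
        q = Q ^ suc n * d ^ β
        c = D ^ β * (Q ^ σ * (X ^ n * Π ^ β))
        l χ : Pattern → ℕ
        l a = D ^ β * (Q ^ suc n * fₐ a)
        χ a with box? T a
        ... | yes _ = Q
        ... | no  _ = 0
        χ-yes : ∀ a → Box T a → χ a ≡ Q
        χ-yes a a∈ with box? T a
        ... | yes _ = refl
        ... | no a∉ = ⊥-elim (a∉ a∈)
        χ-no : ∀ a → ¬ Box T a → χ a ≡ 0
        χ-no a a∉ with box? T a
        ... | yes a∈ = ⊥-elim (a∉ a∈)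
        ... | no _ = refl
        boxSize≤K : boxSize T ≤ K
        boxSize≤K = box zero T λ a a∈ →
          let (v , Fv) = count≢0⇒∃ (F? ∘ (a ∷_)) (ws n) (λ e → good a (a∈ , e)) in a ∷ v , Fv , refl
        scaled : ∀ σ a → yₐ a ≤ D₀ ^ σ →
                 l a ≤ q * yₐ a + D ^ β * (Q ^ suc σ * (X ^ n * Π ^ β))
        scaled σ a small-a = begin
          D ^ β * (Q * Q ^ n * fₐ a)
            ≡⟨ solve 4 (λ D Q Qn f → D :* (Q :* Qn :* f) := Q :* (D :* (Qn :* f))) refl (D ^ β) Q (Q ^ n) (fₐ a) ⟩
          Q * (D ^ β * (Q ^ n * fₐ a))
            ≤⟨ *-monoʳ-≤ Q (ih β σ a small-a) ⟩
          Q * (Q ^ n * (d ^ β * yₐ a) + D ^ β * (Q ^ σ * (X ^ n * Π ^ β)))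
            ≡⟨ solve 7 (λ Q Qn dβ y D Qσ Z → Q :* (Qn :* (dβ :* y) :+ D :* (Qσ :* Z)) := Q :* Qn :* dβ :* y :+ D :* (Q :* Qσ :* Z)) refl
                 Q (Q ^ n) (d ^ β) (yₐ a) (D ^ β) (Q ^ σ) (X ^ n * Π ^ β) ⟩
          q * yₐ a + D ^ β * (Q ^ suc σ * (X ^ n * Π ^ β)) ∎
        rare : ∀ σ a → y ≤ D₀ ^ σ → ¬ Box T a → l a ≤ q * yₐ a + D ^ β * (Q ^ σ * (X ^ n * Π ^ β))
        -- With σ used up `Y` has at most one word, and a fibre with less than 1/`D₀` of it is
        -- empty.
        rare zero a y≤1 a∉ = begin
          l a                                ≡⟨ cong (λ z → D ^ β * (Q ^ suc n * z)) (n≤0⇒n≡0 (≤-trans (fₐ≤yₐ a) yₐ≤0)) ⟩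
          D ^ β * (Q ^ suc n * 0)            ≡⟨ cong (D ^ β *_) (*-zeroʳ (Q ^ suc n)) ⟩
          D ^ β * 0                          ≡⟨ *-zeroʳ (D ^ β) ⟩
          0                                  ≤⟨ z≤n ⟩
          _                                  ∎
          where
          yₐ≤0 : yₐ a ≤ 0
          yₐ≤0 = ≤-trans (m≤n*m (yₐ a) D₀) (s≤s⁻¹ (<-≤-trans (rare-light a a∉) y≤1))
        rare (suc σ) a y≤ a∉ = scaled σ a (<⇒≤ (*-cancelˡ-< D₀ (yₐ a) (D₀ ^ σ) (<-≤-trans (rare-light a a∉) y≤)))
        l≤r : ∀ a → l a ≤ q * yₐ a + c * (χ a + 1)
        l≤r a with box? T a
        ... | yes a∈ = ≤-trans (scaled σ a (≤-trans (yₐ≤y a) small)) (+-monoʳ-≤ (q * yₐ a) (begin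
          D ^ β * (Q ^ suc σ * (X ^ n * Π ^ β))
            ≡⟨ solve 4 (λ D Q Qσ Z → D :* (Q :* Qσ :* Z) := D :* (Qσ :* Z) :* Q) refl (D ^ β) Q (Q ^ σ) (X ^ n * Π ^ β) ⟩
          c * Q        ≤⟨ *-monoʳ-≤ c (m≤m+n Q 1) ⟩
          c * (Q + 1)  ∎))
        ... | no a∉ = ≤-trans (rare σ a small a∉) (+-monoʳ-≤ (q * yₐ a) (≤-reflexive (sym (*-identityʳ c))))
        Σl : ∑ (patterns k M) l ≡ D ^ β * (Q ^ suc n * f)
        Σl = trans (∑-*ˡ (patterns k M) (D ^ β) _)
               (cong (D ^ β *_) (trans (∑-*ˡ (patterns k M) (Q ^ suc n) fₐ) (cong (Q ^ suc n *_) (sym f≡))))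
        Σr : ∑ (patterns k M) (λ a → q * yₐ a + c * (χ a + 1)) ≡ q * y + c * (count (box? T) (patterns k M) * Q + Π)
        Σr = trans (∑-+ (patterns k M) _ _) (cong₂ _+_
          (trans (∑-*ˡ (patterns k M) q yₐ) (cong (q *_) (sym y≡)))
          (trans (∑-*ˡ (patterns k M) c _) (cong (c *_) (trans (∑-+ (patterns k M) χ _) (cong₂ _+_
            (∑-indicator (box? T) Q χ-yes χ-no (patterns k M))
            (trans (∑-const (patterns k M) 1) (trans (*-identityʳ _) #patterns)))))))

      step : Dec (Any.Any Bad (patterns k M)) → Goal
      step (yes h) = let (a , _ , bad) = find h in bad-step a bad
      step (no ¬h) = good-step (λ a bad → ¬h (lose (∈-patterns a) bad))

-- Subcubes

edge-≡ : ∀ {n} {e f : Edge n} → (∀ i → lookup (lower e) i ≡ lookup (lower f) i) → dir e ≡ dir f → e ≡ f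
edge-≡ h = edge-ext (lookup-extensional h)

edgeIndex : ∀ {n} → Edge n → Fin (length (edges n))
edgeIndex e = Any.index (∈-edges e)

edgeAt : ∀ {n} → Fin (length (edges n)) → Edge n
edgeAt = List.lookup (edges _)

edgeAt-index : ∀ {n} (e : Edge n) → edgeAt (edgeIndex e) ≡ e
edgeAt-index e = sym (lookup-index (∈-edges e))

edgeAt-injective : ∀ n {i j} → edgeAt {n} i ≡ edgeAt j → i ≡ j
edgeAt-injective n {i} {j} = lookup-injectiveᵁ (edges-unique n) i j

index-edgeAt : ∀ n i → edgeIndex (edgeAt {n} i) ≡ i
index-edgeAt n i = edgeAt-injective n (edgeAt-index (edgeAt i))

-- The directions of Q_W arranged in A blocks of B directions each.
record Grid (A B W : ℕ) : Set where
  field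
    at       : Fin A → Fin B → Fin W
    addr     : Fin W → Fin A × Fin B
    at-addr  : ∀ i → at (proj₁ (addr i)) (proj₂ (addr i)) ≡ i
    addr-at  : ∀ a j → addr (at a j) ≡ (a , j)
    at-mono  : ∀ a {i j} → i Fin.< j → at a i Fin.< at a j

rows : ∀ A B → Grid A B (A * B)
rows A B = record
  { at = combine ; addr = remQuot B ; at-addr = Fin.combine-remQuot {A} B ; addr-at = Fin.remQuot-combine
  ; at-mono = λ a {i} {j} i<j → subst₂ _<_ (sym (Fin.toℕ-combine a i)) (sym (Fin.toℕ-combine a j))
                (ℕ.+-monoʳ-< (B * Fin.toℕ a) i<j) }

-- A column is a residue class modulo `B`. Its directions increase with the row, so columns too give
-- order-preserving embeddings and heredity applies to them.
columns : ∀ A B → Grid B A (A * B)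
columns A B = record
  { at = λ a j → combine j a ; addr = swap ∘ remQuot B ; at-addr = Fin.combine-remQuot {A} B
  ; addr-at = λ a j → cong swap (Fin.remQuot-combine j a)
  ; at-mono = λ a → Fin.combine-monoˡ-< a a }

module Decompose {A B W} (G : Grid A B W) where
  open Grid G

  embed : Fin A → Vertex W → Vertex B → Vertex W
  embed a x y = tabulate λ i →
    if does (proj₁ (addr i) Fin.≟ a) then lookup y (proj₂ (addr i)) else lookup x i

  embed-on : ∀ {a} x y i → proj₁ (addr i) ≡ a → lookup (embed a x y) i ≡ lookup y (proj₂ (addr i))
  embed-on {a} x y i eq = trans (lookup∘tabulate _ i)
    (cong (if_then _ else lookup x i) (dec-true (proj₁ (addr i) Fin.≟ a) eq))

  embed-off : ∀ {a} x y i → proj₁ (addr i) ≢ a → lookup (embed a x y) i ≡ lookup x i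
  embed-off {a} x y i ne = trans (lookup∘tabulate _ i)
    (cong (if_then lookup y (proj₂ (addr i)) else _) (dec-false (proj₁ (addr i) Fin.≟ a) ne))

  origin : Vertex B
  origin = replicate B false

  clear : Fin A → Vertex W → Vertex W
  clear a x = embed a x origin

  extract : Fin A → Vertex W → Vertex B
  extract a x = tabulate λ j → lookup x (at a j)

  embed-extract : ∀ a x → embed a (clear a x) (extract a x) ≡ x
  embed-extract a x = lookup-extensional λ i → go i (proj₁ (addr i) Fin.≟ a)
    where
    go : ∀ i → Dec (proj₁ (addr i) ≡ a) → lookup (embed a (clear a x) (extract a x)) i ≡ lookup x i
    go i (yes eq) = trans (embed-on (clear a x) (extract a x) i eq) (trans (lookup∘tabulate (λ j → lookup x (at a j)) (proj₂ (addr i)))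
      (cong (lookup x) (trans (cong (λ a → at a (proj₂ (addr i))) (sym eq)) (at-addr i))))
    go i (no ne) = trans (embed-off (clear a x) (extract a x) i ne) (embed-off x origin i ne)

  embed-at : ∀ a x y j → lookup (embed a x y) (at a j) ≡ lookup y j
  embed-at a x y j = trans (embed-on x y (at a j) (cong proj₁ (addr-at a j)))
                           (cong (lookup y ∘ proj₂) (addr-at a j))

  extract-embed : ∀ a x y → extract a (embed a x y) ≡ y
  extract-embed a x y = lookup-extensional λ j → trans (lookup∘tabulate _ j) (embed-at a x y j)

  clear-embed : ∀ a x y → clear a (embed a x y) ≡ clear a x
  clear-embed a x y = lookup-extensional λ i → go i (proj₁ (addr i) Fin.≟ a)
    where
    go : ∀ i → Dec (proj₁ (addr i) ≡ a) → lookup (clear a (embed a x y)) i ≡ lookup (clear a x) i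
    go i (yes eq) = trans (embed-on (embed a x y) origin i eq) (sym (embed-on x origin i eq))
    go i (no ne) = trans (embed-off (embed a x y) origin i ne) (trans (embed-off x y i ne) (sym (embed-off x origin i ne)))

  clear-cong-off : ∀ {a x x′} → clear a x ≡ clear a x′ → ∀ i → proj₁ (addr i) ≢ a → lookup x i ≡ lookup x′ i
  clear-cong-off {a} {x} {x′} eq i ne =
    trans (sym (embed-off x origin i ne)) (trans (cong (λ v → lookup v i) eq) (embed-off x′ origin i ne))

  -- A copy of the smaller cube is a block together with fixed coordinates outside it. Putting 0
  -- inside the block normalises the pair, so that each copy is listed once.
  Cleared : Fin A × Vertex W → Set
  Cleared (a , x) = clear a x ≡ x

  cleared? : Decidable Cleared
  cleared? (a , x) = ≡-decᵛ Bool._≟_ (clear a x) x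

  copies : List (Fin A × Vertex W)
  copies = filter cleared? (cartesianProduct (allFin A) (vertices W))

  copies-unique : Unique copies
  copies-unique = Unique.filter⁺ cleared? (Unique.cartesianProduct⁺ (Unique.allFin⁺ A) (vertices-unique W))

  ∈-copies : ∀ a x → (a , clear a x) ∈ copies
  ∈-copies a x = ∈-filter⁺ cleared? (∈-cartesianProduct⁺ (∈-allFin a) (∈-vertices (clear a x)))
    (clear-embed a x origin)

  #copies : ℕ
  #copies = length copies

  block : Fin #copies → Fin A
  block i = proj₁ (List.lookup copies i)

  base : Fin #copies → Vertex W
  base i = proj₂ (List.lookup copies i)

  base-cleared : ∀ i → clear (block i) (base i) ≡ base i
  base-cleared i = proj₂ (∈-filter⁻ cleared? {xs = cartesianProduct (allFin A) (vertices W)} (∈-lookup i))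

  embedding : Fin A → Vertex W → OrderEmbedding B W
  embedding a x = record
    { φ      = embed a x
    ; b      = at a
    ; b-mono = at-mono a
    ; φ-on   = embed-at a x
    ; φ-off  = λ y i i∉ →
        let i-off : proj₁ (addr i) ≢ a
            i-off eq = i∉ (proj₂ (addr i)) (trans (sym (at-addr i)) (cong (λ a → at a (proj₂ (addr i))) eq))
        in trans (embed-off x y i i-off) (sym (embed-off x origin i i-off)) }

  φᴱ : Fin A → Vertex W → Edge B → Edge W
  φᴱ a x = OrderEmbedding.φᴱ (embedding a x)

  copy : Fin #copies → OrderEmbedding B W
  copy i = embedding (block i) (base i)

  copyᴱ : Fin #copies → Edge B → Edge W
  copyᴱ i = OrderEmbedding.φᴱ (copy i)

  blockOf : Edge W → Fin A
  blockOf e = proj₁ (addr (dir e))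

  part : Edge W → Fin #copies
  part e = Any.index (∈-copies (blockOf e) (lower e))

  pos : Edge W → Edge B
  pos e@(mkEdge x i p) = mkEdge (extract (blockOf e) x) (proj₂ (addr i))
    (trans (lookup∘tabulate _ (proj₂ (addr i))) (trans (cong (lookup x) (at-addr i)) p))

  lookup-part : ∀ e → List.lookup copies (part e) ≡ (blockOf e , clear (blockOf e) (lower e))
  lookup-part e = sym (lookup-index (∈-copies (blockOf e) (lower e)))

  copy-pos : ∀ e → copyᴱ (part e) (pos e) ≡ e
  copy-pos e = trans (cong (λ ax → φᴱ (proj₁ ax) (proj₂ ax) (pos e)) (lookup-part e))
    (edge-ext (embed-extract (blockOf e) (lower e)) (at-addr (dir e)))

  part-copy : ∀ i f → part (copyᴱ i f) ≡ i
  part-copy i f = lookup-injectiveᵁ copies-unique _ i (trans (lookup-part e) (cong₂ _,_ block≡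
    (trans (cong (λ a → clear a (lower e)) block≡) (trans (clear-embed _ (base i) (lower f)) (base-cleared i)))))
    where
    e = copyᴱ i f
    block≡ : blockOf e ≡ block i
    block≡ = cong proj₁ (addr-at (block i) (dir f))

  pos-copy : ∀ i f → pos (copyᴱ i f) ≡ f
  pos-copy i f = edge-ext
    (trans (cong (λ a → extract a (lower e)) block≡) (extract-embed (block i) (base i) (lower f)))
    (cong proj₂ (addr-at (block i) (dir f)))
    where
    e = copyᴱ i f
    block≡ : blockOf e ≡ block i
    block≡ = cong proj₁ (addr-at (block i) (dir f))

  part-injective : ∀ {e e′} → part e ≡ part e′ →
    blockOf e ≡ blockOf e′ × (∀ i → proj₁ (addr i) ≢ blockOf e → lookup (lower e) i ≡ lookup (lower e′) i)
  part-injective {e} {e′} eq = ,-injectiveˡ pair ,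
    clear-cong-off {x = lower e} {lower e′} (trans (,-injectiveʳ pair) (cong (λ a → clear a (lower e′)) (sym (,-injectiveˡ pair))))
    where
    pair : (blockOf e , clear (blockOf e) (lower e)) ≡ (blockOf e′ , clear (blockOf e′) (lower e′))
    pair = trans (sym (lookup-part e)) (trans (cong (List.lookup copies) eq) (lookup-part e′))

  -- The copies partition the edges: an edge lies in exactly one copy, that of the block containing
  -- its direction.
  #copies*e : #copies * length (edges B) ≡ length (edges W)
  #copies*e = ℕ.≤-antisym
    (Fin.injective⇒≤ {f = to} λ {i} {j} → to-inj i j)
    (Fin.injective⇒≤ {f = from} λ {i} {j} → from-inj i j)
    where
    M = length (edges B)
    position : Fin (#copies * M) → Edge B
    position i = edgeAt (proj₂ (remQuot {#copies} M i))
    unpack : Fin (#copies * M) → Edge W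
    unpack i = copyᴱ (proj₁ (remQuot M i)) (position i)
    to : Fin (#copies * M) → Fin (length (edges W))
    to i = edgeIndex (unpack i)
    from : Fin (length (edges W)) → Fin (#copies * M)
    from i = let e = edgeAt {W} i in combine (part e) (edgeIndex (pos e))
    to-inj : ∀ i j → to i ≡ to j → i ≡ j
    to-inj i j eq = trans (sym (Fin.combine-remQuot {#copies} M i))
      (trans (cong₂ combine part≡ (edgeAt-injective B pos≡)) (Fin.combine-remQuot {#copies} M j))
      where
      e≡ : unpack i ≡ unpack j
      e≡ = trans (sym (edgeAt-index (unpack i))) (trans (cong edgeAt eq) (edgeAt-index (unpack j)))
      part≡ = trans (sym (part-copy _ (position i))) (trans (cong part e≡) (part-copy _ (position j)))
      pos≡ = trans (sym (pos-copy (proj₁ (remQuot M i)) (position i))) (trans (cong pos e≡) (pos-copy (proj₁ (remQuot M j)) (position j)))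
    from-inj : ∀ i j → from i ≡ from j → i ≡ j
    from-inj i j eq with Fin.combine-injective _ _ _ _ eq
    ... | part≡ , index≡ = edgeAt-injective W
      (trans (sym (copy-pos e)) (trans (cong₂ copyᴱ part≡ pos≡) (copy-pos e′)))
      where
      e = edgeAt {W} i
      e′ = edgeAt {W} j
      pos≡ : pos e ≡ pos e′
      pos≡ = trans (sym (edgeAt-index (pos e))) (trans (cong edgeAt index≡) (edgeAt-index (pos e′)))

module Transversal (A B : ℕ) where
  open Decompose (columns A B) using (embed-at)
    renaming (copyᴱ to columnᴱ; block to column; base to columnBase)
  open Decompose (rows A B) using () renaming (part to row; part-injective to row-injective)

  -- Edges in one row copy have directions in one row, where the column has a single direction; so
  -- the directions agree. The lower endpoints agree off that row because the row copy is the same,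
  -- and in the common direction both are 0.
  transversal : ∀ i {f f′} → row (columnᴱ i f) ≡ row (columnᴱ i f′) → f ≡ f′
  transversal i {f} {f′} eq with row-injective {columnᴱ i f} {columnᴱ i f′} eq
  ... | row≡ , agree = edge-≡ same-lower dir≡
    where
    dir-row : ∀ g → proj₁ (remQuot {A} B (combine (dir g) (column i))) ≡ dir g
    dir-row g = cong proj₁ (Fin.remQuot-combine (dir g) (column i))
    dir≡ : dir f ≡ dir f′
    dir≡ = trans (sym (dir-row f)) (trans row≡ (dir-row f′))
    same-lower : ∀ j → lookup (lower f) j ≡ lookup (lower f′) j
    same-lower j with j Fin.≟ dir f
    ... | yes refl = trans (edge-zero f) (sym (trans (cong (lookup (lower f′)) dir≡) (edge-zero f′)))
    ... | no ne = trans (sym (embed-at (column i) (columnBase i) (lower f) j))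
        (trans (agree (combine j (column i)) λ e → ne (trans (sym (cong proj₁ (Fin.remQuot-combine j (column i)))) (trans e (dir-row f))))
               (embed-at (column i) (columnBase i) (lower f′) j))

-- Colourings of the grid of subcubes

-- Its `boxSize` is |⟨t⟩|, that is, k^Ent of `t` as a natural number.
templateBox : ∀ {k n} → Template k n → Vec (Subset k) (length (edges n))
templateBox t = tabulate (palette t ∘ edgeAt)

boxSize-empty : ∀ {k m} (T : Vec (Subset k) m) i → ∣ lookup T i ∣ ≡ 0 → boxSize T ≡ 0
boxSize-empty (p ∷ T) zero    eq = cong (_* boxSize T) eq
boxSize-empty (p ∷ T) (suc i) eq = trans (cong (∣ p ∣ *_) (boxSize-empty T i eq)) (ℕ.*-zeroʳ ∣ p ∣)

module Counting {k : ℕ} {P : Property k} {card : ℕ → ℕ} (cardinality : ∀ n → HasCardinality P n (card n)) where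

  module Enum n = Inverse (cardinality n)

  member : ∀ n → Fin (card n) → Colouring k n
  member n i = proj₁ (Enum.to n i)

  member∈ : ∀ n i → mem P n (member n i)
  member∈ n i = proj₂ (Enum.to n i)

  index : ∀ {n c} → mem P n c → Fin (card n)
  index {n} {c} c∈ = Enum.from n (c , c∈)

  member-index : ∀ {n c} (c∈ : mem P n c) → member n (index c∈) ≗ c
  member-index {n} {c} c∈ = Enum.strictlyInverseˡ n (c , c∈)

  member-injective : ∀ {n i j} → member n i ≗ member n j → i ≡ j
  member-injective {n} {i} {j} eq =
    trans (sym (Enum.strictlyInverseʳ n i)) (trans (Enum.from-cong n eq) (Enum.strictlyInverseʳ n j))

  index-injective : ∀ {n c c′} (c∈ : mem P n c) (c′∈ : mem P n c′) → index c∈ ≡ index c′∈ → c ≗ c′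
  index-injective {n} c∈ c′∈ eq e =
    trans (sym (member-index c∈ e)) (trans (cong (λ i → member n i e) eq) (member-index c′∈ e))

  -- The bijection with `Fin (card n)` makes membership decidable: compare with each listed
  -- colouring on each of the finitely many edges.
  mem? : ∀ n → Decidable (mem P n)
  mem? n c = map′ (λ (i , eq) → resp P n eq (member∈ n i)) (λ c∈ → index c∈ , member-index c∈)
    (Fin.any? λ i → map′ (λ all e → All.lookup all (∈-edges e)) (λ eq → All.tabulate (λ {e} _ → eq e))
      (All.all? (λ e → member n i e Fin.≟ c e) (edges n)))

  module Cover {A B W} (G : Grid A B W) where
    open Decompose G

    Covered : Colouring k W → Set
    Covered c = ∀ j → mem P B (c ∘ copyᴱ j)

    restrictions : ∀ c → Covered c → Fin (card B ^ #copies)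
    restrictions c c∈ = funToFin (λ j → index (c∈ j))

    restrictions-injective : ∀ c c′ (c∈ : Covered c) (c′∈ : Covered c′) →
                             restrictions c c∈ ≡ restrictions c′ c′∈ → c ≗ c′
    restrictions-injective c c′ c∈ c′∈ eq e = subst (λ e → c e ≡ c′ e) (copy-pos e)
      (index-injective {B} {c ∘ copyᴱ j} {c′ ∘ copyᴱ j} (c∈ j) (c′∈ j)
        (trans (sym (Fin.finToFun-funToFin (λ j → index (c∈ j)) j))
          (trans (cong (λ r → finToFun r j) eq) (Fin.finToFun-funToFin (λ j → index (c′∈ j)) j)))
        (pos e))
      where j = part e

    -- A colouring is determined by its restrictions to the copies, and heredity puts these in `P`.
    -- With `#copies*e`, the rate log card / e is no larger at `W` than at `B`.
    card-cover : OrderHereditary P → card W ≤ card B ^ #copies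
    card-cover her = Fin.injective⇒≤ {f = λ i → restrictions (member W i) (covered i)}
      λ {i} {i′} eq → member-injective
        (restrictions-injective (member W i) (member W i′) (covered i) (covered i′) eq)
      where
      covered : ∀ i → Covered (member W i)
      covered i j = her (copy j) (member W i) (member∈ W i)

  module Step (her : OrderHereditary P) (m w : ℕ) where
    open Decompose (columns m w)
    module Row = Decompose (rows m w)
    module RowCover = Cover (rows m w)

    W M : ℕ
    W = m * w
    M = length (edges m)

    decode : Word {k} {M} #copies → Colouring k W
    decode v e = entry v (part e) (edgeIndex (pos e))

    encode : Colouring k W → Word {k} {M} #copies
    encode c = tabulate λ i → tabulate λ p → c (copyᴱ i (edgeAt {m} p))

    decode-encode : ∀ c → decode (encode c) ≗ c
    decode-encode c e = begin
      entry (encode c) (part e) (edgeIndex (pos e))   ≡⟨ cong (λ x → lookup x (edgeIndex (pos e))) (lookup∘tabulate _ (part e)) ⟩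
      lookup (tabulate λ p → c (copyᴱ (part e) (edgeAt {m} p))) (edgeIndex (pos e))
                                                      ≡⟨ lookup∘tabulate _ (edgeIndex (pos e)) ⟩
      c (copyᴱ (part e) (edgeAt (edgeIndex (pos e)))) ≡⟨ cong (c ∘ copyᴱ (part e)) (edgeAt-index (pos e)) ⟩
      c (copyᴱ (part e) (pos e))                      ≡⟨ cong c (copy-pos e) ⟩
      c e                                             ∎
      where open ≡-Reasoning

    decode-copy : ∀ v i f → decode v (copyᴱ i f) ≡ entry v i (edgeIndex f)
    decode-copy v i f = cong₂ (λ j g → entry v j (edgeIndex g)) (part-copy i f) (pos-copy i f)

    decode-injective : ∀ {v v′} → decode v ≗ decode v′ → v ≡ v′
    decode-injective {v} {v′} eq = lookup-extensional λ i → lookup-extensional λ p → begin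
      entry v i p                         ≡⟨ cong (entry v i) (index-edgeAt m p) ⟨
      entry v i (edgeIndex (edgeAt {m} p))    ≡⟨ decode-copy v i (edgeAt {m} p) ⟨
      decode v (copyᴱ i (edgeAt {m} p))       ≡⟨ eq (copyᴱ i (edgeAt {m} p)) ⟩
      decode v′ (copyᴱ i (edgeAt {m} p))      ≡⟨ decode-copy v′ i (edgeAt {m} p) ⟩
      entry v′ i (edgeIndex (edgeAt {m} p))   ≡⟨ cong (entry v′ i) (index-edgeAt m p) ⟩
      entry v′ i p                        ∎
      where open ≡-Reasoning

    F Y : Word {k} {M} #copies → Set
    F v = mem P W (decode v)
    Y v = ∀ j → mem P w (decode v ∘ Row.copyᴱ j)

    F? : Decidable F
    F? v = mem? W (decode v)

    Y? : Decidable Y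
    Y? v = Fin.all? (λ j → mem? w (decode v ∘ Row.copyᴱ j))

    F⊆Y : ∀ {v} → F v → Y v
    F⊆Y {v} Fv j = her (Row.copy j) (decode v) Fv

    γ : Fin #copies → Fin M → Fin Row.#copies
    γ i p = Row.part (copyᴱ i (edgeAt {m} p))

    γ-injective : ∀ i {p p′} → γ i p ≡ γ i p′ → p ≡ p′
    γ-injective i eq = edgeAt-injective m (Transversal.transversal m w i eq)

    γ-row : ∀ j f → let e = Row.copyᴱ j f in γ (part e) (edgeIndex (pos e)) ≡ j
    γ-row j f = trans (cong (Row.part ∘ copyᴱ (part e)) (edgeAt-index (pos e)))
      (trans (cong Row.part (copy-pos e)) (Row.part-copy j f))
      where e = Row.copyᴱ j f

    -- A row copy is a single block of `γ`, so it comes entirely from one of the two words.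
    recombining : Recombining γ Y
    recombining b {u} {v} {v′} Yv Yv′ on off j with j Fin.≟ b
    ... | yes refl = resp P w (λ f → sym (on _ _ (γ-row j f))) (Yv′ j)
    ... | no j≢b   = resp P w (λ f → sym (off _ _ (j≢b ∘ trans (sym (γ-row j f))))) (Yv j)

    card≤#F : card W ≤ count F? (ws #copies)
    card≤#F = Fin≤-count F? ∈-ws (encode ∘ member W)
      (λ i → resp P W (λ e → sym (decode-encode (member W i) e)) (member∈ W i))
      (λ i j eq → member-injective λ e → trans (sym (decode-encode (member W i) e))
        (trans (cong (λ v → decode v e) eq) (decode-encode (member W j) e)))

    #Y≤card^ : count Y? (ws #copies) ≤ card w ^ Row.#copies
    #Y≤card^ = count-≤Fin Y? (ws-unique #copies)
      (λ {v} → RowCover.restrictions (decode v))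
      (λ {v} {v′} Yv Yv′ eq → decode-injective (RowCover.restrictions-injective (decode v) (decode v′) Yv Yv′ eq))

    #Y≤all : count Y? (ws #copies) ≤ (k ^ M) ^ #copies
    #Y≤all = ℕ.≤-trans (length-filter Y? (ws #copies)) (ℕ.≤-reflexive
      (trans (length-words (patterns k M) #copies) (cong (_^ #copies)
        (trans (length-words (List.allFin k) M) (cong (_^ M) (length-allFin k))))))

    -- Read as palettes on `Q_m`, a realised `T` is a template: each colouring it allows is the
    -- restriction to column copy `i` of a member of `P`, hence lies in `P` by heredity. If a
    -- palette is empty there is no template, but the box has size 0.
    boxesBounded : ∀ K → (∀ (t : Template k m) → t ⊑ P → boxSize (templateBox t) ≤ K) → BoxesBoundedBy K F
    boxesBounded K bound i T realised with Fin.all? (λ p → nonempty? (lookup T p))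
    ... | no ¬all = let (p , empty) = Fin.¬∀⟶∃¬ M _ (λ p → nonempty? (lookup T p)) ¬all in
      subst (_≤ K) (sym (boxSize-empty T p (trans (cong ∣_∣ (Empty-unique empty)) (∣⊥∣≡0 k)))) z≤n
    ... | yes all = subst (λ T → boxSize T ≤ K) box≡ (bound t t⊑P)
      where
      t : Template k m
      t = record { palette = lookup T ∘ edgeIndex ; nonempty = all ∘ edgeIndex }
      box≡ : templateBox t ≡ T
      box≡ = trans (tabulate-cong (cong (lookup T) ∘ index-edgeAt m)) (tabulate∘lookup T)
      t⊑P : t ⊑ P
      t⊑P c c∈ = resp P m same (her (copy i) (decode v) Fv)
        where
        a : Vec (Fin k) M
        a = tabulate (c ∘ edgeAt)
        a∈ : Box T a
        a∈ = pointwise-lookup a T λ p → subst₂ (λ x q → x ∈ₛ lookup T q)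
          (sym (lookup∘tabulate (c ∘ edgeAt) p)) (index-edgeAt m p) (c∈ (edgeAt {m} p))
        v = proj₁ (realised a a∈)
        Fv = proj₁ (proj₂ (realised a a∈))
        same : decode v ∘ copyᴱ i ≗ c
        same f = begin
          decode v (copyᴱ i f)      ≡⟨ decode-copy v i f ⟩
          entry v i (edgeIndex f)   ≡⟨ cong (λ x → lookup x (edgeIndex f)) (proj₂ (proj₂ (realised a a∈))) ⟩
          lookup a (edgeIndex f)    ≡⟨ lookup∘tabulate (c ∘ edgeAt) (edgeIndex f) ⟩
          c (edgeAt (edgeIndex f))  ≡⟨ cong c (edgeAt-index f) ⟩
          c f                       ∎
          where open ≡-Reasoning

    stepBound : .{{_ : NonZero k}} → ∀ K Q q d .{{_ : NonZero K}} .{{_ : NonZero Q}} → suc d ≡ (k ^ q) ^ M →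
      (∀ (t : Template k m) → t ⊑ P → boxSize (templateBox t) ≤ K) →
      ∀ β σ → (k ^ M) ^ #copies ≤ (k ^ q) ^ σ →
      suc d ^ β * (Q ^ #copies * card W) ≤ Q ^ #copies * (d ^ β * card w ^ Row.#copies)
        + suc d ^ β * (Q ^ σ * ((Q * K + k ^ M) ^ #copies * (k ^ M) ^ β))
    stepBound K Q q d D≡ bound β σ small = begin
      suc d ^ β * (Q ^ #copies * card W)
        ≤⟨ ℕ.*-monoʳ-≤ (suc d ^ β) (ℕ.*-monoʳ-≤ (Q ^ #copies) card≤#F) ⟩
      suc d ^ β * (Q ^ #copies * count F? (ws #copies))
        ≤⟨ countBound K Q (k ^ q) d D≡ #copies β σ F? Y? (λ {v} → F⊆Y {v}) γ γ-injective
             (λ b {u} {v} {v′} → recombining b {u} {v} {v′})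
             (boxesBounded K bound) (ℕ.≤-trans #Y≤all small) ⟩
      Q ^ #copies * (d ^ β * count Y? (ws #copies)) + rest
        ≤⟨ ℕ.+-monoˡ-≤ rest (ℕ.*-monoʳ-≤ (Q ^ #copies) (ℕ.*-monoʳ-≤ (d ^ β) #Y≤card^)) ⟩
      Q ^ #copies * (d ^ β * card w ^ Row.#copies) + rest ∎
      where
      open ℕ.≤-Reasoning
      instance
        k^q≢0 : NonZero (k ^ q)
        k^q≢0 = ℕ.m^n≢0 k q
      rest : ℕ
      rest = suc d ^ β * (Q ^ σ * ((Q * K + k ^ M) ^ #copies * (k ^ M) ^ β))

-- Elementary bounds on boxes and on the number of members

length-patterns : ∀ k m → length (patterns k m) ≡ k ^ m
length-patterns k m = trans (length-words (allFin k) m) (cong (_^ m) (length-allFin k))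

boxSize≤ : ∀ {k m} (T : Vec (Subset k) m) → boxSize T ≤ k ^ m
boxSize≤ {k} {m} T = subst₂ _≤_ (count-box T) (length-patterns k m) (length-filter (box? T) (patterns k m))

face : ∀ {n} → Bool → OrderEmbedding n (suc n)
face h = record { φ = h ∷_ ; b = suc ; b-mono = s≤s ; φ-on = λ _ _ → refl ; φ-off = off }
  where
  off : ∀ x i → (∀ j → i ≢ suc j) → lookup (h ∷ x) i ≡ lookup (h ∷ Vec.replicate _ false) i
  off x zero    _ = refl
  off x (suc i) h with () ← h i refl

spoke : ∀ {n} → Vertex n → Edge (suc n)
spoke x = mkEdge (false ∷ x) zero refl

funToFin-injective : ∀ {m n} (f g : Fin m → Fin n) → funToFin f ≡ funToFin g → f ≗ g
funToFin-injective f g eq i = trans (sym (Fin.finToFun-funToFin f i))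
  (trans (cong (λ r → finToFun r i) eq) (Fin.finToFun-funToFin g i))

module Bounds {k : ℕ} {P : Property k} {card : ℕ → ℕ} (cardinality : ∀ n → HasCardinality P n (card n)) where
  open Counting {P = P} cardinality

  card≤k^e : ∀ n → card n ≤ k ^ length (edges n)
  card≤k^e n = Fin.injective⇒≤ {f = λ i → funToFin (λ p → member n i (edgeAt p))} λ {i} {j} eq →
    member-injective λ e → subst (λ e → member n i e ≡ member n j e) (edgeAt-index e)
      (funToFin-injective (λ p → member n i (edgeAt p)) (λ p → member n j (edgeAt p)) eq (edgeIndex e))

  -- A colouring is given by its two faces in direction 0 and by the colours of the 2^n edges
  -- between them.
  card-suc : OrderHereditary P → ∀ n → card (suc n) ≤ card n * card n * k ^ 2 ^ n
  card-suc her n = subst (λ V → card (suc n) ≤ card n * card n * k ^ V) (length-vertices n)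
    (Fin.injective⇒≤ {f = code} λ {i} {j} → code-injective i j)
    where
    side : ∀ h i → mem P n (member (suc n) i ∘ OrderEmbedding.φᴱ (face h))
    side h i = her (face h) (member (suc n) i) (member∈ (suc n) i)
    spokes : Fin (card (suc n)) → Fin (length (vertices n)) → Fin k
    spokes i p = member (suc n) i (spoke (List.lookup (vertices n) p))
    code : Fin (card (suc n)) → Fin (card n * card n * k ^ length (vertices n))
    code i = combine (combine (index (side false i)) (index (side true i))) (funToFin (spokes i))
    code-injective : ∀ i j → code i ≡ code j → i ≡ j
    code-injective i j eq with Fin.combine-injective (combine (index (side false i)) _) _ (combine (index (side false j)) _) _ eq
    ... | sides , spokes≡ with Fin.combine-injective (index (side false i)) _ (index (side false j)) _ sides
    ...   | left , right = member-injective same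
      where
      same : member (suc n) i ≗ member (suc n) j
      same (mkEdge (false ∷ x) zero _)    =
        subst (λ x → member (suc n) i (spoke x) ≡ member (suc n) j (spoke x)) (sym (lookup-index (∈-vertices x)))
          (funToFin-injective (spokes i) (spokes j) spokes≡ (Any.index (∈-vertices x)))
      same (mkEdge (false ∷ x) (suc d) p) = index-injective (side false i) (side false j) left (mkEdge x d p)
      same (mkEdge (true ∷ x)  (suc d) p) = index-injective (side true i) (side true j) right (mkEdge x d p)

  boxSize≤card : ∀ {n} (t : Template k n) → t ⊑ P → boxSize (templateBox t) ≤ card n
  boxSize≤card {n} t t⊑P = subst (_≤ card n) (count-box (templateBox t))
    (count-≤Fin (box? (templateBox t)) (words-unique (Unique.allFin⁺ k) (length (edges n)))
      (λ {a} a∈ → index (t⊑P (colour a) (colour∈ a a∈)))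
      (λ {a} {a′} a∈ a′∈ eq → lookup-extensional λ p → begin
        lookup a p                          ≡⟨ cong (lookup a) (index-edgeAt n p) ⟨
        colour a (edgeAt p)                 ≡⟨ index-injective (t⊑P (colour a) (colour∈ a a∈)) (t⊑P (colour a′) (colour∈ a′ a′∈)) eq (edgeAt p) ⟩
        colour a′ (edgeAt p)                ≡⟨ cong (lookup a′) (index-edgeAt n p) ⟩
        lookup a′ p                         ∎))
    where
    open ≡-Reasoning
    colour : Vec (Fin k) (length (edges n)) → Colouring k n
    colour a e = lookup a (edgeIndex e)
    colour∈ : ∀ a → Box (templateBox t) a → ⟨ t ⟩ (colour a)
    colour∈ a a∈ e = subst₂ (λ p f → lookup a p ∈ₛ palette t f) refl (edgeAt-index e)
      (subst (lookup a (edgeIndex e) ∈ₛ_) (lookup∘tabulate (palette t ∘ edgeAt) (edgeIndex e)) (Pointwise.lookup a∈ (edgeIndex e)))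

-- Powers

[m*n]^o : ∀ m n o → (m * n) ^ o ≡ m ^ o * n ^ o
[m*n]^o m n zero    = refl
[m*n]^o m n (suc o) = trans (cong (m * n *_) ([m*n]^o m n o)) ([m*n]*[o*p]≡[m*o]*[n*p] m n (m ^ o) (n ^ o))

^-comm : ∀ m n o → (m ^ n) ^ o ≡ (m ^ o) ^ n
^-comm m n o = trans (^-*-assoc m n o) (trans (cong (m ^_) (*-comm n o)) (sym (^-*-assoc m o n)))

-- This is (1 - 1/(q+1))^y ≥ 1 - y/(q+1), multiplied by (q+1)^(y+1).
bernoulli-upper : ∀ q y → suc q ^ suc y ≤ q ^ y * suc q + y * suc q ^ y
bernoulli-upper q zero    = ≤-reflexive (solve 1 (λ q → q :* con 1 := con 1 :* q :+ con 0) refl (suc q))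
  where open ℕ.+-*-Solver
bernoulli-upper q (suc y) = begin
  suc q * suc q ^ suc y                                   ≤⟨ *-monoʳ-≤ (suc q) (bernoulli-upper q y) ⟩
  suc q * (q ^ y * suc q + y * suc q ^ y)
    ≡⟨ solve 4 (λ q a y b → (con 1 :+ q) :* (a :* (con 1 :+ q) :+ y :* b)
         := q :* a :* (con 1 :+ q) :+ ((con 1 :+ q) :* a :+ y :* ((con 1 :+ q) :* b))) refl q (q ^ y) y (suc q ^ y) ⟩
  q * q ^ y * suc q + (suc q * q ^ y + y * (suc q * suc q ^ y))
    ≤⟨ +-monoʳ-≤ (q * q ^ y * suc q) (+-monoˡ-≤ _ (*-monoʳ-≤ (suc q) (^-monoˡ-≤ y (n≤1+n q)))) ⟩
  q * q ^ y * suc q + (suc q * suc q ^ y + y * (suc q * suc q ^ y)) ∎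
  where
  open ≤-Reasoning
  open ℕ.+-*-Solver

suc^≤2* : ∀ q y → 2 * y ≤ suc q → suc q ^ y ≤ 2 * q ^ y
suc^≤2* q y 2y≤ = *-cancelˡ-≤ (suc q) (+-cancelʳ-≤ (suc q * z) _ _ (begin
  suc q * z + suc q * z                ≡⟨ solve 1 (λ x → x :+ x := con 2 :* x) refl (suc q * z) ⟩
  2 * suc q ^ suc y                    ≤⟨ *-monoʳ-≤ 2 (bernoulli-upper q y) ⟩
  2 * (q ^ y * suc q + y * z)          ≡⟨ solve 4 (λ a q y z → con 2 :* (a :* q :+ y :* z) := q :* (con 2 :* a) :+ con 2 :* y :* z) refl (q ^ y) (suc q) y z ⟩
  suc q * (2 * q ^ y) + 2 * y * z      ≤⟨ +-monoʳ-≤ _ (*-monoˡ-≤ z 2y≤) ⟩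
  suc q * (2 * q ^ y) + suc q * z      ∎))
  where
  open ≤-Reasoning
  open ℕ.+-*-Solver
  z = suc q ^ y

-- This is (1 + 1/d)^j ≥ 1 + j/d with denominators cleared.
bernoulli-lower : ∀ d j → d ^ j * (d + j) ≤ suc d ^ j * d
bernoulli-lower d zero    = ≤-reflexive (cong (1 *_) (+-identityʳ d))
bernoulli-lower d (suc j) = begin
  d * d ^ j * (d + suc j)                     ≡⟨ solve 3 (λ d a j → d :* a :* (d :+ (con 1 :+ j)) := d :* (a :* (d :+ j)) :+ d :* a) refl d (d ^ j) j ⟩
  d * (d ^ j * (d + j)) + d * d ^ j           ≤⟨ +-mono-≤ (*-monoʳ-≤ d (bernoulli-lower d j)) (*-monoʳ-≤ d (^-monoˡ-≤ j (n≤1+n d))) ⟩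
  d * (suc d ^ j * d) + d * suc d ^ j         ≡⟨ solve 2 (λ d b → d :* (b :* d) :+ d :* b := (con 1 :+ d) :* b :* d) refl d (suc d ^ j) ⟩
  suc d * suc d ^ j * d                       ∎
  where
  open ≤-Reasoning
  open ℕ.+-*-Solver

2*≤suc^ : ∀ d .{{_ : NonZero d}} → 2 * d ^ d ≤ suc d ^ d
2*≤suc^ d = *-cancelʳ-≤ (2 * d ^ d) (suc d ^ d) d (≤-trans
  (≤-reflexive (solve 2 (λ a d → con 2 :* a :* d := a :* (d :+ d)) refl (d ^ d) d)) (bernoulli-lower d d))
  where open ℕ.+-*-Solver

-- `K` is the integer part of the v-th root of `C`, searched up to `b`. It converts a bound on v-th
-- powers of box sizes into the integer bound used by the counting inequality.
root-floor : ∀ v C → 1 ≤ C → ∀ b → ∃[ K ] 1 ≤ K × K ^ v ≤ C × (∀ x → x ≤ b → x ^ v ≤ C → x ≤ K)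
root-floor v C 1≤C zero    = 1 , ≤-refl , ≤-trans (≤-reflexive (^-zeroˡ v)) 1≤C , λ x x≤ _ → ≤-trans x≤ z≤n
root-floor v C 1≤C (suc b) with suc b ^ v ≤? C | root-floor v C 1≤C b
... | yes h | _ = suc b , s≤s z≤n , h , λ x x≤ _ → x≤
... | no ¬h | K , 1≤K , K^v≤ , max = K , 1≤K , K^v≤ , λ x x≤ x^v≤ → case x≤ x^v≤
  where
  case : ∀ {x} → x ≤ suc b → x ^ v ≤ C → x ≤ K
  case {x} x≤ x^v≤ with m≤n⇒m<n∨m≡n x≤
  ... | inj₁ x< = max x (s≤s⁻¹ x<) x^v≤
  ... | inj₂ refl = ⊥-elim (¬h x^v≤)

-- The conclusion is log_k p ≤ (u/v + 5/s) N. In the s-th power of the hypothesis the errors 2^s,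
-- `Q`^(σs), (1 + 1/q₁)^(ns) ≤ 2^n and `Π`^(βs) are at most k to the powers N, 2N, N and N, five N
-- in all; the main term u/v comes from K^n. Here `λ′` is any upper bound for log_k `Q`.
templateCase : ∀ {k M K q₁ u v s n σ β λ′ p} → 2 ≤ k → .{{_ : NonZero M}} .{{_ : NonZero K}} .{{_ : NonZero q₁}} →
  let Π = k ^ M ; Q = Π * q₁ ; N = n * M in
  suc q₁ ^ s ≤ 2 * q₁ ^ s → K ^ v ≤ k ^ (u * M) → Q ≤ k ^ λ′ → λ′ * (σ * s) ≤ 2 * N → β * s ≤ n → s ≤ N →
  Q ^ n * p ≤ 2 * (Q ^ σ * ((Q * K + Π) ^ n * Π ^ β)) →
  p ^ (s * v) ≤ k ^ ((u * s + 5 * v) * N)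
templateCase {k} {M} {K} {q₁} {u} {v} {s} {n} {σ} {β} {λ′} {p} 2≤k q₁-large K^v≤ Q≤ λσs≤ βs≤n s≤N h = begin
  p ^ (s * v)                               ≡⟨ ^-*-assoc p s v ⟨
  (p ^ s) ^ v                               ≤⟨ ^-monoˡ-≤ v p^s≤ ⟩
  (k ^ (5 * N) * (K ^ n) ^ s) ^ v           ≡⟨ [m*n]^o (k ^ (5 * N)) ((K ^ n) ^ s) v ⟩
  (k ^ (5 * N)) ^ v * ((K ^ n) ^ s) ^ v     ≡⟨ cong₂ _*_ (^-*-assoc k (5 * N) v)
                                                 (trans (cong (_^ v) (^-*-assoc K n s)) (^-comm K (n * s) v)) ⟩
  k ^ (5 * N * v) * (K ^ v) ^ (n * s)       ≤⟨ *-monoʳ-≤ (k ^ (5 * N * v)) (^-monoˡ-≤ (n * s) K^v≤) ⟩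
  k ^ (5 * N * v) * (k ^ (u * M)) ^ (n * s) ≡⟨ cong (k ^ (5 * N * v) *_) (^-*-assoc k (u * M) (n * s)) ⟩
  k ^ (5 * N * v) * k ^ (u * M * (n * s))   ≡⟨ ^-distribˡ-+-* k (5 * N * v) (u * M * (n * s)) ⟨
  k ^ (5 * N * v + u * M * (n * s))         ≡⟨ cong (k ^_) (solve 5 (λ n M v u s → con 5 :* (n :* M) :* v :+ u :* M :* (n :* s)
                                                 := (u :* s :+ con 5 :* v) :* (n :* M)) refl n M v u s) ⟩
  k ^ ((u * s + 5 * v) * N)                 ∎
  where
  open ≤-Reasoning
  open ℕ.+-*-Solver
  Π Q N X : ℕ
  Π = k ^ M
  Q = Π * q₁
  N = n * M
  X = Q * K + Π
  instance
    k≢0 : NonZero k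
    k≢0 = >-nonZero (≤-trans (s≤s z≤n) 2≤k)
    Π≢0 : NonZero Π
    Π≢0 = m^n≢0 k M
    Q≢0 : NonZero Q
    Q≢0 = m*n≢0 Π q₁
    Qns≢0 : NonZero ((Q ^ n) ^ s)
    Qns≢0 = m^n≢0 (Q ^ n) s {{m^n≢0 Q n}}
  -- As `K` ≥ 1 and `Q` = `Π q₁`, the summand `Π` only changes `Q K` by the factor 1 + 1/`q₁`.
  X≤ : X ≤ Π * K * suc q₁
  X≤ = begin
    Π * q₁ * K + Π          ≤⟨ +-monoʳ-≤ (Π * q₁ * K) (m≤m*n Π K) ⟩
    Π * q₁ * K + Π * K      ≡⟨ solve 3 (λ a b c → a :* b :* c :+ a :* c := a :* c :* (con 1 :+ b)) refl Π q₁ K ⟩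
    Π * K * suc q₁          ∎
  X^s≤ : X ^ s ≤ 2 * (Q * K) ^ s
  X^s≤ = begin
    X ^ s                         ≤⟨ ^-monoˡ-≤ s X≤ ⟩
    (Π * K * suc q₁) ^ s          ≡⟨ [m*n]^o (Π * K) (suc q₁) s ⟩
    (Π * K) ^ s * suc q₁ ^ s      ≤⟨ *-monoʳ-≤ ((Π * K) ^ s) q₁-large ⟩
    (Π * K) ^ s * (2 * q₁ ^ s)    ≡⟨ solve 2 (λ a b → a :* (con 2 :* b) := con 2 :* (a :* b)) refl ((Π * K) ^ s) (q₁ ^ s) ⟩
    2 * ((Π * K) ^ s * q₁ ^ s)    ≡⟨ cong (2 *_) ([m*n]^o (Π * K) q₁ s) ⟨
    2 * (Π * K * q₁) ^ s          ≡⟨ cong (λ z → 2 * z ^ s) (solve 3 (λ a b c → a :* b :* c := a :* c :* b) refl Π K q₁) ⟩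
    2 * (Q * K) ^ s               ∎
  X^ns≤ : (X ^ n) ^ s ≤ 2 ^ n * ((Q ^ n) ^ s * (K ^ n) ^ s)
  X^ns≤ = begin
    (X ^ n) ^ s                             ≡⟨ ^-comm X n s ⟩
    (X ^ s) ^ n                             ≤⟨ ^-monoˡ-≤ n X^s≤ ⟩
    (2 * (Q * K) ^ s) ^ n                   ≡⟨ [m*n]^o 2 ((Q * K) ^ s) n ⟩
    2 ^ n * ((Q * K) ^ s) ^ n               ≡⟨ cong (2 ^ n *_) (trans (^-comm (Q * K) s n)
                                                 (trans (cong (_^ s) ([m*n]^o Q K n)) ([m*n]^o (Q ^ n) (K ^ n) s))) ⟩
    2 ^ n * ((Q ^ n) ^ s * (K ^ n) ^ s)     ∎
  2^≤ : ∀ i → 2 ^ i ≤ k ^ i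
  2^≤ i = ^-monoˡ-≤ i 2≤k
  n≤N : n ≤ N
  n≤N = m≤m*n n M
  Mβs≤N : M * (β * s) ≤ N
  Mβs≤N = ≤-trans (*-monoʳ-≤ M βs≤n) (≤-reflexive (*-comm M n))
  error≤ : 2 ^ s * (k ^ (λ′ * (σ * s)) * (2 ^ n * k ^ (M * (β * s)))) ≤ k ^ (5 * N)
  error≤ = begin
    2 ^ s * (k ^ (λ′ * (σ * s)) * (2 ^ n * k ^ (M * (β * s))))
      ≤⟨ *-mono-≤ (≤-trans (2^≤ s) (^-monoʳ-≤ k s≤N)) (*-mono-≤ (^-monoʳ-≤ k λσs≤)
           (*-mono-≤ (≤-trans (2^≤ n) (^-monoʳ-≤ k n≤N)) (^-monoʳ-≤ k Mβs≤N))) ⟩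
    k ^ N * (k ^ (2 * N) * (k ^ N * k ^ N))
      ≡⟨ cong (λ z → k ^ N * (k ^ (2 * N) * z)) (^-distribˡ-+-* k N N) ⟨
    k ^ N * (k ^ (2 * N) * k ^ (N + N))
      ≡⟨ cong (k ^ N *_) (^-distribˡ-+-* k (2 * N) (N + N)) ⟨
    k ^ N * k ^ (2 * N + (N + N))
      ≡⟨ ^-distribˡ-+-* k N _ ⟨
    k ^ (N + (2 * N + (N + N)))
      ≡⟨ cong (k ^_) (solve 1 (λ N → N :+ (con 2 :* N :+ (N :+ N)) := con 5 :* N) refl N) ⟩
    k ^ (5 * N) ∎
  Q^σs≤ : (Q ^ σ) ^ s ≤ k ^ (λ′ * (σ * s))
  Q^σs≤ = begin
    (Q ^ σ) ^ s             ≡⟨ ^-*-assoc Q σ s ⟩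
    Q ^ (σ * s)             ≤⟨ ^-monoˡ-≤ (σ * s) Q≤ ⟩
    (k ^ λ′) ^ (σ * s)      ≡⟨ ^-*-assoc k λ′ (σ * s) ⟩
    k ^ (λ′ * (σ * s))      ∎
  Π^βs≡ : (Π ^ β) ^ s ≡ k ^ (M * (β * s))
  Π^βs≡ = trans (^-*-assoc Π β s) (^-*-assoc k M (β * s))
  p^s≤ : p ^ s ≤ k ^ (5 * N) * (K ^ n) ^ s
  p^s≤ = *-cancelˡ-≤ ((Q ^ n) ^ s) (begin
    (Q ^ n) ^ s * p ^ s
      ≡⟨ [m*n]^o (Q ^ n) p s ⟨
    (Q ^ n * p) ^ s
      ≤⟨ ^-monoˡ-≤ s h ⟩
    (2 * (Q ^ σ * (X ^ n * Π ^ β))) ^ s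
      ≡⟨ trans ([m*n]^o 2 _ s) (cong (2 ^ s *_) (trans ([m*n]^o (Q ^ σ) _ s) (cong ((Q ^ σ) ^ s *_) ([m*n]^o (X ^ n) (Π ^ β) s)))) ⟩
    2 ^ s * ((Q ^ σ) ^ s * ((X ^ n) ^ s * (Π ^ β) ^ s))
      ≤⟨ *-monoʳ-≤ (2 ^ s) (*-mono-≤ Q^σs≤ (*-mono-≤ X^ns≤ (≤-reflexive Π^βs≡))) ⟩
    2 ^ s * (k ^ (λ′ * (σ * s)) * (2 ^ n * ((Q ^ n) ^ s * (K ^ n) ^ s) * k ^ (M * (β * s))))
      ≡⟨ solve 6 (λ a b c d e f → a :* (b :* (c :* (d :* e) :* f)) := d :* (a :* (b :* (c :* f)) :* e)) refl
           (2 ^ s) (k ^ (λ′ * (σ * s))) (2 ^ n) ((Q ^ n) ^ s) ((K ^ n) ^ s) (k ^ (M * (β * s))) ⟩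
    (Q ^ n) ^ s * (2 ^ s * (k ^ (λ′ * (σ * s)) * (2 ^ n * k ^ (M * (β * s)))) * (K ^ n) ^ s)
      ≤⟨ *-monoʳ-≤ ((Q ^ n) ^ s) (*-monoˡ-≤ ((K ^ n) ^ s) error≤) ⟩
    (Q ^ n) ^ s * (k ^ (5 * N) * (K ^ n) ^ s) ∎)

-- Since (1 + 1/d)^d ≥ 2, having β ≥ d (j+1) yields 2^(j+1) p ≤ 2 B: one of the j+1 doublings pays
-- for the factor 2 in the hypothesis. The X-th power turns 2^j into at least 2^N.
lossCase : ∀ {d β Q p B j N X} .{{_ : NonZero d}} .{{_ : NonZero Q}} → d * suc j ≤ β → N ≤ j * X → ∀ n →
  suc d ^ β * (Q ^ n * p) ≤ 2 * (Q ^ n * (d ^ β * B)) → p ^ X * 2 ^ N ≤ B ^ X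
lossCase {d} {β} {Q} {p} {B} {j} {N} {X} dj≤β N≤ n h = begin
  p ^ X * 2 ^ N            ≤⟨ *-monoʳ-≤ (p ^ X) (^-monoʳ-≤ 2 N≤) ⟩
  p ^ X * 2 ^ (j * X)      ≡⟨ cong (p ^ X *_) (^-*-assoc 2 j X) ⟨
  p ^ X * (2 ^ j) ^ X      ≡⟨ [m*n]^o p (2 ^ j) X ⟨
  (p * 2 ^ j) ^ X          ≤⟨ ^-monoˡ-≤ X (*-cancelˡ-≤ (2 * d ^ β) (*-cancelˡ-≤ (Q ^ n) shrink)) ⟩
  B ^ X                    ∎
  where
  open ≤-Reasoning
  open ℕ.+-*-Solver
  r : ℕ
  r = β ∸ d * suc j
  β≡ : β ≡ d * suc j + r
  β≡ = sym (m+[n∸m]≡n dj≤β)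
  instance
    dβ≢0 : NonZero (2 * d ^ β)
    dβ≢0 = m*n≢0 2 (d ^ β) {{_}} {{m^n≢0 d β}}
    Qn≢0 : NonZero (Q ^ n)
    Qn≢0 = m^n≢0 Q n
  growth : 2 ^ suc j * d ^ β ≤ suc d ^ β
  growth = begin
    2 ^ suc j * d ^ β                             ≡⟨ cong (λ b → 2 ^ suc j * d ^ b) β≡ ⟩
    2 ^ suc j * d ^ (d * suc j + r)               ≡⟨ cong (2 ^ suc j *_) (trans (^-distribˡ-+-* d (d * suc j) r) (cong (_* d ^ r) (sym (^-*-assoc d d (suc j))))) ⟩
    2 ^ suc j * ((d ^ d) ^ suc j * d ^ r)         ≡⟨ *-assoc (2 ^ suc j) _ (d ^ r) ⟨
    2 ^ suc j * (d ^ d) ^ suc j * d ^ r           ≡⟨ cong (_* d ^ r) ([m*n]^o 2 (d ^ d) (suc j)) ⟨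
    (2 * d ^ d) ^ suc j * d ^ r                   ≤⟨ *-mono-≤ (^-monoˡ-≤ (suc j) (2*≤suc^ d)) (^-monoˡ-≤ r (n≤1+n d)) ⟩
    (suc d ^ d) ^ suc j * suc d ^ r               ≡⟨ cong (_* suc d ^ r) (^-*-assoc (suc d) d (suc j)) ⟩
    suc d ^ (d * suc j) * suc d ^ r               ≡⟨ ^-distribˡ-+-* (suc d) (d * suc j) r ⟨
    suc d ^ (d * suc j + r)                       ≡⟨ cong (suc d ^_) β≡ ⟨
    suc d ^ β                                     ∎
  shrink : Q ^ n * (2 * d ^ β * (p * 2 ^ j)) ≤ Q ^ n * (2 * d ^ β * B)
  shrink = begin
    Q ^ n * (2 * d ^ β * (p * 2 ^ j))
      ≡⟨ solve 4 (λ q a p b → q :* (con 2 :* a :* (p :* b)) := con 2 :* b :* a :* (q :* p)) refl (Q ^ n) (d ^ β) p (2 ^ j) ⟩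
    2 ^ suc j * d ^ β * (Q ^ n * p)
      ≤⟨ *-monoˡ-≤ (Q ^ n * p) growth ⟩
    suc d ^ β * (Q ^ n * p)
      ≤⟨ h ⟩
    2 * (Q ^ n * (d ^ β * B))
      ≡⟨ solve 3 (λ q a b → con 2 :* (q :* (a :* b)) := q :* (con 2 :* a :* b)) refl (Q ^ n) (d ^ β) B ⟩
    Q ^ n * (2 * d ^ β * B) ∎

+-split : ∀ a b c → a ≤ b + c → a ≤ 2 * b ⊎ a ≤ 2 * c
+-split a b c a≤ with ≤-total b c
... | inj₁ b≤c = inj₂ (≤-trans a≤ (≤-trans (+-monoˡ-≤ c b≤c) (≤-reflexive (cong (λ z → c + z) (sym (+-identityʳ c))))))
... | inj₂ c≤b = inj₁ (≤-trans a≤ (≤-trans (+-monoʳ-≤ b c≤b) (≤-reflexive (cong (λ z → b + z) (sym (+-identityʳ b))))))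

-- The upper bound along w, mw, m²w, …

∣E_∣ : ℕ → ℕ
∣E n ∣ = length (edges n)

m<n*[1+m/n] : ∀ m n .{{_ : NonZero n}} → m < n * suc (m ℕ./ n)
m<n*[1+m/n] m n = begin-strict
  m                      ≡⟨ m≡m%n+[m/n]*n m n ⟩
  m ℕ.% n + (m ℕ./ n) * n    <⟨ +-monoˡ-< _ (m%n<n m n) ⟩
  n + (m ℕ./ n) * n        ≡⟨ *-comm (suc (m ℕ./ n)) n ⟩
  n * suc (m ℕ./ n)        ∎
  where open ≤-Reasoning

*∣E∣≤∣E*∣ : ∀ m w → 1 ≤ w → w * ∣E m ∣ ≤ ∣E m * w ∣
*∣E∣≤∣E*∣ m w 1≤w = begin
  w * ∣E m ∣                      ≡⟨ cong (w *_) (length-edges m) ⟩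
  w * (m * 2 ^ (m ∸ 1))           ≡⟨ trans (sym (*-assoc w m _)) (cong (_* 2 ^ (m ∸ 1)) (*-comm w m)) ⟩
  m * w * 2 ^ (m ∸ 1)             ≤⟨ *-monoʳ-≤ (m * w) (^-monoʳ-≤ 2 (∸-monoˡ-≤ 1 (m≤m*n m w {{>-nonZero 1≤w}}))) ⟩
  m * w * 2 ^ (m * w ∸ 1)         ≡⟨ length-edges (m * w) ⟨
  ∣E m * w ∣                      ∎
  where open ≤-Reasoning

∣E∣>0 : ∀ {n} → 1 ≤ n → 1 ≤ ∣E n ∣
∣E∣>0 {suc n} _ = subst (1 ≤_) (sym (length-edges (suc n))) (>-nonZero⁻¹ _ {{e⟨Q⟩≢0 n}})

∣E-suc∣ : ∀ n → ∣E suc n ∣ ≡ 2 * ∣E n ∣ + 2 ^ n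
∣E-suc∣ n = trans (length-edges (suc n)) (trans (lemma n) (cong (λ e → 2 * e + 2 ^ n) (sym (length-edges n))))
  where
  lemma : ∀ n → suc n * 2 ^ n ≡ 2 * (n * 2 ^ (n ∸ 1)) + 2 ^ n
  lemma zero    = refl
  lemma (suc n) = solve 2 (λ n p → (con 2 :+ n) :* (con 2 :* p) := con 2 :* ((con 1 :+ n) :* p) :+ con 2 :* p) refl n (2 ^ n)
    where open ℕ.+-*-Solver

module Upper {k : ℕ} .{{k≥2 : NonTrivial k}} {P : Property k} {card : ℕ → ℕ}
             (cardinality : ∀ n → HasCardinality P n (card n)) (her : OrderHereditary P)
             (card>0 : ∀ n → 1 ≤ card n) where
  open Counting {P = P} cardinality using (module Step; module Cover)
  open Bounds {P = P} cardinality

  private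
    2≤k : 2 ≤ k
    2≤k = recompute (2 ≤? k) (nonTrivial⇒n>1 k)

    instance
      k≢0 : NonZero k
      k≢0 = >-nonZero (≤-trans (s≤s z≤n) 2≤k)

  module _ (U V : ℕ) where

    -- The rate log_k (card n) / e(Q_n) is at most U/V, with logarithm and denominators cleared.
    AtMost : ℕ → Set
    AtMost n = card n ^ V ≤ k ^ (U * ∣E n ∣)

    atMost-blocks : ∀ A w → AtMost w → AtMost (A * w)
    atMost-blocks A w h = begin
      card (A * w) ^ V           ≤⟨ ^-monoˡ-≤ V (Cover.card-cover (rows A w) her) ⟩
      (card w ^ g) ^ V           ≡⟨ ^-comm (card w) g V ⟩
      (card w ^ V) ^ g           ≤⟨ ^-monoˡ-≤ g h ⟩
      (k ^ (U * ∣E w ∣)) ^ g     ≡⟨ ^-*-assoc k (U * ∣E w ∣) g ⟩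
      k ^ (U * ∣E w ∣ * g)       ≡⟨ cong (k ^_) (trans (*-assoc U _ g) (cong (U *_) (trans (*-comm ∣E w ∣ g) #copies*e))) ⟩
      k ^ (U * ∣E A * w ∣)       ∎
      where
      open ≤-Reasoning
      open Decompose (rows A w) using (#copies; #copies*e)
      g = #copies

    -- The doubling in `card-suc` matches the one in `∣E-suc∣`, so only the edges between the faces
    -- cost extra. Each added direction contributes at most V 2^(r+n), the later doublings included.
    atMost-+ : ∀ {n} → AtMost n → ∀ r → card (r + n) ^ V ≤ k ^ (U * ∣E r + n ∣ + V * r * 2 ^ (r + n))
    atMost-+ {n} h zero    = ≤-trans h (^-monoʳ-≤ k (m≤m+n (U * ∣E n ∣) (V * 0 * 2 ^ n)))
    atMost-+ {n} h (suc r) = begin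
      card (suc i) ^ V
        ≤⟨ ^-monoˡ-≤ V (card-suc her i) ⟩
      (card i * card i * k ^ 2 ^ i) ^ V
        ≡⟨ trans ([m*n]^o (card i * card i) _ V) (cong₂ _*_ ([m*n]^o (card i) (card i) V) (^-*-assoc k (2 ^ i) V)) ⟩
      card i ^ V * card i ^ V * k ^ (2 ^ i * V)
        ≤⟨ *-monoˡ-≤ (k ^ (2 ^ i * V)) (*-mono-≤ (atMost-+ h r) (atMost-+ h r)) ⟩
      k ^ a * k ^ a * k ^ (2 ^ i * V)
        ≡⟨ trans (cong (_* k ^ (2 ^ i * V)) (sym (^-distribˡ-+-* k a a))) (sym (^-distribˡ-+-* k (a + a) _)) ⟩
      k ^ (a + a + 2 ^ i * V)
        ≤⟨ ^-monoʳ-≤ k (begin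
          U * ∣E i ∣ + V * r * 2 ^ i + (U * ∣E i ∣ + V * r * 2 ^ i) + 2 ^ i * V
            ≤⟨ m≤m+n _ (U * 2 ^ i + V * 2 ^ i) ⟩
          U * ∣E i ∣ + V * r * 2 ^ i + (U * ∣E i ∣ + V * r * 2 ^ i) + 2 ^ i * V + (U * 2 ^ i + V * 2 ^ i)
            ≡⟨ solve 5 (λ U e V r p → U :* e :+ V :* r :* p :+ (U :* e :+ V :* r :* p) :+ p :* V :+ (U :* p :+ V :* p)
                 := U :* (con 2 :* e :+ p) :+ V :* (con 1 :+ r) :* (con 2 :* p)) refl U ∣E i ∣ V r (2 ^ i) ⟩
          U * (2 * ∣E i ∣ + 2 ^ i) + V * suc r * (2 * 2 ^ i)
            ≡⟨ cong (λ e → U * e + V * suc r * (2 * 2 ^ i)) (∣E-suc∣ i) ⟨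
          U * ∣E suc i ∣ + V * suc r * (2 * 2 ^ i) ∎) ⟩
      k ^ (U * ∣E suc i ∣ + V * suc r * 2 ^ suc i) ∎
      where
      open ≤-Reasoning
      open ℕ.+-*-Solver
      i = r + n
      a = U * ∣E i ∣ + V * r * 2 ^ i

  -- Divide n by w: whole blocks keep the rate, and the remainder r < w raises it by at most 2r/n,
  -- which is at most 1/s once n ≥ 2sw. The step from U to U + v over sv is this 1/s.
  atMost-eventually : ∀ U v s {w} → 1 ≤ w → AtMost U (s * v) w →
                      ∃[ n₀ ] ∀ n → n₀ ≤ n → AtMost (U + v) (s * v) n
  atMost-eventually U v s {w} 1≤w h = 1 + 2 * s * w , bound
    where
    instance
      w≢0 : NonZero w
      w≢0 = >-nonZero 1≤w
    bound : ∀ n → 1 + 2 * s * w ≤ n → AtMost (U + v) (s * v) n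
    bound n@(suc n′) (s≤s n₀≤) = begin
      card n ^ (s * v)
        ≡⟨ cong (λ i → card i ^ (s * v)) n≡ ⟩
      card (r + A * w) ^ (s * v)
        ≤⟨ atMost-+ U (s * v) (atMost-blocks U (s * v) A w h) r ⟩
      k ^ (U * ∣E r + A * w ∣ + s * v * r * 2 ^ (r + A * w))
        ≡⟨ cong (λ i → k ^ (U * ∣E i ∣ + s * v * r * 2 ^ i)) n≡ ⟨
      k ^ (U * ∣E n ∣ + s * v * r * 2 ^ n)
        ≤⟨ ^-monoʳ-≤ k (+-monoʳ-≤ (U * ∣E n ∣) small) ⟩
      k ^ (U * ∣E n ∣ + v * ∣E n ∣)
        ≡⟨ cong (k ^_) (*-distribʳ-+ ∣E n ∣ U v) ⟨
      k ^ ((U + v) * ∣E n ∣) ∎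
      where
      open ≤-Reasoning
      open ℕ.+-*-Solver
      A = n ℕ./ w
      r = n ℕ.% w
      n≡ : n ≡ r + A * w
      n≡ = m≡m%n+[m/n]*n n w
      small : s * v * r * 2 ^ n ≤ v * ∣E n ∣
      small = begin
        s * v * r * (2 * 2 ^ n′)      ≡⟨ solve 4 (λ s v r p → s :* v :* r :* (con 2 :* p) := v :* (con 2 :* s :* r :* p)) refl s v r (2 ^ n′) ⟩
        v * (2 * s * r * 2 ^ n′)      ≤⟨ *-monoʳ-≤ v (*-monoˡ-≤ (2 ^ n′) (≤-trans (*-monoʳ-≤ (2 * s) (<⇒≤ (m%n<n n w))) (m≤n⇒m≤1+n n₀≤))) ⟩
        v * (n * 2 ^ n′)              ≡⟨ cong (v *_) (length-edges n) ⟨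
        v * ∣E n ∣                    ∎

  -- The fraction u/v bounds the normalised entropy of the templates for `Q_m`, and s is the
  -- precision: the rate is shown to be at most u/v + 6/s eventually.
  module Search (m u v s : ℕ) (1≤m : 1 ≤ m) .{{_ : NonZero v}} .{{_ : NonZero s}}
                (bound : ∀ (t : Template k m) → t ⊑ P → boxSize (templateBox t) ^ v ≤ k ^ (u * ∣E m ∣)) where

    private
      instance
        m≢0 : NonZero m
        m≢0 = >-nonZero 1≤m
      M : ℕ
      M = ∣E m ∣
      instance
        M≢0 : NonZero M
        M≢0 = >-nonZero (∣E∣>0 1≤m)
        Π≢0 : NonZero (k ^ M)
        Π≢0 = m^n≢0 k M
      rootK = root-floor v (k ^ (u * M)) (m^n>0 k (u * M)) (k ^ M)
      K = proj₁ rootK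
      instance
        K≢0 : NonZero K
        K≢0 = >-nonZero (proj₁ (proj₂ rootK))
      K^v≤ : K ^ v ≤ k ^ (u * M)
      K^v≤ = proj₁ (proj₂ (proj₂ rootK))
      bound′ : ∀ (t : Template k m) → t ⊑ P → boxSize (templateBox t) ≤ K
      bound′ t t⊑P = proj₂ (proj₂ (proj₂ rootK)) _ (boxSize≤ (templateBox t)) (bound t t⊑P)
      q₁ Q q D d w₀ X : ℕ
      -- `q₁` makes (1 + 1/`q₁`)^s ≤ 2. The rarity threshold is `D₀` = k^`q`, so about N/`q` rare
      -- colours can occur; with `q` = `Q` s, their total price `Q`^σ is at most k^(2N/s). `w₀`
      -- ensures n ≥ 2sd, N ≥ `q` and N ≥ s below.
      q₁ = 2 * s
      Q = k ^ M * q₁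
      q = Q * s
      D = (k ^ q) ^ M
      d = pred D
      w₀ = 2 * (s * d) + q + s
      X = 3 * (s * d) * M
      instance
        q₁≢0 : NonZero q₁
        q₁≢0 = m*n≢0 2 s
        Q≢0 : NonZero Q
        Q≢0 = m*n≢0 (k ^ M) q₁
        q≢0 : NonZero q
        q≢0 = m*n≢0 Q s
        D≢0 : NonZero D
        D≢0 = m^n≢0 (k ^ q) M {{m^n≢0 k q}}
      D≡ : suc d ≡ D
      D≡ = suc-pred D
      instance
        d≢0 : NonZero d
        d≢0 = >-nonZero (s≤s⁻¹ (begin
          2                ≤⟨ s≤s (>-nonZero⁻¹ (q * M) {{m*n≢0 q M}}) ⟩
          suc (q * M)      ≤⟨ n<k^n k (q * M) ⟩
          k ^ (q * M)      ≡⟨ ^-*-assoc k q M ⟨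
          D                ≡⟨ D≡ ⟨
          suc d            ∎))
          where open ≤-Reasoning
        sd≢0 : NonZero (s * d)
        sd≢0 = m*n≢0 s d
        X≢0 : NonZero X
        X≢0 = m*n≢0 (3 * (s * d)) M {{m*n≢0 3 (s * d)}}

    Bounded : ℕ → Set
    Bounded = AtMost (u * s + 5 * v) (s * v)

    module _ (w : ℕ) (w₀≤w : w₀ ≤ w) where
      private
        1≤w : 1 ≤ w
        1≤w = ≤-trans (>-nonZero⁻¹ s) (≤-trans (m≤n+m s (2 * (s * d) + q)) w₀≤w)
        module S = Step her m w
        n N g β σ J : ℕ
        n = Decompose.#copies (columns m w)
        N = n * M
        g = Decompose.#copies (rows m w)
        -- Up to n/s missing choices are affordable, because `Π`^β is then at most k^(N/s). `σ` is
        -- large enough for |Y| ≤ k^N ≤ `D₀`^σ, and `J` counts batches of `d` missing choices, each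
        -- of which halves the bound on |Y|.
        β = n ℕ./ s
        σ = suc (N ℕ./ q)
        J = β ℕ./ d
        w≤n : w ≤ n
        w≤n = *-cancelʳ-≤ w n M (≤-trans (*∣E∣≤∣E*∣ m w 1≤w) (≤-reflexive (sym (Decompose.#copies*e (columns m w)))))
        2sd≤n : 2 * (s * d) ≤ n
        2sd≤n = ≤-trans (≤-trans (m≤m+n _ q) (m≤m+n _ s)) (≤-trans w₀≤w w≤n)
        q≤N : q ≤ N
        q≤N = ≤-trans (≤-trans (m≤n+m q _) (m≤m+n _ s)) (≤-trans w₀≤w (≤-trans w≤n (m≤m*n n M)))
        s≤N : s ≤ N
        s≤N = ≤-trans (m≤n+m s _) (≤-trans w₀≤w (≤-trans w≤n (m≤m*n n M)))
        n<sd[1+J] : n < s * d * suc J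
        n<sd[1+J] = begin-strict
          n                     <⟨ m<n*[1+m/n] n s ⟩
          s * suc β             ≤⟨ *-monoʳ-≤ s (m<n*[1+m/n] β d) ⟩
          s * (d * suc J)       ≡⟨ *-assoc s d (suc J) ⟨
          s * d * suc J         ∎
          where open ≤-Reasoning
        2≤J : 2 ≤ J
        2≤J = s≤s⁻¹ (*-cancelˡ-< (s * d) 2 (suc J) (≤-<-trans (≤-trans (≤-reflexive (*-comm (s * d) 2)) 2sd≤n) n<sd[1+J]))
        j : ℕ
        j = pred J
        J≡ : suc j ≡ J
        J≡ = suc-pred J {{>-nonZero (≤-trans (s≤s z≤n) 2≤J)}}
        1≤j : 1 ≤ j
        1≤j = s≤s⁻¹ (≤-trans 2≤J (≤-reflexive (sym J≡)))
        -- The factor 3 in `X` serves the next inequality: n < sd (`J` + 1), and `J` + 1 = j + 2 ≤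
        -- 3j because j ≥ 1.
        dJ≤β : d * suc j ≤ β
        dJ≤β = ≤-trans (≤-reflexive (trans (cong (d *_) J≡) (*-comm d J))) (m/n*n≤m β d)
        N≤jX : N ≤ j * X
        N≤jX = begin
          n * M                            ≤⟨ *-monoˡ-≤ M (<⇒≤ n<sd[1+J]) ⟩
          s * d * suc J * M                ≡⟨ cong (λ J → s * d * suc J * M) J≡ ⟨
          s * d * (2 + j) * M              ≤⟨ *-monoˡ-≤ M (*-monoʳ-≤ (s * d) (+-monoˡ-≤ j (*-monoʳ-≤ 2 1≤j))) ⟩
          s * d * (2 * j + j) * M          ≡⟨ solve 3 (λ a j M → a :* (con 2 :* j :+ j) :* M := j :* (con 3 :* a :* M)) refl (s * d) j M ⟩
          j * X                            ∎
          where
          open ≤-Reasoning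
          open ℕ.+-*-Solver
        N≤qσ : M * n ≤ q * σ
        N≤qσ = ≤-trans (≤-reflexive (*-comm M n)) (<⇒≤ (m<n*[1+m/n] N q))
        qσ≤2N : Q * (σ * s) ≤ 2 * N
        qσ≤2N = begin
          Q * (σ * s)            ≡⟨ solve 3 (λ Q σ s → Q :* (σ :* s) := σ :* (Q :* s)) refl Q σ s ⟩
          q + N ℕ./ q * q          ≤⟨ +-mono-≤ q≤N (m/n*n≤m N q) ⟩
          N + N                  ≡⟨ cong (λ z → N + z) (+-identityʳ N) ⟨
          2 * N                  ∎
          where
          open ≤-Reasoning
          open ℕ.+-*-Solver
        N≡ : N ≡ ∣E m * w ∣
        N≡ = Decompose.#copies*e (columns m w)

      template : suc d ^ β * (Q ^ n * card (m * w)) ≤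
                   2 * (suc d ^ β * (Q ^ σ * ((Q * K + k ^ M) ^ n * (k ^ M) ^ β))) →
                 Bounded (m * w)
      template h = subst (λ e → card (m * w) ^ (s * v) ≤ k ^ ((u * s + 5 * v) * e)) N≡
        (templateCase {k} {M} {K} {q₁} {u} {v} {s} {n} {σ} {β} {Q} {card (m * w)}
          2≤k (suc^≤2* q₁ s (n≤1+n q₁)) K^v≤ (<⇒≤ (n<k^n k Q)) qσ≤2N (m/n*n≤m n s) s≤N
          (cancel (suc d ^ β) {{m^n≢0 (suc d) β}} h))
        where
        cancel : ∀ {y z} x .{{_ : NonZero x}} → x * y ≤ 2 * (x * z) → y ≤ 2 * z
        cancel {y} {z} x h = *-cancelˡ-≤ x (subst (x * y ≤_) (solve 2 (λ x z → con 2 :* (x :* z) := x :* (con 2 :* z)) refl x z) h)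
          where open ℕ.+-*-Solver

      loss : suc d ^ β * (Q ^ n * card (m * w)) ≤ 2 * (Q ^ n * (d ^ β * card w ^ g)) →
             card (m * w) ^ X * 2 ^ ∣E m * w ∣ ≤ (card w ^ g) ^ X
      loss h = subst (λ e → card (m * w) ^ X * 2 ^ e ≤ (card w ^ g) ^ X) N≡
        (lossCase {d} {β} {Q} {card (m * w)} {card w ^ g} {j} {N} {X} dJ≤β N≤jX n h)

      dichotomy : Bounded (m * w) ⊎ card (m * w) ^ X * 2 ^ ∣E m * w ∣ ≤ (card w ^ g) ^ X
      dichotomy = [ (λ h → inj₂ (loss h)) , (λ h → inj₁ (template h)) ]′
        (+-split (suc d ^ β * (Q ^ n * card (m * w))) (Q ^ n * (d ^ β * card w ^ g)) _
          (S.stepBound K Q q d D≡ bound′ β σ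
            (subst₂ _≤_ (sym (^-*-assoc k M n)) (sym (^-*-assoc k q σ)) (^-monoʳ-≤ k N≤qσ))))

    -- The rate at w is at most 1 - j (log_k 2)/`X`. As `X` is fixed before w, each loss raises j by
    -- one.
    Deficient : ℕ → ℕ → Set
    Deficient j w = card w ^ X * 2 ^ (j * ∣E w ∣) ≤ k ^ (X * ∣E w ∣)

    deficient-step : ∀ j w → let g = Decompose.#copies (rows m w) in
      card (m * w) ^ X * 2 ^ ∣E m * w ∣ ≤ (card w ^ g) ^ X → Deficient j w → Deficient (suc j) (m * w)
    deficient-step j w h def = begin
      card (m * w) ^ X * 2 ^ (suc j * N)              ≡⟨ cong (card (m * w) ^ X *_) (^-distribˡ-+-* 2 N (j * N)) ⟩
      card (m * w) ^ X * (2 ^ N * 2 ^ (j * N))        ≡⟨ *-assoc (card (m * w) ^ X) (2 ^ N) (2 ^ (j * N)) ⟨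
      card (m * w) ^ X * 2 ^ N * 2 ^ (j * N)          ≤⟨ *-monoˡ-≤ (2 ^ (j * N)) h ⟩
      (card w ^ g) ^ X * 2 ^ (j * N)                  ≡⟨ cong₂ _*_ (^-comm (card w) g X)
                                                           (trans (cong (λ N → 2 ^ (j * N)) N≡) (trans (cong (2 ^_) (sym (*-assoc j ∣E w ∣ g))) (sym (^-*-assoc 2 (j * ∣E w ∣) g)))) ⟩
      (card w ^ X) ^ g * (2 ^ (j * ∣E w ∣)) ^ g       ≡⟨ [m*n]^o (card w ^ X) (2 ^ (j * ∣E w ∣)) g ⟨
      (card w ^ X * 2 ^ (j * ∣E w ∣)) ^ g             ≤⟨ ^-monoˡ-≤ g def ⟩
      (k ^ (X * ∣E w ∣)) ^ g                          ≡⟨ trans (^-*-assoc k (X * ∣E w ∣) g) (cong (k ^_) (trans (*-assoc X ∣E w ∣ g) (cong (X *_) (sym N≡)))) ⟩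
      k ^ (X * N)                                     ∎
      where
      open ≤-Reasoning
      g N : ℕ
      g = Decompose.#copies (rows m w)
      N = ∣E m * w ∣
      N≡ : N ≡ ∣E w ∣ * g
      N≡ = trans (sym (Decompose.#copies*e (rows m w))) (*-comm g ∣E w ∣)

    -- Since k < 2^k, such a deficiency would make the rate negative, against `card w` ≥ 1. The
    -- contradiction is stated with the conclusion that `search` returns.
    not-too-deficient : ∀ w → 1 ≤ w → Deficient (k * X) w → ∃[ w ] 1 ≤ w × Bounded w
    not-too-deficient w 1≤w def = ⊥-elim (<⇒≱ (begin-strict
      k ^ (X * ∣E w ∣)                          <⟨ ^-monoˡ-< (X * ∣E w ∣) {{XE≢0}} (n<k^n 2 k) ⟩
      (2 ^ k) ^ (X * ∣E w ∣)                    ≡⟨ trans (^-*-assoc 2 k (X * ∣E w ∣)) (cong (2 ^_) (sym (*-assoc k X ∣E w ∣))) ⟩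
      2 ^ (k * X * ∣E w ∣)                      ≤⟨ m≤n*m (2 ^ (k * X * ∣E w ∣)) (card w ^ X) {{m^n≢0 (card w) X {{>-nonZero (card>0 w)}}}} ⟩
      card w ^ X * 2 ^ (k * X * ∣E w ∣)         ∎) def)
      where
      open ≤-Reasoning
      XE≢0 : NonZero (X * ∣E w ∣)
      XE≢0 = m*n≢0 X ∣E w ∣ {{X≢0}} {{>-nonZero (∣E∣>0 1≤w)}}

    w₀>0 : ∀ {w} → w₀ ≤ w → 1 ≤ w
    w₀>0 w₀≤w = ≤-trans (>-nonZero⁻¹ s) (≤-trans (m≤n+m s (2 * (s * d) + q)) w₀≤w)

    -- The fuel is the number of losses still possible; each step either reaches the bound at
    -- `m * w` or consumes one.
    search : ∀ fuel j w → w₀ ≤ w → fuel + j ≡ k * X → Deficient j w → ∃[ w ] 1 ≤ w × Bounded w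
    search zero j w w₀≤w eq def = not-too-deficient w (w₀>0 w₀≤w) (subst (λ j → Deficient j w) eq def)
    search (suc fuel) j w w₀≤w eq def = [ found , continue ]′ (dichotomy w w₀≤w)
      where
      w₀≤mw : w₀ ≤ m * w
      w₀≤mw = ≤-trans w₀≤w (m≤n*m w m)
      found : Bounded (m * w) → ∃[ w ] 1 ≤ w × Bounded w
      found bounded = m * w , w₀>0 w₀≤mw , bounded
      continue : card (m * w) ^ X * 2 ^ ∣E m * w ∣ ≤ (card w ^ Decompose.#copies (rows m w)) ^ X →
                 ∃[ w ] 1 ≤ w × Bounded w
      continue loss = search fuel (suc j) (m * w) w₀≤mw (trans (+-suc fuel j) eq) (deficient-step j w loss def)

    eventually : ∃[ n₀ ] ∀ n → n₀ ≤ n → AtMost (u * s + 5 * v + v) (s * v) n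
    eventually = let (w , 1≤w , bounded) = search (k * X) 0 w₀ ≤-refl (+-identityʳ (k * X)) initial in
      atMost-eventually (u * s + 5 * v) v s 1≤w bounded
      where
      open ≤-Reasoning
      initial : Deficient 0 w₀
      initial = begin
        card w₀ ^ X * 1          ≡⟨ *-identityʳ _ ⟩
        card w₀ ^ X              ≤⟨ ^-monoˡ-≤ X {card w₀} {k ^ ∣E w₀ ∣} (card≤k^e w₀) ⟩
        (k ^ ∣E w₀ ∣) ^ X        ≡⟨ trans (^-*-assoc k ∣E w₀ ∣ X) (cong (k ^_) (*-comm ∣E w₀ ∣ X)) ⟩
        k ^ (X * ∣E w₀ ∣)        ∎

-- Rational approximations of logarithms

≤ℚ⁺ : ∀ {a b c d} → a ℕ.* suc d ℕ.≤ c ℕ.* suc b → mkℚᵘ (+ a) b ℚ.≤ mkℚᵘ (+ c) d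
≤ℚ⁺ {a} {b} {c} {d} h = *≤* (subst₂ ℤ._≤_ (ℤ.pos-* a (suc d)) (ℤ.pos-* c (suc b)) (ℤ.+≤+ h))

≤ℚ⁻ : ∀ {a b c d} → mkℚᵘ (+ a) b ℚ.≤ mkℚᵘ (+ c) d → a ℕ.* suc d ℕ.≤ c ℕ.* suc b
≤ℚ⁻ {a} {b} {c} {d} h = ℤ.drop‿+≤+ (subst₂ ℤ._≤_ (sym (ℤ.pos-* a (suc d))) (sym (ℤ.pos-* c (suc b))) (ℚ.drop-*≤* h))

≃ℚ⁺ : ∀ {a b c d} → a ℕ.* suc d ≡ c ℕ.* suc b → mkℚᵘ (+ a) b ℚ.≃ mkℚᵘ (+ c) d
≃ℚ⁺ {a} {b} {c} {d} h = *≡* (trans (sym (ℤ.pos-* a (suc d))) (trans (cong +_ h) (ℤ.pos-* c (suc b))))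

integer : ℕ → ℚᵘ
integer e = mkℚᵘ (+ e) 0

mk-+ : ∀ a c b → mkℚᵘ (+ a) b ℚ.+ mkℚᵘ (+ c) b ℚ.≃ mkℚᵘ (+ (a ℕ.+ c)) b
mk-+ a c b = *≡* (trans (cong (ℤ._* + suc b) (sym (ℤ.*-distribʳ-+ (+ suc b) (+ a) (+ c))))
                    (ℤ.*-assoc (+ (a ℕ.+ c)) (+ suc b) (+ suc b)))

integer-* : ∀ e a b → integer e ℚ.* mkℚᵘ (+ a) b ℚ.≃ mkℚᵘ (+ (a ℕ.* e)) b
integer-* e a b = *≡* (begin
  + e ℤ.* + a ℤ.* + suc b          ≡⟨ cong (ℤ._* + suc b) (sym (ℤ.pos-* e a)) ⟩
  + (e ℕ.* a) ℤ.* + suc b          ≡⟨ cong₂ (λ x y → + x ℤ.* + y) (ℕ.*-comm e a) (sym (ℕ.*-identityˡ (suc b))) ⟩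
  + (a ℕ.* e) ℤ.* + (1 ℕ.* suc b)  ∎)
  where open ≡-Reasoning

mk-+-mk : ∀ a b c d → mkℚᵘ (+ a) b ℚ.+ mkℚᵘ (+ c) d ℚ.≃ mkℚᵘ (+ (a ℕ.* suc d ℕ.+ c ℕ.* suc b)) (d ℕ.+ b ℕ.* suc d)
mk-+-mk a b c d = *≡* (cong (ℤ._* + (suc b ℕ.* suc d))
  (trans (cong₂ ℤ._+_ (sym (ℤ.pos-* a (suc d))) (sym (ℤ.pos-* c (suc b)))) (sym (ℤ.pos-+ (a ℕ.* suc d) (c ℕ.* suc b)))))

archimedean* : ∀ c ε → 0ℚᵘ ℚ.< ε → ∃[ N ] ∀ n → N ℕ.≤ n → mkℚᵘ (+ c) n ℚ.≤ ε
archimedean* c (mkℚᵘ (+ zero)  d) (*<* (ℤ.+<+ ()))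
archimedean* c (mkℚᵘ -[1+ p ]  d) (*<* ())
archimedean* c (mkℚᵘ (+ suc p) d) _ = c ℕ.* suc d , λ n N≤n → ≤ℚ⁺
  (ℕ.≤-trans N≤n (ℕ.≤-trans (ℕ.n≤1+n n) (ℕ.m≤m+n (suc n) (p ℕ.* suc n))))

record Naturals (q : ℚᵘ) : Set where
  constructor mkNaturals
  field
    num  : ℕ
    den  : ℕ
    is   : q ≡ mkℚᵘ (+ num) den

nonNegative : ∀ q → 0ℚᵘ ℚ.≤ q → Naturals q
nonNegative (mkℚᵘ (+ n) d) _ = mkNaturals n d refl
nonNegative (mkℚᵘ -[1+ n ] d) (*≤* ())

module _ (e : ℕ) .{{e≢0 : NonZero e}} where

  private
    lemma : ∀ e .{{_ : NonZero e}} → ((+ 1 ℚ./ e) ℚ.* integer e ℚ.≃ 1ℚᵘ) × (0ℚᵘ ℚ.≤ + 1 ℚ./ e)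
    lemma (suc e) = *≡* (begin
      + 1 ℤ.* + suc e ℤ.* + 1      ≡⟨ ℤ.*-identityʳ (+ 1 ℤ.* + suc e) ⟩
      + 1 ℤ.* + suc e              ≡⟨ cong (λ x → + 1 ℤ.* + x) (sym (ℕ.*-identityʳ (suc e))) ⟩
      + 1 ℤ.* + (suc e ℕ.* 1)      ∎) , *≤* (ℤ.+≤+ z≤n)
      where open ≡-Reasoning

  1/e*e : (+ 1 ℚ./ e) ℚ.* integer e ℚ.≃ 1ℚᵘ
  1/e*e = proj₁ (lemma e)

  instance
    1/e≥0 : ℚ.NonNegative (+ 1 ℚ./ e)
    1/e≥0 = ℚ.nonNegative (proj₂ (lemma e))

  divide-≤ : ∀ {p q} → p ℚ.≤ integer e ℚ.* q → (+ 1 ℚ./ e) ℚ.* p ℚ.≤ q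
  divide-≤ {p} {q} h = begin
    (+ 1 ℚ./ e) ℚ.* p                      ≤⟨ ℚ.*-monoʳ-≤-nonNeg (+ 1 ℚ./ e) h ⟩
    (+ 1 ℚ./ e) ℚ.* (integer e ℚ.* q)      ≃⟨ ℚ.*-assoc (+ 1 ℚ./ e) (integer e) q ⟨
    (+ 1 ℚ./ e) ℚ.* integer e ℚ.* q        ≃⟨ ℚ.*-congʳ 1/e*e ⟩
    1ℚᵘ ℚ.* q                              ≃⟨ ℚ.*-identityˡ q ⟩
    q                                      ∎
    where open ℚ.≤-Reasoning

  multiply-≤ : ∀ {p q} → (+ 1 ℚ./ e) ℚ.* p ℚ.≤ q → p ℚ.≤ integer e ℚ.* q
  multiply-≤ {p} {q} h = begin
    p                                      ≃⟨ ℚ.*-identityˡ p ⟨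
    1ℚᵘ ℚ.* p                              ≃⟨ ℚ.*-congʳ 1/e*e ⟨
    (+ 1 ℚ./ e) ℚ.* integer e ℚ.* p        ≃⟨ solve 3 (λ r e p → r :* e :* p := e :* (r :* p)) ℚ.≃-refl (+ 1 ℚ./ e) (integer e) p ⟩
    integer e ℚ.* ((+ 1 ℚ./ e) ℚ.* p)      ≤⟨ ℚ.*-monoʳ-≤-nonNeg (integer e) h ⟩
    integer e ℚ.* q                        ∎
    where
    open ℚ.≤-Reasoning
    open ℚ.+-*-Solver

module Logs (k : ℕ) .{{k≥2 : NonTrivial k}} where

  private
    1<k : 1 ℕ.< k
    1<k = recompute (1 ℕ.<? k) (ℕ.nonTrivial⇒n>1 k)

    instance
      k≢0 : NonZero k
      k≢0 = ℕ.>-nonZero (ℕ.<-trans (s≤s z≤n) 1<k)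

  ^-cancelʳ-≤ : ∀ {i j} → k ℕ.^ i ℕ.≤ k ℕ.^ j → i ℕ.≤ j
  ^-cancelʳ-≤ {i} {j} h = ℕ.s≤s⁻¹ (^-cancelʳ-< k (ℕ.≤-<-trans h (ℕ.^-monoʳ-< k 1<k (ℕ.n<1+n j))))

  -- The approximations of the logarithm are rounded down, so a rational upper bound holds for every
  -- one of them without an error term.
  logSeq-≤-rational : ∀ x .{{_ : NonZero x}} {a b} → x ℕ.^ suc b ℕ.≤ k ℕ.^ a → ∀ j → logSeq k x j ℚ.≤ mkℚᵘ (+ a) b
  logSeq-≤-rational x {a} {b} h j = ≤ℚ⁺ (^-cancelʳ-≤ (begin
    k ℕ.^ (l ℕ.* suc b)              ≡⟨ ℕ.^-*-assoc k l (suc b) ⟨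
    (k ℕ.^ l) ℕ.^ suc b              ≤⟨ ℕ.^-monoˡ-≤ (suc b) (k^⌊log⌋≤ k (x ℕ.^ suc j) {{ℕ.m^n≢0 x (suc j)}}) ⟩
    (x ℕ.^ suc j) ℕ.^ suc b          ≡⟨ ^-comm x (suc j) (suc b) ⟩
    (x ℕ.^ suc b) ℕ.^ suc j          ≤⟨ ℕ.^-monoˡ-≤ (suc j) h ⟩
    (k ℕ.^ a) ℕ.^ suc j              ≡⟨ ℕ.^-*-assoc k a (suc j) ⟩
    k ℕ.^ (a ℕ.* suc j)              ∎))
    where
    open ℕ.≤-Reasoning
    l = ⌊log⌋ k (x ℕ.^ suc j)

  ≤-logSeq : ∀ x {l j} → k ℕ.^ l ℕ.≤ x ℕ.^ suc j → mkℚᵘ (+ l) j ℚ.≤ logSeq k x j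
  ≤-logSeq x {l} {j} h = ≤ℚ⁺ (ℕ.*-monoˡ-≤ (suc j)
    (ℕ.s≤s⁻¹ (^-cancelʳ-< k {l} {suc (⌊log⌋ k (x ℕ.^ suc j))} (ℕ.≤-<-trans h (<k^1+⌊log⌋ k (x ℕ.^ suc j))))))

  module _ {n} (t : Template k n) (j : ℕ) where

    private
      ℓ : Edge n → ℕ
      ℓ e = ⌊log⌋ k (∣ palette t e ∣ ℕ.^ suc j)
      size : List (Edge n) → ℕ
      size xs = product (map (λ e → ∣ palette t e ∣) xs)

      boxSize-product : ∀ xs → boxSize (tabulate (palette t ∘ List.lookup xs)) ≡ size xs
      boxSize-product []       = refl
      boxSize-product (e ∷ xs) = cong (∣ palette t e ∣ ℕ.*_) (boxSize-product xs)

      lower-bound : ∀ xs → k ℕ.^ ∑ xs ℓ ℕ.≤ size xs ℕ.^ suc j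
      lower-bound []       = ℕ.≤-reflexive (sym (ℕ.^-zeroˡ (suc j)))
      lower-bound (e ∷ xs) = begin
        k ℕ.^ (ℓ e ℕ.+ ∑ xs ℓ)                                   ≡⟨ ℕ.^-distribˡ-+-* k (ℓ e) (∑ xs ℓ) ⟩
        k ℕ.^ ℓ e ℕ.* k ℕ.^ ∑ xs ℓ                               ≤⟨ ℕ.*-mono-≤ (k^⌊log⌋≤ k _ {{ℕ.m^n≢0 ∣ palette t e ∣ (suc j) {{∣palette∣≢0 t e}}}}) (lower-bound xs) ⟩
        ∣ palette t e ∣ ℕ.^ suc j ℕ.* size xs ℕ.^ suc j          ≡⟨ [m*n]^o ∣ palette t e ∣ (size xs) (suc j) ⟨
        size (e ∷ xs) ℕ.^ suc j                                  ∎
        where open ℕ.≤-Reasoning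

      -- Each rounding down loses less than 1 in the exponent, hence the extra `length xs`. Divided
      -- by j + 1 and by the number of edges, this loss is 1/(j+1).
      upper-bound : ∀ xs → size xs ℕ.^ suc j ℕ.≤ k ℕ.^ (∑ xs ℓ ℕ.+ length xs)
      upper-bound []       = ℕ.≤-reflexive (ℕ.^-zeroˡ (suc j))
      upper-bound (e ∷ xs) = begin
        size (e ∷ xs) ℕ.^ suc j                                  ≡⟨ [m*n]^o ∣ palette t e ∣ (size xs) (suc j) ⟩
        ∣ palette t e ∣ ℕ.^ suc j ℕ.* size xs ℕ.^ suc j          ≤⟨ ℕ.*-mono-≤ (ℕ.<⇒≤ (<k^1+⌊log⌋ k (∣ palette t e ∣ ℕ.^ suc j))) (upper-bound xs) ⟩
        k ℕ.^ suc (ℓ e) ℕ.* k ℕ.^ (∑ xs ℓ ℕ.+ length xs)         ≡⟨ ℕ.^-distribˡ-+-* k (suc (ℓ e)) (∑ xs ℓ ℕ.+ length xs) ⟨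
        k ℕ.^ (suc (ℓ e) ℕ.+ (∑ xs ℓ ℕ.+ length xs))             ≡⟨ cong (k ℕ.^_) (trans (cong suc (sym (ℕ.+-assoc (ℓ e) (∑ xs ℓ) (length xs)))) (sym (ℕ.+-suc _ (length xs)))) ⟩
        k ℕ.^ (ℓ e ℕ.+ ∑ xs ℓ ℕ.+ suc (length xs))               ∎
        where open ℕ.≤-Reasoning

      seq-sum : ∀ xs → seq (foldr _+ᵣ_ 0ᵣ (map (λ e → log k ∣ palette t e ∣ {{∣palette∣≢0 t e}}) xs)) j ℚ.≃ mkℚᵘ (+ ∑ xs ℓ) j
      seq-sum []       = ≃ℚ⁺ {0} {0} {0} refl
      seq-sum (e ∷ xs) = ℚ.≃-trans (ℚ.+-congʳ (mkℚᵘ (+ ℓ e) j) (seq-sum xs)) (mk-+ (ℓ e) (∑ xs ℓ) j)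

    -- The numerator of the j-th rational approximation of Ent t, whose denominator is j + 1.
    entropy : ℕ
    entropy = ∑ (edges n) ℓ

    seq-Ent : seq (Ent t) j ℚ.≃ mkℚᵘ (+ entropy) j
    seq-Ent = seq-sum (edges n)

    k^entropy≤ : k ℕ.^ entropy ℕ.≤ boxSize (templateBox t) ℕ.^ suc j
    k^entropy≤ = subst (λ x → k ℕ.^ entropy ℕ.≤ x ℕ.^ suc j) (sym (boxSize-product (edges n))) (lower-bound (edges n))

    ≤k^entropy : boxSize (templateBox t) ℕ.^ suc j ℕ.≤ k ℕ.^ (entropy ℕ.+ length (edges n))
    ≤k^entropy = subst (λ x → x ℕ.^ suc j ℕ.≤ k ℕ.^ (entropy ℕ.+ length (edges n))) (sym (boxSize-product (edges n))) (upper-bound (edges n))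

-- The limit

≤-drop-minus : ∀ p q ε → p ℚ.- q ℚ.≤ ε → p ℚ.≤ q ℚ.+ ε
≤-drop-minus p q ε h = begin
  p                  ≃⟨ solve 2 (λ p q → p := q :+ (p :- q)) ℚ.≃-refl p q ⟩
  q ℚ.+ (p ℚ.- q)    ≤⟨ ℚ.+-monoʳ-≤ q h ⟩
  q ℚ.+ ε            ∎
  where
  open ℚ.≤-Reasoning
  open ℚ.+-*-Solver

≤-minus : ∀ p q ε → p ℚ.≤ q ℚ.+ ε → p ℚ.- q ℚ.≤ ε
≤-minus p q ε h = begin
  p ℚ.- q            ≤⟨ ℚ.+-monoˡ-≤ (ℚ.- q) h ⟩
  q ℚ.+ ε ℚ.- q      ≃⟨ solve 2 (λ q e → q :+ e :- q := e) ℚ.≃-refl q ε ⟩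
  ε                  ∎
  where
  open ℚ.≤-Reasoning
  open ℚ.+-*-Solver

≤-+0 : ∀ p {δ} → 0ℚᵘ ℚ.< δ → p ℚ.≤ p ℚ.+ δ
≤-+0 p {δ} 0<δ = ℚ.p≤p+q p δ {{ℚ.nonNegative (ℚ.<⇒≤ 0<δ)}}

approximates : ∀ x ε → 0ℚᵘ ℚ.< ε → ∃[ p ] ∃[ J ] ∀ j → J ℕ.≤ j → seq x j ℚ.≤ p ℚ.+ ε × p ℚ.≤ seq x j ℚ.+ ε
approximates x ε 0<ε with cauchy x ε 0<ε
... | J , close = seq x J , J , λ j J≤j →
  ≤-drop-minus (seq x j) (seq x J) ε (ℚ.≤-trans (p≤∣p∣ _) (close j J J≤j ℕ.≤-refl)) ,
  ≤-drop-minus (seq x J) (seq x j) ε (ℚ.≤-trans (p≤∣p∣ _) (close J j ℕ.≤-refl J≤j))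
  where
  p≤∣p∣ : ∀ p → p ℚ.≤ ℚ.∣ p ∣
  p≤∣p∣ p@(mkℚᵘ (+ _) _) = ℚ.≤-refl
  p≤∣p∣ (mkℚᵘ -[1+ n ] d) = *≤* ℤ.-≤+

≡^ᵣ-cong : ∀ {m k} x y → (∀ j → seq x j ℚ.≃ seq y j) → m ≡ k ^ᵣ x → m ≡ k ^ᵣ y
≡^ᵣ-cong x y eq pow = record
  { below = λ r (ε , 0<ε , J , h) → _≡_^ᵣ_.below pow r
      (ε , 0<ε , J , λ j J≤j → ℚ.≤-respʳ-≃ (ℚ.≃-sym (eq j)) (h j J≤j))
  ; above = λ r (ε , 0<ε , J , h) → _≡_^ᵣ_.above pow r
      (ε , 0<ε , J , λ j J≤j → ℚ.≤-respˡ-≃ (ℚ.+-congˡ ε (ℚ.≃-sym (eq j))) (h j J≤j)) }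

ℕ-cases : (Q : ℕ → Set) → Q 0 → (∀ n → Q (suc n)) → ∀ n → Q n
ℕ-cases Q z s zero    = z
ℕ-cases Q z s (suc n) = s n

rescale : ∀ r e l p → r ℚ.* e ℚ.≃ 1ℚᵘ → l ℚ.≃ e ℚ.* (p ℚ.+ (r ℚ.* l ℚ.- p))
rescale r e l p re≃1 = begin
  l                                ≈⟨ ℚ.*-identityˡ l ⟨
  1ℚᵘ ℚ.* l                        ≈⟨ ℚ.*-congʳ {l} re≃1 ⟨
  (r ℚ.* e) ℚ.* l                  ≈⟨ solve 4 (λ r e l p → (r :* e) :* l := e :* (p :+ (r :* l :- p))) ℚ.≃-refl r e l p ⟩
  e ℚ.* (p ℚ.+ (r ℚ.* l ℚ.- p))    ∎
  where
  open import Relation.Binary.Reasoning.Setoid ℚ.≃-setoid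
  open ℚ.+-*-Solver

module Density (k : ℕ) .{{k≥2 : NonTrivial k}} (P : Property k) (her : OrderHereditary P)
               (inhabited : ∀ n → ∃ (mem P n)) (π : ℝ) (density : IsDensity P π)
               (card : ℕ → ℕ) (cardinality : ∀ n → HasCardinality P n (card n)) where
  open Counting {P = P} cardinality using (index)
  open Bounds {P = P} cardinality using (boxSize≤card)
  open Logs k

  ex : ℕ → ℝ
  ex = proj₁ density

  card>0 : ∀ n → 1 ℕ.≤ card n
  card>0 n with card n | index {n} (proj₂ (inhabited n))
  ... | suc _ | _ = s≤s z≤n

  instance
    card≢0 : ∀ {n} → NonZero (card n)
    card≢0 {n} = ℕ.>-nonZero (card>0 n)

  1/e : ℕ → ℚᵘ
  1/e n = (+ 1 / e⟨Q suc n ⟩) {{e⟨Q⟩≢0 n}}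

  rate : ℕ → ℕ → ℚᵘ
  rate n j = 1/e n ℚ.* logSeq k (card (suc n)) j

  exRate : ℕ → ℕ → ℚᵘ
  exRate n j = 1/e n ℚ.* seq (ex (suc n)) j

  1/e-mono : ∀ n {p q} → p ℚ.≤ q → 1/e n ℚ.* p ℚ.≤ 1/e n ℚ.* q
  1/e-mono n h = ℚ.*-monoʳ-≤-nonNeg (1/e n) {{1/e≥0 e⟨Q suc n ⟩ {{e⟨Q⟩≢0 n}}}} h

  1/e-error : ∀ n {p q ε} → p ℚ.≤ q ℚ.+ integer e⟨Q suc n ⟩ ℚ.* ε → 1/e n ℚ.* p ℚ.≤ 1/e n ℚ.* q ℚ.+ ε
  1/e-error n {p} {q} {ε} h = begin
    1/e n ℚ.* p                                                ≤⟨ 1/e-mono n h ⟩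
    1/e n ℚ.* (q ℚ.+ integer e⟨Q suc n ⟩ ℚ.* ε)                ≃⟨ ℚ.*-distribˡ-+ (1/e n) q _ ⟩
    1/e n ℚ.* q ℚ.+ 1/e n ℚ.* (integer e⟨Q suc n ⟩ ℚ.* ε)      ≤⟨ ℚ.+-monoʳ-≤ (1/e n ℚ.* q) (divide-≤ e⟨Q suc n ⟩ {{e⟨Q⟩≢0 n}} ℚ.≤-refl) ⟩
    1/e n ℚ.* q ℚ.+ ε                                          ∎
    where open ℚ.≤-Reasoning

  e*>0 : ∀ n {ε} → 0ℚᵘ ℚ.< ε → 0ℚᵘ ℚ.< integer e⟨Q suc n ⟩ ℚ.* ε
  e*>0 n {ε} 0<ε = ℚ.positive⁻¹ _ {{ℚ.pos*pos⇒pos (integer e⟨Q suc n ⟩) {{positive e⟨Q suc n ⟩ {{e⟨Q⟩≢0 n}}}} ε {{ℚ.positive 0<ε}}}}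
    where
    positive : ∀ e .{{_ : NonZero e}} → ℚ.Positive (integer e)
    positive (suc e) = _

  -- An extremal template has k^Ent colourings, all of them members of `P`. One ε is the distance to
  -- the limit; the other two are the slack in the two uses of `≤ᵣ`.
  density≤rate : ∀ ε → 0ℚᵘ ℚ.< ε → ∃[ n₀ ] ∀ n → n₀ ℕ.≤ n → ∃[ J ] ∀ j → J ℕ.≤ j → seq π j ℚ.≤ rate n j ℚ.+ (ε ℚ.+ ε ℚ.+ ε)
  density≤rate ε 0<ε = let (n₀ , conv) = proj₂ (proj₂ density) ε 0<ε in n₀ , λ n n₀≤n → at n (proj₂ (conv n n₀≤n))
    where
    at : ∀ n → π -ᵣ (1/e n • ex (suc n)) ≤ᵣ fromℚ ε → ∃[ J ] ∀ j → J ℕ.≤ j → seq π j ℚ.≤ rate n j ℚ.+ (ε ℚ.+ ε ℚ.+ ε)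
    at n close with IsMaximum.attained (proj₁ (proj₂ density) (suc n)) | close ε 0<ε
    ... | t , t⊑P , ex≤Ent , _ | J₁ , h₁ with ex≤Ent _ (e*>0 n 0<ε)
    ...   | J₂ , h₂ = J₁ ℕ.⊔ J₂ , λ j J≤j → begin
      seq π j
        ≤⟨ ≤-drop-minus (seq π j) (exRate n j) (ε ℚ.+ ε) (h₁ j (ℕ.m⊔n≤o⇒m≤o J₁ J₂ J≤j)) ⟩
      exRate n j ℚ.+ (ε ℚ.+ ε)
        ≤⟨ ℚ.+-monoˡ-≤ (ε ℚ.+ ε) (1/e-error n (ℚ.≤-trans (h₂ j (ℕ.m⊔n≤o⇒n≤o J₁ J₂ J≤j))
             (ℚ.+-monoˡ-≤ _ (ℚ.≤-trans (ℚ.≤-reflexive (seq-Ent t j))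
               (≤-logSeq (card (suc n)) (ℕ.≤-trans (k^entropy≤ t j) (ℕ.^-monoˡ-≤ (suc j) (boxSize≤card t t⊑P)))))))) ⟩
      rate n j ℚ.+ ε ℚ.+ (ε ℚ.+ ε)
        ≃⟨ solve 2 (λ r e → r :+ e :+ (e :+ e) := r :+ (e :+ e :+ e)) ℚ.≃-refl (rate n j) ε ⟩
      rate n j ℚ.+ (ε ℚ.+ ε ℚ.+ ε) ∎
      where
      open ℚ.≤-Reasoning
      open ℚ.+-*-Solver

  -- An index j is taken late enough for all approximations. Of the two ε, one is the slack in Ent ≤
  -- ex and the other covers the rounding loss 1/(j+1).
  templates-bounded : ∀ m′ {p ε u v} → 0ℚᵘ ℚ.< ε →
    (∃[ J ] ∀ j → J ℕ.≤ j → exRate m′ j ℚ.≤ p) → p ℚ.+ ε ℚ.+ ε ℚ.≤ mkℚᵘ (+ u) v →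
    ∀ (t : Template k (suc m′)) → t ⊑ P → boxSize (templateBox t) ℕ.^ suc v ℕ.≤ k ℕ.^ (u ℕ.* ∣E suc m′ ∣)
  templates-bounded m′ {p} {ε} {u} {v} 0<ε (J₁ , h₁) p+2ε≤ t t⊑P = ^-cancelˡ-≤ k (suc j) (begin
    (B ℕ.^ suc v) ℕ.^ suc j              ≡⟨ ^-comm B (suc v) (suc j) ⟩
    (B ℕ.^ suc j) ℕ.^ suc v              ≤⟨ ℕ.^-monoˡ-≤ (suc v) (≤k^entropy t j) ⟩
    (k ℕ.^ (l ℕ.+ M)) ℕ.^ suc v          ≡⟨ ℕ.^-*-assoc k (l ℕ.+ M) (suc v) ⟩
    k ℕ.^ ((l ℕ.+ M) ℕ.* suc v)          ≤⟨ ℕ.^-monoʳ-≤ k (≤ℚ⁻ l+M≤) ⟩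
    k ℕ.^ (u ℕ.* M ℕ.* suc j)            ≡⟨ ℕ.^-*-assoc k (u ℕ.* M) (suc j) ⟨
    (k ℕ.^ (u ℕ.* M)) ℕ.^ suc j          ∎)
    where
    open ℕ.≤-Reasoning
    instance
      k≢0 : NonZero k
      k≢0 = ℕ.nonTrivial⇒nonZero k
    M e : ℕ
    M = ∣E suc m′ ∣
    e = e⟨Q suc m′ ⟩
    M≡e : M ≡ e
    M≡e = length-edges (suc m′)
    Ent≤ = IsMaximum.bound (proj₁ (proj₂ density) (suc m′)) (Ent t) (t , t⊑P , (λ δ 0<δ → 0 , λ n _ → ≤-+0 _ 0<δ) , (λ δ 0<δ → 0 , λ n _ → ≤-+0 _ 0<δ))
             (integer e ℚ.* ε) (e*>0 m′ 0<ε)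
    arch = archimedean ε 0<ε
    J₂ J₃ j B l : ℕ
    J₂ = proj₁ Ent≤
    J₃ = proj₁ arch
    j = J₁ ℕ.⊔ (J₂ ℕ.⊔ J₃)
    B = boxSize (templateBox t)
    l = entropy t j
    J₂⊔J₃≤j : J₂ ℕ.⊔ J₃ ℕ.≤ j
    J₂⊔J₃≤j = ℕ.m≤n⊔m J₁ (J₂ ℕ.⊔ J₃)
    l≤ : mkℚᵘ (+ l) j ℚ.≤ integer e ℚ.* (p ℚ.+ ε)
    l≤ = ℚ.≤-trans (ℚ.≤-reflexive (ℚ.≃-sym (seq-Ent t j)))
      (multiply-≤ e {{e⟨Q⟩≢0 m′}} (ℚ.≤-trans (1/e-error m′ (proj₂ Ent≤ j (ℕ.≤-trans (ℕ.m≤m⊔n J₂ J₃) J₂⊔J₃≤j)))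
        (ℚ.+-monoˡ-≤ ε (h₁ j (ℕ.m≤m⊔n J₁ (J₂ ℕ.⊔ J₃))))))
    M≤ : mkℚᵘ (+ M) j ℚ.≤ integer e ℚ.* ε
    M≤ = ℚ.≤-trans (ℚ.≤-reflexive (ℚ.≃-trans (≃ℚ⁺ {M} {j} {1 ℕ.* e} {j} (cong (ℕ._* suc j) (trans M≡e (sym (ℕ.*-identityˡ e)))))
           (ℚ.≃-sym (integer-* e 1 j))))
         (ℚ.*-monoʳ-≤-nonNeg (integer e) (proj₂ arch j (ℕ.≤-trans (ℕ.m≤n⊔m J₂ J₃) J₂⊔J₃≤j)))
    l+M≤ : mkℚᵘ (+ (l ℕ.+ M)) j ℚ.≤ mkℚᵘ (+ (u ℕ.* M)) v
    l+M≤ = ℚ-chain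
      where
      open ℚ.+-*-Solver
      ℚ-chain : mkℚᵘ (+ (l ℕ.+ M)) j ℚ.≤ mkℚᵘ (+ (u ℕ.* M)) v
      ℚ-chain = ℚ.≤-trans (ℚ.≤-reflexive (ℚ.≃-sym (mk-+ l M j))) (ℚ.≤-trans (ℚ.+-mono-≤ l≤ M≤)
        (ℚ.≤-trans (ℚ.≤-reflexive (solve 3 (λ e p d → e :* (p :+ d) :+ e :* d := e :* (p :+ d :+ d)) ℚ.≃-refl (integer e) p ε))
          (ℚ.≤-trans (ℚ.*-monoʳ-≤-nonNeg (integer e) p+2ε≤)
            (ℚ.≤-reflexive (ℚ.≃-trans (integer-* e u v) (≃ℚ⁺ {u ℕ.* e} {v} {u ℕ.* M} {v} (cong (λ m → u ℕ.* m ℕ.* suc v) (sym M≡e))))))))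

  rate≤ : ∀ {u v s} n → card (suc n) ℕ.^ (suc s ℕ.* suc v) ℕ.≤ k ℕ.^ ((u ℕ.* suc s ℕ.+ 5 ℕ.* suc v ℕ.+ suc v) ℕ.* ∣E suc n ∣) →
          ∀ j → rate n j ℚ.≤ mkℚᵘ (+ u) v ℚ.+ mkℚᵘ (+ 6) s
  rate≤ {u} {v} {s} n h j = divide-≤ e {{e⟨Q⟩≢0 n}} (begin
    logSeq k (card (suc n)) j
      ≤⟨ logSeq-≤-rational (card (suc n)) h j ⟩
    mkℚᵘ (+ (a ℕ.* ∣E suc n ∣)) (v ℕ.+ s ℕ.* suc v)
      ≃⟨ ≃ℚ⁺ {a ℕ.* ∣E suc n ∣} {v ℕ.+ s ℕ.* suc v} {b ℕ.* e} {s ℕ.+ v ℕ.* suc s}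
           (cong₂ ℕ._*_ (cong₂ ℕ._*_ a≡b (length-edges (suc n))) (ℕ.*-comm (suc v) (suc s))) ⟩
    mkℚᵘ (+ (b ℕ.* e)) (s ℕ.+ v ℕ.* suc s)
      ≃⟨ integer-* e b (s ℕ.+ v ℕ.* suc s) ⟨
    integer e ℚ.* mkℚᵘ (+ b) (s ℕ.+ v ℕ.* suc s)
      ≃⟨ ℚ.*-congˡ {integer e} (mk-+-mk u v 6 s) ⟨
    integer e ℚ.* (mkℚᵘ (+ u) v ℚ.+ mkℚᵘ (+ 6) s) ∎)
    where
    open ℚ.≤-Reasoning
    e a b : ℕ
    e = e⟨Q suc n ⟩
    a = u ℕ.* suc s ℕ.+ 5 ℕ.* suc v ℕ.+ suc v
    b = u ℕ.* suc s ℕ.+ 6 ℕ.* suc v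
    a≡b : a ≡ b
    a≡b = solve 3 (λ u s v → u :* s :+ con 5 :* v :+ v := u :* s :+ con 6 :* v) refl u (suc s) (suc v)
      where open ℕ.+-*-Solver

  -- The seven ε: one for replacing π by a rational `p` and one for returning from it, two for the
  -- distance of ex to its limit, two for `templates-bounded`, and one for 6/s.
  rate≤density : ∀ ε → 0ℚᵘ ℚ.< ε → ∃[ n₀ ] ∀ n → n₀ ℕ.≤ n → ∃[ J ] ∀ j → J ℕ.≤ j →
                 rate n j ℚ.≤ seq π j ℚ.+ (ε ℚ.+ ε ℚ.+ ε ℚ.+ ε ℚ.+ ε ℚ.+ ε ℚ.+ ε)
  rate≤density ε 0<ε = n₀ , λ n n₀≤n → J₀ , λ j J₀≤j → begin
    rate n j
      ≤⟨ rate≤ {u} {v} {s} n (proj₂ eventually (suc n) (ℕ.m≤n⇒m≤1+n n₀≤n)) j ⟩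
    mkℚᵘ (+ u) v ℚ.+ mkℚᵘ (+ 6) s
      ≤⟨ ℚ.+-mono-≤ (ℚ.≤-reflexive (ℚ.≃-reflexive (sym U≡))) (proj₂ arch s ℕ.≤-refl) ⟩
    p₃ ℚ.+ ε ℚ.+ ε ℚ.+ ε
      ≤⟨ ℚ.+-monoˡ-≤ ε (ℚ.+-monoˡ-≤ ε (ℚ.+-monoˡ-≤ ε (ℚ.+-monoˡ-≤ (ε ℚ.+ ε) (ℚ.+-monoˡ-≤ ε (proj₂ (near j J₀≤j)))))) ⟩
    seq π j ℚ.+ ε ℚ.+ ε ℚ.+ (ε ℚ.+ ε) ℚ.+ ε ℚ.+ ε ℚ.+ ε
      ≃⟨ solve 2 (λ π e → π :+ e :+ e :+ (e :+ e) :+ e :+ e :+ e := π :+ (e :+ e :+ e :+ e :+ e :+ e :+ e)) ℚ.≃-refl (seq π j) ε ⟩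
    seq π j ℚ.+ (ε ℚ.+ ε ℚ.+ ε ℚ.+ ε ℚ.+ ε ℚ.+ ε ℚ.+ ε) ∎
    where
    open ℚ.≤-Reasoning
    open ℚ.+-*-Solver
    approx = approximates π ε 0<ε
    p p₃ : ℚᵘ
    p = proj₁ approx
    p₃ = p ℚ.+ ε ℚ.+ (ε ℚ.+ ε)
    J₀ = proj₁ (proj₂ approx)
    near = proj₂ (proj₂ approx)
    conv = proj₂ (proj₂ density) ε 0<ε
    -- A single cube, of dimension `suc m′`, with ex close enough to the limit controls the rate for
    -- all large n.
    m′ = proj₁ conv
    ex-near = proj₁ (proj₂ conv m′ ℕ.≤-refl) ε 0<ε
    exRate≤ : ∃[ J ] ∀ j → J ℕ.≤ j → exRate m′ j ℚ.≤ p₃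
    exRate≤ = J₀ ℕ.⊔ proj₁ ex-near , λ j J≤j → ℚ.≤-trans
      (≤-drop-minus (exRate m′ j) (seq π j) (ε ℚ.+ ε) (proj₂ ex-near j (ℕ.m⊔n≤o⇒n≤o J₀ _ J≤j)))
      (ℚ.+-monoˡ-≤ (ε ℚ.+ ε) (proj₁ (near j (ℕ.m⊔n≤o⇒m≤o J₀ _ J≤j))))
    -- The bound has to be a fraction with natural numerator for use as an exponent; it is
    -- nonnegative because the entropy of the extremal template is.
    U≥0 : 0ℚᵘ ℚ.≤ p₃ ℚ.+ ε ℚ.+ ε
    U≥0 = begin
      0ℚᵘ                             ≤⟨ ℚ.nonNegative⁻¹ _ {{ℚ.nonNeg*nonNeg⇒nonNeg (1/e m′) {{1/e≥0 e⟨Q suc m′ ⟩ {{e⟨Q⟩≢0 m′}}}} (mkℚᵘ (+ entropy t j) j)}} ⟩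
      1/e m′ ℚ.* mkℚᵘ (+ entropy t j) j ≃⟨ ℚ.*-congˡ {1/e m′} (seq-Ent t j) ⟨
      1/e m′ ℚ.* seq (Ent t) j        ≤⟨ 1/e-error m′ (proj₂ Ent≤ex j (ℕ.m≤m⊔n _ _)) ⟩
      exRate m′ j ℚ.+ ε               ≤⟨ ℚ.+-monoˡ-≤ ε (proj₂ exRate≤ j (ℕ.m≤n⊔m (proj₁ Ent≤ex) _)) ⟩
      p₃ ℚ.+ ε                        ≤⟨ ≤-+0 (p₃ ℚ.+ ε) 0<ε ⟩
      p₃ ℚ.+ ε ℚ.+ ε                  ∎
      where
      extremal = IsMaximum.attained (proj₁ (proj₂ density) (suc m′))
      t = proj₁ extremal
      Ent≤ex = proj₂ (proj₂ (proj₂ extremal)) (integer e⟨Q suc m′ ⟩ ℚ.* ε) (e*>0 m′ 0<ε)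
      j = proj₁ Ent≤ex ℕ.⊔ proj₁ exRate≤
    open Naturals (nonNegative (p₃ ℚ.+ ε ℚ.+ ε) U≥0) renaming (num to u; den to v; is to U≡)
    arch = archimedean* 6 ε 0<ε
    s = proj₁ arch
    open Upper.Search {P = P} cardinality her card>0 (suc m′) u (suc v) (suc s) (s≤s z≤n)
      (templates-bounded m′ {p₃} {ε} {u} {v} 0<ε exRate≤ (ℚ.≤-reflexive (ℚ.≃-reflexive U≡))) using (eventually)
    n₀ = proj₁ eventually

  private
    seventh : ℚᵘ → ℚᵘ
    seventh ε = mkℚᵘ (+ 1) 6 ℚ.* ε

    seventh>0 : ∀ {ε} → 0ℚᵘ ℚ.< ε → 0ℚᵘ ℚ.< seventh ε
    seventh>0 {ε} 0<ε = ℚ.positive⁻¹ _ {{ℚ.pos*pos⇒pos (mkℚᵘ (+ 1) 6) ε {{ℚ.positive 0<ε}}}}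

    7*seventh : ∀ ε → let δ = seventh ε in δ ℚ.+ δ ℚ.+ δ ℚ.+ δ ℚ.+ δ ℚ.+ δ ℚ.+ δ ℚ.≃ ε
    7*seventh ε = ℚ.≃-trans
      (solve 2 (λ s e → s :* e :+ s :* e :+ s :* e :+ s :* e :+ s :* e :+ s :* e :+ s :* e
                        := (s :+ s :+ s :+ s :+ s :+ s :+ s) :* e) ℚ.≃-refl (mkℚᵘ (+ 1) 6) ε)
      (ℚ.≃-trans (ℚ.*-congʳ {ε} (*≡* {s ℚ.+ s ℚ.+ s ℚ.+ s ℚ.+ s ℚ.+ s ℚ.+ s} {1ℚᵘ} refl)) (ℚ.*-identityˡ ε))
      where
      open ℚ.+-*-Solver
      s = mkℚᵘ (+ 1) 6

    3≤7 : ∀ {δ} → 0ℚᵘ ℚ.< δ → δ ℚ.+ δ ℚ.+ δ ℚ.≤ δ ℚ.+ δ ℚ.+ δ ℚ.+ δ ℚ.+ δ ℚ.+ δ ℚ.+ δ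
    3≤7 {δ} 0<δ = ℚ.≤-trans (ℚ.≤-trans (≤-+0 x 0<δ) (≤-+0 (x ℚ.+ δ) 0<δ))
      (ℚ.≤-trans (≤-+0 (x ℚ.+ δ ℚ.+ δ) 0<δ) (≤-+0 (x ℚ.+ δ ℚ.+ δ ℚ.+ δ) 0<δ))
      where x = δ ℚ.+ δ ℚ.+ δ

  -- For positive n this solves log card = e (π + o). At 0 the factor e(Q_0) = 0 annihilates the
  -- exponent, so the value there is a mere default.
  o : ℕ → ℝ
  o zero    = 0ᵣ
  o (suc n) = 1/e n • log k (card (suc n)) -ᵣ π

  o⟶0 : o ⟶ 0ᵣ
  o⟶0 ε 0<ε = suc (proj₁ above ℕ.⊔ proj₁ below) , bounds
    where
    above = rate≤density (seventh ε) (seventh>0 0<ε)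
    below = density≤rate (seventh ε) (seventh>0 0<ε)
    bounds : ∀ n → suc (proj₁ above ℕ.⊔ proj₁ below) ℕ.≤ n → o n -ᵣ 0ᵣ ≤ᵣ fromℚ ε × 0ᵣ -ᵣ o n ≤ᵣ fromℚ ε
    bounds (suc n) (s≤s n₀≤n) = over , under
      where
      open ℚ.≤-Reasoning
      open ℚ.+-*-Solver
      h₁ = proj₂ above n (ℕ.m⊔n≤o⇒m≤o (proj₁ above) (proj₁ below) n₀≤n)
      h₂ = proj₂ below n (ℕ.m⊔n≤o⇒n≤o (proj₁ above) (proj₁ below) n₀≤n)
      over : o (suc n) -ᵣ 0ᵣ ≤ᵣ fromℚ ε
      over δ 0<δ = proj₁ h₁ , λ j J≤j → begin
        rate n j ℚ.- seq π j ℚ.- 0ℚᵘ   ≃⟨ solve 1 (λ x → x :- con 0ℚᵘ := x) ℚ.≃-refl (rate n j ℚ.- seq π j) ⟩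
        rate n j ℚ.- seq π j           ≤⟨ ≤-minus (rate n j) (seq π j) ε (ℚ.≤-trans (proj₂ h₁ j J≤j)
                                            (ℚ.+-monoʳ-≤ (seq π j) (ℚ.≤-reflexive (7*seventh ε)))) ⟩
        ε                              ≤⟨ ≤-+0 ε 0<δ ⟩
        ε ℚ.+ δ                        ∎
      under : 0ᵣ -ᵣ o (suc n) ≤ᵣ fromℚ ε
      under δ 0<δ = proj₁ h₂ , λ j J≤j → begin
        0ℚᵘ ℚ.- (rate n j ℚ.- seq π j) ≃⟨ solve 2 (λ x y → con 0ℚᵘ :- (x :- y) := y :- x) ℚ.≃-refl (rate n j) (seq π j) ⟩
        seq π j ℚ.- rate n j           ≤⟨ ≤-minus (seq π j) (rate n j) ε (ℚ.≤-trans (proj₂ h₂ j J≤j)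
                                            (ℚ.+-monoʳ-≤ (rate n j) (ℚ.≤-trans (3≤7 (seventh>0 0<ε)) (ℚ.≤-reflexive (7*seventh ε))))) ⟩
        ε                              ≤⟨ ≤-+0 ε 0<δ ⟩
        ε ℚ.+ δ                        ∎

  -- `Q_0` has no edges and hence only the empty colouring.
  log-card-0 : ∀ j → logSeq k (card 0) j ℚ.≃ 0ℚᵘ
  log-card-0 j = ℚ.≤-antisym
    (logSeq-≤-rational (card 0) {0} {0}
      (ℕ.≤-trans (ℕ.≤-reflexive (ℕ.^-identityʳ (card 0))) (Bounds.card≤k^e {P = P} cardinality 0)) j)
    (≤ℚ⁺ {0} {0} {⌊log⌋ k (card 0 ℕ.^ suc j)} {j} z≤n)

  vanish : ∀ j → (+ 0 / 1) ℚ.* (seq π j ℚ.+ 0ℚᵘ) ℚ.≃ 0ℚᵘ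
  vanish j = ℚ.*-zeroˡ (seq π j ℚ.+ 0ℚᵘ)

  log-card-0≃ : ∀ j → logSeq k (card 0) j ℚ.≃ (+ 0 / 1) ℚ.* (seq π j ℚ.+ 0ℚᵘ)
  log-card-0≃ j = ℚ.≃-trans (log-card-0 j) (ℚ.≃-sym (vanish j))

  card≡-zero : card 0 ≡ k ^ᵣ (+ e⟨Q 0 ⟩ / 1) • (π +ᵣ o 0)
  card≡-zero = ≡^ᵣ-cong (log k (card 0)) ((+ e⟨Q 0 ⟩ / 1) • (π +ᵣ o 0)) log-card-0≃ (^ᵣ-log k (card 0))

  -- The exponent agrees with the logarithm of `card (suc n)` term by term, and that logarithm
  -- solves the equation by `^ᵣ-log`.
  card≡-suc : ∀ n → card (suc n) ≡ k ^ᵣ (+ e⟨Q suc n ⟩ / 1) • (π +ᵣ o (suc n))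
  card≡-suc n = ≡^ᵣ-cong (log k (card (suc n))) ((+ e⟨Q suc n ⟩ / 1) • (π +ᵣ o (suc n)))
    (λ j → rescale (1/e n) (integer e⟨Q suc n ⟩) (logSeq k (card (suc n)) j) (seq π j)
             (1/e*e e⟨Q suc n ⟩ {{e⟨Q⟩≢0 n}}))
    (^ᵣ-log k (card (suc n)))

  card≡ : ∀ n → card n ≡ k ^ᵣ (+ e⟨Q n ⟩ / 1) • (π +ᵣ o n)
  card≡ = ℕ-cases (λ n → card n ≡ k ^ᵣ (+ e⟨Q n ⟩ / 1) • (π +ᵣ o n)) card≡-zero card≡-suc

corollary3p16 : (k : ℕ) .{{_ : NonTrivial k}}
    (P : Property k) → OrderHereditary P → (∀ n → ∃ (mem P n)) →
    (π : ℝ) → IsDensity P π →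
    (card : ℕ → ℕ) → (∀ n → HasCardinality P n (card n)) →
    Σ (ℕ → ℝ) λ o → o ⟶ 0ᵣ ×
    (∀ n → card n ≡ k ^ᵣ (+ e⟨Q n ⟩ / 1) • (π +ᵣ o n))
corollary3p16 k P her inhabited π density card cardinality = o , o⟶0 , card≡
  where open Density k P her inhabited π density card cardinality
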